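{- Let $\{\lambda,\underline m\}$ be a pointed knapsack partition of $n$ with $m>0$, where $\lambda$ has $k$ parts. The cycles $g_{\alpha,\vec d}=\sum_{\gamma\in\mathfrak S^c_{\vec d}}\sum_{\vec c\in W(\vec d)}(-1)^\gamma(-1)^{\vec c}\,\sigma(\alpha\circ\gamma,\vec c)$, where $\vec d$ ranges over $V(\lambda,\underline m)$ and $\alpha$ ranges over all permutations in $\mathfrak S_n$ with descent composition $\vec d$, form a basis for the homology group $\widetilde H_{k-1}(\Lambda_{\{\lambda,\underline m\}})$.
   Context: A knapsack partition is a multiset $\lambda=\{\lambda_1^{e_1},\dots,\lambda_q^{e_q}\}$ of positive integers ($\lambda_i$ distinct) such that the sums $\sum f_i\lambda_i$, $0\le f_i\le e_i$, are pairwise distinct; a pointed knapsack partition $\{\lambda,\underline m\}$ of $n$ adds an integer $m\ge0$ with total sum $n$. Pointed set partitions of $[n]$: $\{B_1,\dots,B_j,\underline Z\}$, $Z\subseteq[n]$ possibly empty, $B_i$ nonempty partitioning $[n]\setminus Z$; type = multiset $\{|B_i|\}$ with pointed number $|Z|$; $\Pi^\bullet_n$ ordered by $\pi\le\pi'$ iff each non-pointed block of $\pi$ lies in a block of $\pi'$ and the pointed block of $\pi$ lies in that of $\pi'$. $\Pi^\bullet_{\{\lambda,\underline m\}}$ is the filter generated by pointed set partitions of type $\{\lambda,\underline m\}$. An ordered set partition of $[n]$ is $(C_1,\dots,C_r)$, disjoint with union $[n]$, $C_1,\dots,C_{r-1}$ nonempty, $C_r$ possibly empty; $\Delta_n$ has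 these as faces ($(C_1,\dots,C_r)$ of dimension $r-2$, faces by merging consecutive blocks, $([n])$ empty face); $\Lambda_{\{\lambda,\underline m\}}$ is the subcomplex of $(C_1,\dots,C_r)$ with $\{C_1,\dots,C_{r-1},\underline{C_r}\}\in\Pi^\bullet_{\{\lambda,\underline m\}}$. Chains: $\partial(C_1,\dots,C_r)=\sum_{i=1}^{r-1}(-1)^{i-1}(C_1,\dots,C_i\cup C_{i+1},\dots,C_r)$; reduced homology with coefficients in a fixed field. Pointed compositions $(c_1,\dots,c_r)$ ($c_i\ge1$ for $i<r$, $c_r\ge0$, sum $n$) are ordered by $\vec c\le\vec d$ iff $\vec d$ arises by replacing runs of consecutive entries by their sums; type = multiset $\{c_1,\dots,c_{r-1}\}$ with pointed $c_r$. With $F$ the filter generated by compositions of type $\{\lambda,\underline m\}$, $V(\lambda,\underline m)$ is the set of $\vec d=(d_1,\dots,d_r)\in F$ with $d_r=m$ and each $d_i$ ($i<r$) a sum of parts of $\lambda$ of pairwise distinct values. $\epsilon(\vec d)$ replaces each $d_i$ ($i<r$) by the strictly decreasing list of parts of $\lambda$ summing to it (using all parts of $\lambda$), keeping last part $m$. $W(\vec d)=\{\vec c\in V(\lambda,\underline m):\vec c\le\vec d,\ \operatorname{type}(\vec c)=\{\lambda,\underline m\}\}$; for $\vec c\in W(\vec d)$, each $d_i$ splits into $t_i$ consecutive parts of $\vec c$ that are a rearrangement of the corresponding parts of $\epsilon(\vec d)$, via a unique $\rho\in\mathfrak S_{t_1}\times\cdots\times\mathfrak S_{t_r}$, and $(-1)^{\vec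 c}=\operatorname{sign}(\rho)$. For $\alpha\in\mathfrak S_n$ and $\vec c=(c_1,\dots,c_s)$, $\sigma(\alpha,\vec c)=(\{\alpha_j:j\in R_1\},\dots,\{\alpha_j:j\in R_s\})$, $R_i=[c_1+\dots+c_{i-1}+1,c_1+\dots+c_i]$; $\alpha\circ\gamma$ is $j\mapsto\alpha_{\gamma(j)}$; $(-1)^\gamma$ is the sign. Descent composition of $\alpha$ with descent set $\{s_1<\dots<s_{p-1}\}$: $(s_1,s_2-s_1,\dots,n-s_{p-1})$. For $\vec d=(d_1,\dots,d_r)$, the column intervals $K_1,\dots,K_{n-r+1}$ are the maximal intervals of $[n]$ such that $j,j+1$ lie in the same interval iff $j\in\{d_1,d_1+d_2,\dots,d_1+\dots+d_{r-1}\}$, and $\mathfrak S^c_{\vec d}=\mathfrak S_{K_1}\times\cdots\times\mathfrak S_{K_{n-r+1}}$. -}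

module Defs where

open import Level using (_⊔_) renaming (suc to lsuc)
open import Algebra.Bundles using (CommutativeRing)
open import Data.Nat using (ℕ; zero; suc; _+_; _∸_; _<_; _≤?_; _<?_; pred)
open import Data.Nat.Properties using (_≟_)
open import Data.Bool using (Bool; true; false; if_then_else_)
open import Data.List using (List; []; _∷_; [_]; _++_; map; concat; concatMap; filter;
  upTo; length; deduplicate; take; drop; reverse)
open import Data.Nat.ListAction using (sum)
open import Data.Bool.ListAction using (any)
open import Data.List.Properties using (≡-dec)
open import Data.List.Relation.Unary.All using (All)
open import Data.List.Relation.Unary.Any using (Any)
open import Data.List.Relation.Unary.Unique.Propositional using (Unique)
open import Data.List.Relation.Binary.Permutation.Propositional using (_↭_)
open import Data.List.Relation.Binary.Subset.Propositional using (_⊆_)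
open import Data.Product using (Σ; ∃; ∃₂; _×_; _,_; proj₁; proj₂)
open import Relation.Nullary using (¬_; ⌊_⌋)
open import Relation.Binary.PropositionalEquality using (_≡_)

record Field c ℓ : Set (lsuc (c ⊔ ℓ)) where
  field
    commutativeRing : CommutativeRing c ℓ
  open CommutativeRing commutativeRing public
  field
    0≉1       : ¬ (0# ≈ 1#)
    inverseOf : ∀ x → ¬ (x ≈ 0#) → Σ Carrier λ y → x * y ≈ 1#

NonEmpty : List ℕ → Set
NonEmpty xs = 0 < length xs

at : List ℕ → ℕ → ℕ
at []       _       = 0
at (x ∷ xs) zero    = x
at (x ∷ xs) (suc i) = at xs i

insertℕ : ℕ → List ℕ → List ℕ
insertℕ x []       = [ x ]
insertℕ x (y ∷ ys) = if ⌊ x Data.Nat.≤? y ⌋ then x ∷ y ∷ ys else y ∷ insertℕ x ys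

-- increasing sort (canonical representative of a finite set of ℕ)
sortℕ : List ℕ → List ℕ
sortℕ []       = []
sortℕ (x ∷ xs) = insertℕ x (sortℕ xs)

sortDesc : List ℕ → List ℕ
sortDesc xs = reverse (sortℕ xs)

indexOf : ℕ → List ℕ → ℕ
indexOf x []       = 0
indexOf x (y ∷ ys) = if ⌊ x ≟ y ⌋ then 0 else suc (indexOf x ys)

countLess : ℕ → List ℕ → ℕ
countLess x []       = 0
countLess x (y ∷ ys) = (if ⌊ y <? x ⌋ then 1 else 0) + countLess x ys

inversions : List ℕ → ℕ
inversions []       = 0
inversions (x ∷ xs) = countLess x xs + inversions xs

insertions : ℕ → List ℕ → List (List ℕ)
insertions x []       = [ [ x ] ]
insertions x (y ∷ ys) = (x ∷ y ∷ ys) ∷ map (y ∷_) (insertions x ys)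

perms : List ℕ → List (List ℕ)
perms []       = [ [] ]
perms (x ∷ xs) = concatMap (insertions x) (perms xs)

choices : List (List (List ℕ)) → List (List ℕ)
choices []            = [ [] ]
choices (opts ∷ rest) = concatMap (λ o → map (o ++_) (choices rest)) opts

extCut : ℕ → List (List ℕ) → List (List (List ℕ))
extCut x []       = [ [ [ x ] ] ]
extCut x (s ∷ ss) = ([ x ] ∷ s ∷ ss) ∷ ((x ∷ s) ∷ ss) ∷ []

cuts : List ℕ → List (List (List ℕ))
cuts []       = [ [] ]
cuts (x ∷ xs) = concatMap (extCut x) (cuts xs)

-- Knapsack partitions (λ given as the list of its parts, with repetition)

SubMultiset : List ℕ → List ℕ → Set
SubMultiset μ la = ∃ λ ν → (μ ++ ν) ↭ la

IsKnapsack : List ℕ → Set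
IsKnapsack la =
  All (λ x → 0 < x) la ×
  (∀ μ μ′ → SubMultiset μ la → SubMultiset μ′ la → sum μ ≡ sum μ′ → μ ↭ μ′)

IsPComp : ℕ → List ℕ → Set
IsPComp n c = ∃₂ λ cs x → c ≡ cs ++ [ x ] × All (λ y → 0 < y) cs × sum c ≡ n

_≼_ : List ℕ → List ℕ → Set
c ≼ d = ∃ λ segs → concat segs ≡ c × All NonEmpty segs × map sum segs ≡ d

HasType : List ℕ → ℕ → List ℕ → Set
HasType la m c = ∃₂ λ cs x → c ≡ cs ++ [ x ] × cs ↭ la × x ≡ m

InF : ℕ → List ℕ → ℕ → List ℕ → Set
InF n la m d = IsPComp n d × ∃ λ c → IsPComp n c × HasType la m c × c ≼ d

InV : ℕ → List ℕ → ℕ → List ℕ → Set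
InV n la m d =
  InF n la m d ×
  ∃ λ ds → d ≡ ds ++ [ m ] ×
    All (λ x → ∃ λ μ → SubMultiset μ la × Unique μ × sum μ ≡ x) ds

-- Permutations of [n] (0-based one-line notation) and descent compositions

IsPerm : ℕ → List ℕ → Set
IsPerm n α = α ↭ upTo n

-- descent set ⊆ {1,…,n-1} (1-based): s with α_s > α_{s+1}
descentSet : ℕ → List ℕ → List ℕ
descentSet n α = filter (λ s → at α s <? at α (s ∸ 1)) (map suc (upTo (pred n)))

diffs : ℕ → List ℕ → List ℕ
diffs prev []       = []
diffs prev (x ∷ xs) = (x ∸ prev) ∷ diffs x xs

descComp : ℕ → List ℕ → List ℕ
descComp n α = diffs 0 (descentSet n α ++ [ n ])

-- Ordered set partitions (faces of Δₙ); blocks are stored sorted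

Face : Set
Face = List (List ℕ)

IsOSP : ℕ → Face → Set
IsOSP n F =
  (∃₂ λ Cs Cr → F ≡ Cs ++ [ Cr ] × All NonEmpty Cs) ×
  All (λ B → sortℕ B ≡ B) F ×
  concat F ↭ upTo n

-- F = (C₁,…,C_r) with {C₁,…,C_{r-1},C_r pointed} in the filter generated
-- by pointed set partitions of type {λ, m}
InΛ : ℕ → List ℕ → ℕ → Face → Set
InΛ n la m F =
  ∃₂ λ Cs Cr → F ≡ Cs ++ [ Cr ] ×
  ∃₂ λ Bs Z →
    (concat Bs ++ Z) ↭ upTo n × All NonEmpty Bs ×
    map length Bs ↭ la × length Z ≡ m ×
    All (λ B → Any (λ C → B ⊆ C) F) Bs × Z ⊆ Cr

ΛFace : ℕ → List ℕ → ℕ → Face → Set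
ΛFace n la m F = IsOSP n F × InΛ n la m F

chunks : List ℕ → List ℕ → List (List ℕ)
chunks α []       = []
chunks α (c ∷ cs) = take c α ∷ chunks (drop c α) cs

sigma : List ℕ → List ℕ → Face
sigma α c = map sortℕ (chunks α c)

compose : List ℕ → List ℕ → List ℕ
compose α γ = map (at α) γ

merges : Face → List Face
merges (C₁ ∷ C₂ ∷ rest) = (sortℕ (C₁ ++ C₂) ∷ rest) ∷ map (C₁ ∷_) (merges (C₂ ∷ rest))
merges _                = []

partialSums : ℕ → List ℕ → List ℕ
partialSums acc []       = []
partialSums acc (x ∷ xs) = (acc + x) ∷ partialSums (acc + x) xs

initL : List ℕ → List ℕ
initL []           = []
initL (x ∷ [])     = []
initL (x ∷ y ∷ ys) = x ∷ initL (y ∷ ys)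

groupBy : (ℕ → Bool) → List ℕ → List ℕ → List (List ℕ)
groupBy p cur []       = [ cur ]
groupBy p cur (i ∷ is) = if p i then groupBy p (cur ++ [ i ]) is else cur ∷ groupBy p [ i ] is

-- 0-based positions i-1, i (1-based j = i, j+1) are joined iff i ∈ {d₁, d₁+d₂, …}
columnIntervals : ℕ → List ℕ → List (List ℕ)
columnIntervals zero    d = []
columnIntervals (suc n) d =
  groupBy (λ i → any (λ s → ⌊ s ≟ i ⌋) (partialSums 0 (initL d))) [ 0 ] (map suc (upTo n))

-- elements of 𝔖ᶜ_d in one-line notation
colPerms : ℕ → List ℕ → List (List ℕ)
colPerms n d = choices (map perms (columnIntervals n d))

Wpairs : List ℕ → ℕ → List ℕ → List (List ℕ × List (List ℕ))
Wpairs la m d =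
  concatMap
    (λ cs → map (λ segs → (cs ++ [ m ]) , segs)
               (filter (λ segs → ≡-dec _≟_ (map sum segs) d) (cuts (cs ++ [ m ]))))
    (deduplicate (≡-dec _≟_) (perms la))

-- ρ for one segment: the segment is a rearrangement of the strictly
-- decreasing list of the same parts (the corresponding piece of ε(d))
rhoSeg : List ℕ → List ℕ
rhoSeg seg = map (λ x → indexOf x (sortDesc seg)) seg

module Chains {c ℓ} (K : Field c ℓ) where
  open Field K renaming (_+_ to _+ᴷ_; _*_ to _*ᴷ_)

  Chain : Set c
  Chain = List (Carrier × Face)

  signOf : ℕ → Carrier
  signOf zero    = 1#
  signOf (suc k) = - signOf k

  alt : Carrier → List Face → Chain
  alt s []       = []
  alt s (F ∷ Fs) = (s , F) ∷ alt (- s) Fs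

  ∂ : Chain → Chain
  ∂ []             = []
  ∂ ((a , F) ∷ xs) = alt a (merges F) ++ ∂ xs

  coeff : Chain → Face → Carrier
  coeff []             G = 0#
  coeff ((a , F) ∷ xs) G = (if ⌊ ≡-dec (≡-dec _≟_) F G ⌋ then a else 0#) +ᴷ coeff xs G

  _≈ᶜ_ : Chain → Chain → Set ℓ
  x ≈ᶜ y = ∀ G → coeff x G ≈ coeff y G

  IsZeroChain : Chain → Set ℓ
  IsZeroChain x = ∀ G → coeff x G ≈ 0#

  -- chain supported on faces satisfying P with exactly r blocks
  -- (i.e. of dimension r - 2)
  ChainIn : (Face → Set) → ℕ → Chain → Set c
  ChainIn P r z = All (λ p → P (proj₂ p) × length (proj₂ p) ≡ r) z

  scale : Carrier → Chain → Chain
  scale a z = map (λ p → (a *ᴷ proj₁ p) , proj₂ p) z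

  combo : {I : Set} → (I → Chain) → List (Carrier × I) → Chain
  combo g xs = concatMap (λ p → scale (proj₁ p) (g (proj₂ p))) xs

  HomologyBasis : (Face → Set) → ℕ → {I : Set} → (I → Set) → (I → Chain) → Set (c ⊔ ℓ)
  HomologyBasis P r {I} Idx g =
    (∀ i → Idx i → ChainIn P r (g i) × IsZeroChain (∂ (g i))) ×
    (∀ (xs : List (Carrier × I)) (b : Chain) →
       All (λ p → Idx (proj₂ p)) xs → Unique (map proj₂ xs) →
       ChainIn P (suc r) b → combo g xs ≈ᶜ ∂ b →
       All (λ p → proj₁ p ≈ 0#) xs) ×
    (∀ (z : Chain) → ChainIn P r z → IsZeroChain (∂ z) →
       ∃₂ λ (xs : List (Carrier × I)) (b : Chain) →
         All (λ p → Idx (proj₂ p)) xs × ChainIn P (suc r) b ×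
         z ≈ᶜ (combo g xs ++ ∂ b))

  signW : List (List ℕ) → Carrier
  signW segs = signOf (sum (map (λ s → inversions (rhoSeg s)) segs))

  gCycle : ℕ → List ℕ → ℕ → List ℕ → List ℕ → Chain
  gCycle n la m d α =
    concatMap
      (λ γ → map (λ w → (signOf (inversions γ) *ᴷ signW (proj₂ w)) ,
                         sigma (compose α γ) (proj₁ w))
                 (Wpairs la m d))
      (colPerms n d)

GIndex : ℕ → List ℕ → ℕ → List ℕ × List ℕ → Set
GIndex n la m (d , α) = InV n la m d × IsPerm n α × descComp n α ≡ d

module Submission where

-- Since m > 0, the complex has no faces above dimension k - 1, so the homology in question is the
-- space of cycles. Order the top faces by the number of inversions of the word obtained by
-- concatenating the blocks, and then by the number of inversions of the list of block sizes.
--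
-- Call a top face a non-pivot if it has adjacent blocks C, C′ such that C C′ is increasing and
-- either |C| ≤ |C′| or C′ is the pointed block. The knapsack condition forces every top face
-- above the facet that merges C and C′ to arise by splitting at the same position, and the
-- non-pivot is strictly minimal among them; hence the coefficient of a cycle at a non-pivot is
-- determined by its coefficients at larger faces. The remaining top faces are exactly the faces
-- σ(α, ε(d)), and σ(α, ε(d)) is the largest term of g_{α,d}, with coefficient ±1, because
-- permuting a decreasing column or sorting a block lowers the number of inversions. Triangularity
-- gives independence, and elimination from the top gives generation.
--
-- The g_{α,d} are cycles by a sign-reversing involution for each merging position: if the position
-- is interior to a part of d, exchange the two merged (distinct) parts of c; otherwise it ends a
-- part of d, and the two values of αγ next to it are exchanged, which stays inside a column.

import Level
open import Defs
open import Data.Bool using (if_then_else_; true; false)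
open import Data.Bool.ListAction using (any)
open import Data.Nat
open import Data.Nat.Properties
open import Data.Nat.ListAction using (sum)
open import Data.Nat.ListAction.Properties using (sum-↭; sum-++)
open import Data.List hiding (sum; find; any; last; merge)
open import Data.List.Properties hiding (sum-++)
open import Data.List.Membership.Propositional using (_∈_; find)
open import Data.List.Membership.Propositional.Properties
  using (∈-∃++; ∈-++⁺ˡ; ∈-++⁺ʳ; ∈-++⁻; ∈-map⁺; ∈-map⁻; ∈-concatMap⁺; ∈-deduplicate⁺; ∈-deduplicate⁻; ∈-filter⁺; ∈-filter⁻;
    ∈-cartesianProduct⁺; ∈-cartesianProduct⁻; ∈-concat⁺′; ∈-concat⁻′)
open import Data.List.Relation.Unary.All as All using (All; []; _∷_)
import Data.List.Relation.Unary.All.Properties as Allₚ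
open import Data.List.Relation.Unary.Any as Any using (Any; here; there)
open import Data.List.Relation.Unary.AllPairs as AllPairs using (AllPairs; []; _∷_)
import Data.List.Relation.Unary.AllPairs.Properties as AllPairsₚ
open import Data.List.Relation.Unary.Unique.Propositional using (Unique)
open import Data.List.Relation.Binary.Pointwise as Pointwise using (Pointwise; []; _∷_)
open import Data.List.Relation.Binary.Permutation.Propositional using (_↭_; ↭-sym; ↭-trans; ↭-refl; ↭-reflexive; prep; swap)
  renaming (refl to ↭refl; trans to ↭trans)
open import Data.List.Relation.Binary.Permutation.Propositional.Properties
  using (All-resp-↭; Any-resp-↭; ∈-resp-↭; ↭-singleton-inv; shifts; ↭-length; shift; drop-∷; drop-mid; ↭-reverse;
      ↭-empty-inv)
  renaming (map⁺ to ↭-map⁺; ++⁺ to ↭-++⁺)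
open import Data.Product using (Σ; ∃; ∃₂; _×_; _,_; proj₁; proj₂)
open import Data.Sum using (_⊎_; inj₁; inj₂)
open import Function using (_∘_)
open import Relation.Binary.Definitions using (tri<; tri≈; tri>)
open import Relation.Nullary using (¬_; ¬?; ⌊_⌋; Dec; yes; no; contradiction)
open import Relation.Binary.PropositionalEquality hiding ([_])
import Data.List.Relation.Unary.Unique.Propositional.Properties as Uniqueₚ
import Data.List.Relation.Unary.Unique.DecPropositional.Properties as DecUniqueₚ
import Algebra.Properties.Ring as RingProperties
import Relation.Binary.Reasoning.Setoid as SetoidReasoning

-- Word inversions alone do not suffice: two top faces above the same facet may have the same word
-- and differ only in which of two sizes comes first. The inversions of the size list break this
-- tie. They also single out the leading term among those with trivial γ, all of which have the word
-- α. In both places the case of equality must be controlled together with the inequality, so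
-- comparisons run through one relation: equal, or a rearrangement with strictly fewer inversions.
-- Positivity of `m` gives the pointed block a first value. An exchange across the last merging
-- position therefore stays inside the merged block, and the pointed block can be the last ascending
-- run of a word. A chain is a list in which a face may recur, so chains are studied through their
-- pairings with functions on faces; coefficients and boundary coefficients are both of this kind.

private variable
  x y : ℕ
  xs ys zs xs′ ys′ : List ℕ
  xss yss : List (List ℕ)

-- Sorting and inversions

Asc Desc : List ℕ → Set
Asc  = AllPairs _≤_
Desc = AllPairs _>_

insertℕ-↭ : ∀ x xs → insertℕ x xs ↭ x ∷ xs
insertℕ-↭ x []       = ↭-refl
insertℕ-↭ x (y ∷ ys) with x ≤? y
... | yes _ = ↭-refl
... | no _  = ↭-trans (prep y (insertℕ-↭ x ys)) (swap y x ↭-refl)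

sortℕ-↭ : ∀ xs → sortℕ xs ↭ xs
sortℕ-↭ []       = ↭-refl
sortℕ-↭ (x ∷ xs) = ↭-trans (insertℕ-↭ x (sortℕ xs)) (prep x (sortℕ-↭ xs))

insertℕ-asc : ∀ x {xs} → Asc xs → Asc (insertℕ x xs)
insertℕ-asc x []                  = [] ∷ []
insertℕ-asc x {y ∷ ys} (y≤ ∷ asc) with x ≤? y
... | yes x≤y = (x≤y ∷ All.map (≤-trans x≤y) y≤) ∷ y≤ ∷ asc
... | no x≰y  = All-resp-↭ (↭-sym (insertℕ-↭ x ys)) (<⇒≤ (≰⇒> x≰y) ∷ y≤) ∷ insertℕ-asc x asc

sortℕ-asc : ∀ xs → Asc (sortℕ xs)
sortℕ-asc []       = []
sortℕ-asc (x ∷ xs) = insertℕ-asc x (sortℕ-asc xs)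

asc-↭⇒≡ : Asc xs → Asc ys → xs ↭ ys → xs ≡ ys
asc-↭⇒≡ {[]}     {ys}     _ _ p = sym (↭-empty-inv (↭-sym p))
asc-↭⇒≡ {x ∷ xs} {[]}     _ _ p = ↭-empty-inv p
asc-↭⇒≡ {x ∷ xs} {y ∷ ys} (x≤ ∷ ax) (y≤ ∷ ay) p
  with ≤-antisym (All.lookup (≤-refl ∷ x≤) (∈-resp-↭ (↭-sym p) (here refl)))
                 (All.lookup (≤-refl ∷ y≤) (∈-resp-↭ p (here refl)))
... | refl = cong (x ∷_) (asc-↭⇒≡ ax ay (drop-∷ p))

sortℕ-cong : xs ↭ ys → sortℕ xs ≡ sortℕ ys
sortℕ-cong {xs} {ys} p = asc-↭⇒≡ (sortℕ-asc xs) (sortℕ-asc ys)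
  (↭-trans (sortℕ-↭ xs) (↭-trans p (↭-sym (sortℕ-↭ ys))))

sortℕ-fix : Asc xs → sortℕ xs ≡ xs
sortℕ-fix {xs} asc = asc-↭⇒≡ (sortℕ-asc xs) asc (sortℕ-↭ xs)

countLess-↭ : ∀ x → xs ↭ ys → countLess x xs ≡ countLess x ys
countLess-↭ x ↭refl        = refl
countLess-↭ x (prep y p)   = cong (_ +_) (countLess-↭ x p)
countLess-↭ x (swap {xs} {ys} y z p) = trans (cong (λ t → a + (b + t)) (countLess-↭ x p))
  (trans (sym (+-assoc a b _)) (trans (cong (_+ countLess x ys) (+-comm a b)) (+-assoc b a _)))
  where
  a = if ⌊ y <? x ⌋ then 1 else 0
  b = if ⌊ z <? x ⌋ then 1 else 0
countLess-↭ x (↭trans p q) = trans (countLess-↭ x p) (countLess-↭ x q)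

countLess-++ : ∀ x xs ys → countLess x (xs ++ ys) ≡ countLess x xs + countLess x ys
countLess-++ x []       ys = refl
countLess-++ x (y ∷ xs) ys = trans (cong (a +_) (countLess-++ x xs ys)) (sym (+-assoc a (countLess x xs) (countLess x ys)))
  where a = if ⌊ y <? x ⌋ then 1 else 0

crossings : List ℕ → List ℕ → ℕ
crossings xs ys = sum (map (λ x → countLess x ys) xs)

crossings-↭ : xs ↭ xs′ → ys ↭ ys′ → crossings xs ys ≡ crossings xs′ ys′
crossings-↭ {xs′ = xs′} p q = trans (sum-↭ (↭-map⁺ _ p)) (cong sum (map-cong (λ x → countLess-↭ x q) xs′))

inversions-++ : ∀ xs ys → inversions (xs ++ ys) ≡ inversions xs + inversions ys + crossings xs ys
inversions-++ []       ys = sym (+-identityʳ _)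
inversions-++ (x ∷ xs) ys rewrite countLess-++ x xs ys | inversions-++ xs ys = lem (countLess x xs) _ (inversions xs) _ _
  where
  open import Data.Nat.Solver using (module +-*-Solver)
  open +-*-Solver
  lem : ∀ a b c d e → a + b + (c + d + e) ≡ a + c + d + (b + e)
  lem = solve 5 (λ a b c d e → a :+ b :+ (c :+ d :+ e) := a :+ c :+ d :+ (b :+ e)) refl

infix 4 _⊑_
-- A partial order on the arrangements of one multiset in which ties in the inversion number are
-- equalities. Maximality and uniqueness of a maximal arrangement are thus carried together.
_⊑_ : List ℕ → List ℕ → Set
xs ⊑ ys = xs ↭ ys × (inversions xs < inversions ys ⊎ xs ≡ ys)

⊑-refl : xs ⊑ xs
⊑-refl = ↭-refl , inj₂ refl

⊑-reflexive : xs ≡ ys → xs ⊑ ys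
⊑-reflexive refl = ⊑-refl

⊑-trans : xs ⊑ ys → ys ⊑ zs → xs ⊑ zs
⊑-trans (p , inj₁ a)    (q , inj₁ b)    = ↭-trans p q , inj₁ (<-trans a b)
⊑-trans (p , inj₁ a)    (q , inj₂ refl) = ↭-trans p q , inj₁ a
⊑-trans (p , inj₂ refl) q               = q

⊑⇒≤ : xs ⊑ ys → inversions xs ≤ inversions ys
⊑⇒≤ (_ , inj₁ a)    = <⇒≤ a
⊑⇒≤ (_ , inj₂ refl) = ≤-refl

⊑-antisym : xs ⊑ ys → inversions ys ≤ inversions xs → xs ≡ ys
⊑-antisym (_ , inj₁ a)  b = contradiction a (≤⇒≯ b)
⊑-antisym (_ , inj₂ eq) _ = eq

⊑-strict : xs ⊑ ys → xs ≢ ys → inversions xs < inversions ys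
⊑-strict (_ , inj₁ h)  _  = h
⊑-strict (_ , inj₂ eq) ne = contradiction eq ne

-- Holds because the inversions between two segments depend only on their contents.
⊑-++ : xs ⊑ ys → xs′ ⊑ ys′ → xs ++ xs′ ⊑ ys ++ ys′
⊑-++ {xs} {ys} {xs′} {ys′} s@(p , r) s′@(p′ , r′) = ↭-++⁺ p p′ , go r r′
  where
  lt : inversions xs + inversions xs′ < inversions ys + inversions ys′ →
       inversions (xs ++ xs′) < inversions (ys ++ ys′)
  lt h rewrite inversions-++ xs xs′ | inversions-++ ys ys′ | crossings-↭ p p′ = +-monoˡ-< _ h
  go : inversions xs < inversions ys ⊎ xs ≡ ys → inversions xs′ < inversions ys′ ⊎ xs′ ≡ ys′ →
       inversions (xs ++ xs′) < inversions (ys ++ ys′) ⊎ xs ++ xs′ ≡ ys ++ ys′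
  go (inj₁ a)    _           = inj₁ (lt (+-mono-<-≤ a (⊑⇒≤ s′)))
  go (inj₂ _)    (inj₁ b)    = inj₁ (lt (+-mono-≤-< (⊑⇒≤ s) b))
  go (inj₂ refl) (inj₂ refl) = inj₂ refl

⊑-concat : Pointwise _⊑_ xss yss → concat xss ⊑ concat yss
⊑-concat []       = ⊑-refl
⊑-concat (p ∷ ps) = ⊑-++ p (⊑-concat ps)

asc⇒inversions≡0 : Asc xs → inversions xs ≡ 0
asc⇒inversions≡0 []             = refl
asc⇒inversions≡0 {x ∷ xs} (h ∷ asc) = trans (cong (countLess x xs +_) (asc⇒inversions≡0 asc)) (trans (+-identityʳ _)
    (none h))
  where
  none : ∀ {ys} → All (x ≤_) ys → countLess x ys ≡ 0
  none []                 = refl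
  none {y ∷ ys} (x≤y ∷ h) with y <? x
  ... | yes y<x = contradiction y<x (≤⇒≯ x≤y)
  ... | no _    = none h

inversions≡0⇒asc : ∀ xs → inversions xs ≡ 0 → Asc xs
inversions≡0⇒asc []       _  = []
inversions≡0⇒asc (x ∷ xs) eq = none xs (m+n≡0⇒m≡0 _ eq) ∷ inversions≡0⇒asc xs (m+n≡0⇒n≡0 (countLess x xs) eq)
  where
  none : ∀ ys → countLess x ys ≡ 0 → All (x ≤_) ys
  none []       _  = []
  none (y ∷ ys) eq with y <? x
  ... | no y≮x = ≮⇒≥ y≮x ∷ none ys eq

-- Having no inversions characterises ascending lists, and a multiset has only one ascending
-- arrangement.
asc⇒⊑ : Asc xs → xs ↭ ys → xs ⊑ ys
asc⇒⊑ {xs} {ys} asc p = p , go (inversions ys) refl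
  where
  go : ∀ k → inversions ys ≡ k → inversions xs < inversions ys ⊎ xs ≡ ys
  go zero    eq = inj₂ (asc-↭⇒≡ asc (inversions≡0⇒asc ys eq) p)
  go (suc k) eq = inj₁ (subst₂ _<_ (sym (asc⇒inversions≡0 asc)) (sym eq) (z<s {n = k}))


sortℕ-⊑ : ∀ xs → sortℕ xs ⊑ xs
sortℕ-⊑ xs = asc⇒⊑ (sortℕ-asc xs) (sortℕ-↭ xs)

swap-⊑ : ∀ zs → x < y → x ∷ y ∷ zs ⊑ y ∷ x ∷ zs
swap-⊑ {x} {y} zs x<y = swap x y ↭-refl , inj₁ lt
  where
  lt : inversions (x ∷ y ∷ zs) < inversions (y ∷ x ∷ zs)
  lt with y <? x | x <? y
  ... | yes y<x | _       = contradiction y<x (<⇒≯ x<y)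
  ... | no _    | no x≮y  = contradiction x<y x≮y
  ... | no _    | yes _   = s≤s (≤-reflexive (trans (sym (+-assoc (countLess x zs) _ _))
      (trans (cong (_+ inversions zs) (+-comm (countLess x zs) (countLess y zs))) (+-assoc (countLess y zs) _ _))))

-- The maximum `y` travels left through `xs` by adjacent exchanges, each of which creates an
-- inversion.
extract-max-⊑ : ∀ xs ys → All (_< y) xs → xs ++ y ∷ ys ⊑ y ∷ xs ++ ys
extract-max-⊑ []       ys []      = ⊑-refl
extract-max-⊑ (x ∷ xs) ys (h ∷ hs) =
  ⊑-trans (⊑-++ {xs = [ x ]} ⊑-refl (extract-max-⊑ xs ys hs)) (swap-⊑ (xs ++ ys) h)

-- Selection sort: the largest entry moves to the front and the rest is treated recursively. This is
-- the source of maximality both for α among its column rearrangements and for ε(d) within W(d).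
desc⇒⊑ : Desc ys → xs ↭ ys → xs ⊑ ys
desc⇒⊑ []                     p = ⊑-reflexive (↭-empty-inv p)
desc⇒⊑ {y ∷ ys} (y> ∷ desc) p with ∈-∃++ (∈-resp-↭ (↭-sym p) (here refl))
... | as , bs , refl = ⊑-trans (extract-max-⊑ as bs (Allₚ.++⁻ˡ as (All-resp-↭ (↭-sym q) y>)))
                               (⊑-++ {xs = [ y ]} ⊑-refl (desc⇒⊑ desc q))
  where q = drop-mid as [] p

-- A crude bound is enough; it determines the multiplier in `key`.
inversions≤ : ∀ xs → inversions xs ≤ length xs * length xs
inversions≤ []       = z≤n
inversions≤ (x ∷ xs) = +-mono-≤ (m≤n⇒m≤1+n (count≤ xs)) (≤-trans (inversions≤ xs) (*-monoʳ-≤ (length xs) (n≤1+n _)))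
  where
  count≤ : ∀ ys → countLess x ys ≤ length ys
  count≤ []       = z≤n
  count≤ (y ∷ ys) with y <? x
  ... | yes _ = s≤s (count≤ ys)
  ... | no _  = m≤n⇒m≤1+n (count≤ ys)

-- Adjacent transpositions

-- Out of range this is the identity, so `swapAt-involutive` and `swapAt-↭` need no side condition.
swapAt : ∀ {a} {A : Set a} → ℕ → List A → List A
swapAt zero    (x ∷ y ∷ zs) = y ∷ x ∷ zs
swapAt (suc i) (x ∷ xs)     = x ∷ swapAt i xs
swapAt _       xs           = xs

module _ {a} {A : Set a} where

  swapAt-involutive : ∀ i (xs : List A) → swapAt i (swapAt i xs) ≡ xs
  swapAt-involutive zero    []           = refl
  swapAt-involutive zero    (x ∷ [])     = refl
  swapAt-involutive zero    (x ∷ y ∷ zs) = refl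
  swapAt-involutive (suc i) []           = refl
  swapAt-involutive (suc i) (x ∷ xs)     = cong (x ∷_) (swapAt-involutive i xs)

  swapAt-↭ : ∀ i (xs : List A) → swapAt i xs ↭ xs
  swapAt-↭ zero    []           = ↭-refl
  swapAt-↭ zero    (x ∷ [])     = ↭-refl
  swapAt-↭ zero    (x ∷ y ∷ zs) = swap y x ↭-refl
  swapAt-↭ (suc i) []           = ↭-refl
  swapAt-↭ (suc i) (x ∷ xs)     = prep x (swapAt-↭ i xs)

  swapAt-++ˡ : ∀ i (xs ys : List A) → suc i < length xs → swapAt i (xs ++ ys) ≡ swapAt i xs ++ ys
  swapAt-++ˡ zero    (x ∷ y ∷ xs) ys _       = refl
  swapAt-++ˡ zero    (x ∷ [])     ys (s≤s ())
  swapAt-++ˡ (suc i) (x ∷ xs)     ys (s≤s h) = cong (x ∷_) (swapAt-++ˡ i xs ys h)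

  swapAt-++ʳ : ∀ i (xs ys : List A) → swapAt (length xs + i) (xs ++ ys) ≡ xs ++ swapAt i ys
  swapAt-++ʳ i []       ys = refl
  swapAt-++ʳ i (x ∷ xs) ys = cong (x ∷_) (swapAt-++ʳ i xs ys)

map-swapAt : ∀ {a b} {A : Set a} {B : Set b} (f : A → B) i xs → map f (swapAt i xs) ≡ swapAt i (map f xs)
map-swapAt f zero    []           = refl
map-swapAt f zero    (x ∷ [])     = refl
map-swapAt f zero    (x ∷ y ∷ zs) = refl
map-swapAt f (suc i) []           = refl
map-swapAt f (suc i) (x ∷ xs)     = cong (f x ∷_) (map-swapAt f i xs)

-- A sharp form of opposite parity: it flips `signOf`, and it excludes equality, which shows that an
-- exchange moves its argument.
Neighbours : ℕ → ℕ → Set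
Neighbours a b = a ≡ suc b ⊎ b ≡ suc a

-- Counts against all other entries depend only on contents, so only the exchanged pair matters;
-- being distinct, it is inverted in exactly one of its two orders.
inversions-swapAt : ∀ i {xs} → Unique xs → suc i < length xs →
  Neighbours (inversions (swapAt i xs)) (inversions xs)
inversions-swapAt zero {x ∷ y ∷ zs} ((x≢y ∷ _) ∷ _) _ with x <? y | y <? x
... | yes _   | no _    = inj₁ (cong suc lem)
  where lem = trans (sym (+-assoc (countLess y zs) _ _)) (trans (cong (_+ inversions zs)
                (+-comm (countLess y zs) (countLess x zs))) (+-assoc (countLess x zs) _ _))
... | no _    | yes _   = inj₂ (cong suc lem)
  where lem = trans (sym (+-assoc (countLess x zs) _ _)) (trans (cong (_+ inversions zs)
                (+-comm (countLess x zs) (countLess y zs))) (+-assoc (countLess y zs) _ _))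
... | yes a   | yes b   = contradiction b (<⇒≯ a)
... | no a    | no b    = contradiction (≤-antisym (≮⇒≥ b) (≮⇒≥ a)) x≢y
inversions-swapAt zero {x ∷ []} _ (s≤s ())
inversions-swapAt (suc i) {x ∷ xs} (_ ∷ u) (s≤s h)
  rewrite countLess-↭ x (swapAt-↭ i xs) with inversions-swapAt i u h
... | inj₁ eq = inj₁ (trans (cong (countLess x xs +_) eq) (+-suc _ _))
... | inj₂ eq = inj₂ (trans (cong (countLess x xs +_) eq) (+-suc _ _))

-- Lists without repetition

unique-⊆-length : ∀ {a} {A : Set a} {xs ys : List A} → Unique xs → (∀ {x} → x ∈ xs → x ∈ ys) → length xs ≤ length ys
unique-⊆-length {xs = []}     _       _ = z≤n
unique-⊆-length {xs = x ∷ xs} (n ∷ u) s with ∈-∃++ (s (here refl))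
... | as , bs , refl = subst (suc (length xs) ≤_) (sym (↭-length (shift x as bs))) (s≤s (unique-⊆-length u sub))
  where
  sub : ∀ {z} → z ∈ xs → z ∈ as ++ bs
  sub z∈ with ∈-++⁻ as (s (there z∈))
  ... | inj₁ q           = ∈-++⁺ˡ q
  ... | inj₂ (here refl) = contradiction refl (All.lookup n z∈)
  ... | inj₂ (there q)   = ∈-++⁺ʳ as q

unique-↭ : ∀ {a} {A : Set a} {xs ys : List A} → xs ↭ ys → Unique xs → Unique ys
unique-↭ ↭refl        u                       = u
unique-↭ (prep x p)   (h ∷ u)                 = All-resp-↭ p h ∷ unique-↭ p u
unique-↭ (swap x y p) ((x≢y ∷ hx) ∷ hy ∷ u)   = ((x≢y ∘ sym) ∷ All-resp-↭ p hy) ∷ All-resp-↭ p hx ∷ unique-↭ p u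
unique-↭ (↭trans p q) u                       = unique-↭ q (unique-↭ p u)

-- Enumerations

∈-concatMap-intro : ∀ {a b} {A : Set a} {B : Set b} (f : A → List B) {x y xs} → x ∈ xs → y ∈ f x → y ∈ concatMap f xs
∈-concatMap-intro f {y = y} x∈ y∈ = ∈-concatMap⁺ f (Any.map (λ eq → subst (λ z → y ∈ f z) eq y∈) x∈)

∈-concatMap-elim : ∀ {a b} {A : Set a} {B : Set b} (f : A → List B) xs {y} → y ∈ concatMap f xs →
  ∃ λ x → x ∈ xs × y ∈ f x
∈-concatMap-elim f (x ∷ xs) y∈ with ∈-++⁻ (f x) y∈
... | inj₁ h = x , here refl , h
... | inj₂ h with ∈-concatMap-elim f xs h
...   | z , z∈ , h′ = z , there z∈ , h′

-- The retraction `g` recovers from each output the input that produced it, so different inputs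
-- share no output. The uniqueness of `perms`, `choices`, `cuts` and `Wpairs` is obtained this way.
concatMap-unique : ∀ {a b} {A : Set a} {B : Set b} (f : A → List B) (g : B → A) {xs} → Unique xs →
  (∀ {x} → x ∈ xs → Unique (f x)) → (∀ {x y} → x ∈ xs → y ∈ f x → g y ≡ x) → Unique (concatMap f xs)
concatMap-unique f g {[]}     _       _ _ = []
concatMap-unique f g {x ∷ xs} (n ∷ u) h r = Uniqueₚ.++⁺ (h (here refl))
  (concatMap-unique f g u (h ∘ there) (r ∘ there)) disj
  where
  disj : ∀ {y} → ¬ (y ∈ f x × y ∈ concatMap f xs)
  disj (y∈ , y∈′) with ∈-concatMap-elim f xs y∈′
  ... | z , z∈ , y∈z = All.lookup n z∈ (trans (sym (r (here refl) y∈)) (r (there z∈) y∈z))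

insertions-↭ : ∀ x ys {zs} → zs ∈ insertions x ys → zs ↭ x ∷ ys
insertions-↭ x []       (here refl) = ↭-refl
insertions-↭ x (y ∷ ys) (here refl) = ↭-refl
insertions-↭ x (y ∷ ys) (there p) with ∈-map⁻ (y ∷_) p
... | zs , q , refl = ↭-trans (prep y (insertions-↭ x ys q)) (swap y x ↭-refl)

∈-insertions : ∀ x as bs → as ++ x ∷ bs ∈ insertions x (as ++ bs)
∈-insertions x []       []       = here refl
∈-insertions x []       (b ∷ bs) = here refl
∈-insertions x (a ∷ as) bs       = there (∈-map⁺ (a ∷_) (∈-insertions x as bs))

perms⁻ : ∀ xs → ys ∈ perms xs → ys ↭ xs
perms⁻ []       (here refl) = ↭-refl
perms⁻ (x ∷ xs) p with ∈-concatMap-elim (insertions x) (perms xs) p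
... | zs , q , r = ↭-trans (insertions-↭ x zs r) (prep x (perms⁻ xs q))

perms⁺ : ∀ xs → ys ↭ xs → ys ∈ perms xs
perms⁺ []       p rewrite ↭-empty-inv p = here refl
perms⁺ (x ∷ xs) p with ∈-∃++ (∈-resp-↭ (↭-sym p) (here refl))
... | as , bs , refl = ∈-concatMap-intro (insertions x) (perms⁺ xs (drop-mid as [] p)) (∈-insertions x as bs)

deleteℕ : ℕ → List ℕ → List ℕ
deleteℕ x = filter (λ y → ¬? (x ≟ y))

delete-fresh : All (x ≢_) ys → deleteℕ x ys ≡ ys
delete-fresh = filter-all _

insertions-delete : ∀ x ys {zs} → All (x ≢_) ys → zs ∈ insertions x ys → deleteℕ x zs ≡ ys
insertions-delete x []       _ (here refl) = filter-reject (λ y → ¬? (x ≟ y)) (λ h → h refl)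
insertions-delete x (y ∷ ys) h (here refl) = trans (filter-reject (λ y → ¬? (x ≟ y)) (λ h → h refl)) (delete-fresh h)
insertions-delete x (y ∷ ys) (x≢y ∷ h) (there p) with ∈-map⁻ (y ∷_) p
... | zs , q , refl = trans (filter-accept (λ y → ¬? (x ≟ y)) x≢y) (cong (y ∷_) (insertions-delete x ys h q))

insertions-unique : ∀ x ys → All (x ≢_) ys → Unique (insertions x ys)
insertions-unique x []       _         = [] ∷ []
insertions-unique x (y ∷ ys) (x≢y ∷ h) =
  Allₚ.map⁺ (All.tabulate λ _ eq → x≢y (∷-injectiveˡ eq)) ∷ Uniqueₚ.map⁺ ∷-injectiveʳ (insertions-unique x ys h)

perms-unique : ∀ {xs} → Unique xs → Unique (perms xs)
perms-unique []                = [] ∷ []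
perms-unique {x ∷ xs} (n ∷ u) = concatMap-unique (insertions x) (deleteℕ x) (perms-unique u)
  (λ {ys} p → insertions-unique x ys (fresh p)) (λ {ys} p q → insertions-delete x ys (fresh p) q)
  where
  fresh : ∀ {ys} → ys ∈ perms xs → All (x ≢_) ys
  fresh p = All-resp-↭ (↭-sym (perms⁻ xs p)) n

choices-perms⁻ : ∀ Ks {γ} → γ ∈ choices (map perms Ks) → ∃ λ γs → Pointwise _↭_ γs Ks × concat γs ≡ γ
choices-perms⁻ []       (here refl) = [] , [] , refl
choices-perms⁻ (K ∷ Ks) p with ∈-concatMap-elim (λ o → map (o ++_) (choices (map perms Ks))) (perms K) p
... | o , o∈ , q with ∈-map⁻ (o ++_) q
...   | _ , r , refl with choices-perms⁻ Ks r
...     | γs , ps , refl = o ∷ γs , perms⁻ K o∈ ∷ ps , refl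

choices-perms⁺ : ∀ {γs Ks} → Pointwise _↭_ γs Ks → concat γs ∈ choices (map perms Ks)
choices-perms⁺ []                        = here refl
choices-perms⁺ {o ∷ _} {K ∷ Ks} (p ∷ ps) =
  ∈-concatMap-intro (λ o → map (o ++_) (choices (map perms Ks))) (perms⁺ K p) (∈-map⁺ (o ++_) (choices-perms⁺ ps))

take-length-++ : ∀ {a} {A : Set a} (xs ys : List A) → take (length xs) (xs ++ ys) ≡ xs
take-length-++ []       ys = refl
take-length-++ (x ∷ xs) ys = cong (x ∷_) (take-length-++ xs ys)

drop-length-++ : ∀ {a} {A : Set a} (xs ys : List A) → drop (length xs) (xs ++ ys) ≡ ys
drop-length-++ []       ys = refl
drop-length-++ (x ∷ xs) ys = drop-length-++ xs ys

choices-perms-unique : ∀ Ks → All Unique Ks → Unique (choices (map perms Ks))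
choices-perms-unique []       _        = [] ∷ []
choices-perms-unique (K ∷ Ks) (u ∷ us) = concatMap-unique (λ o → map (o ++_) (choices (map perms Ks)))
  (take (length K)) (perms-unique u)
  (λ {o} _ → Uniqueₚ.map⁺ (++-cancelˡ o _ _) (choices-perms-unique Ks us)) retract
  where
  retract : ∀ {o γ} → o ∈ perms K → γ ∈ map (o ++_) (choices (map perms Ks)) → take (length K) γ ≡ o
  retract {o} o∈ p with ∈-map⁻ (o ++_) p
  ... | ys , _ , refl rewrite sym (↭-length (perms⁻ K o∈)) = take-length-++ o ys

cuts⁻ : ∀ c {segs} → segs ∈ cuts c → concat segs ≡ c × All NonEmpty segs
cuts⁻ []      (here refl) = refl , []
cuts⁻ (x ∷ c) p with ∈-concatMap-elim (extCut x) (cuts c) p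
... | ss , ss∈ , q with cuts⁻ c ss∈
cuts⁻ (x ∷ c) p | []     , _ , here refl         | refl , []     = refl , z<s ∷ []
cuts⁻ (x ∷ c) p | s ∷ ss , _ , here refl         | refl , h      = refl , z<s ∷ h
cuts⁻ (x ∷ c) p | s ∷ ss , _ , there (here refl) | refl , _ ∷ h  = refl , z<s ∷ h

cuts⁺ : ∀ segs → All NonEmpty segs → segs ∈ cuts (concat segs)
cuts⁺ []                       _       = here refl
cuts⁺ ([] ∷ _)                 (() ∷ _)
cuts⁺ ((x ∷ []) ∷ [])          _       = here refl
cuts⁺ ((x ∷ []) ∷ s ∷ ss)      (_ ∷ h) = ∈-concatMap-intro (extCut x) (cuts⁺ (s ∷ ss) h) (here refl)
cuts⁺ ((x ∷ y ∷ s) ∷ ss)       (_ ∷ h) = ∈-concatMap-intro (extCut x) (cuts⁺ ((y ∷ s) ∷ ss) (z<s ∷ h)) (there (here refl))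

-- The retraction for `extCut`: a singleton first segment was added whole, a longer one was extended
-- by its first entry. It is a left inverse only on cuts into nonempty segments.
uncut : List (List ℕ) → List (List ℕ)
uncut ((x ∷ y ∷ s) ∷ ss) = (y ∷ s) ∷ ss
uncut (_ ∷ ss)           = ss
uncut []                 = []

cuts-unique : ∀ c → Unique (cuts c)
cuts-unique []      = [] ∷ []
cuts-unique (x ∷ c) = concatMap-unique (extCut x) uncut (cuts-unique c) (λ {ss} p → ext-unique ss)
  (λ {ss} p → retract ss (proj₂ (cuts⁻ c p)))
  where
  ext-unique : ∀ ss → Unique (extCut x ss)
  ext-unique []       = [] ∷ []
  ext-unique (s ∷ ss) = ((λ eq → n≢1+n (cong length (∷-injectiveʳ eq))) ∷ []) ∷ [] ∷ []
    where
    n≢1+n : ∀ {n} → suc n ≢ n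
    n≢1+n = 1+n≢n
  retract : ∀ ss {ts} → All NonEmpty ss → ts ∈ extCut x ss → uncut ts ≡ ss
  retract []             _       (here refl)         = refl
  retract (s ∷ ss)       _       (here refl)         = refl
  retract ((y ∷ s) ∷ ss) _       (there (here refl)) = refl
  retract ([] ∷ ss)      (() ∷ _) _

initL-∷ʳ : ∀ xs x → initL (xs ++ [ x ]) ≡ xs
initL-∷ʳ []           x = refl
initL-∷ʳ (y ∷ [])     x = refl
initL-∷ʳ (y ∷ z ∷ xs) x = cong (y ∷_) (initL-∷ʳ (z ∷ xs) x)

module _ (la : List ℕ) (m : ℕ) (d : List ℕ) where

  private
    cutsOf : List ℕ → List (List ℕ × List (List ℕ))
    cutsOf cs = map (λ segs → (cs ++ [ m ]) , segs)
                    (filter (λ segs → ≡-dec _≟_ (map sum segs) d) (cuts (cs ++ [ m ])))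

    cutsOf⁻ : ∀ cs {w} → w ∈ cutsOf cs →
      proj₁ w ≡ cs ++ [ m ] × concat (proj₂ w) ≡ cs ++ [ m ] × All NonEmpty (proj₂ w) × map sum (proj₂ w) ≡ d
    cutsOf⁻ cs p with ∈-map⁻ (λ segs → (cs ++ [ m ]) , segs) p
    ... | segs , q , refl with ∈-filter⁻ (λ segs → ≡-dec _≟_ (map sum segs) d) {xs = cuts (cs ++ [ m ])} q
    ...   | r , eq with cuts⁻ _ r
    ...     | eq′ , h = refl , eq′ , h , eq

  Wpairs⁻ : ∀ {w} → w ∈ Wpairs la m d → ∃ λ cs → proj₁ w ≡ cs ++ [ m ] × cs ↭ la ×
    concat (proj₂ w) ≡ cs ++ [ m ] × All NonEmpty (proj₂ w) × map sum (proj₂ w) ≡ d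
  Wpairs⁻ p with ∈-concatMap-elim cutsOf (deduplicate (≡-dec _≟_) (perms la)) p
  ... | cs , cs∈ , q with cutsOf⁻ cs q
  ...   | e₁ , e₂ , h , e₃ = cs , e₁ , perms⁻ la (∈-deduplicate⁻ (≡-dec _≟_) (perms la) cs∈) , e₂ , h , e₃

  Wpairs⁺ : ∀ cs segs → cs ↭ la → concat segs ≡ cs ++ [ m ] → All NonEmpty segs → map sum segs ≡ d →
    (cs ++ [ m ] , segs) ∈ Wpairs la m d
  Wpairs⁺ cs segs p e h eq = ∈-concatMap-intro cutsOf (∈-deduplicate⁺ (≡-dec _≟_) (perms⁺ la p))
    (∈-map⁺ (λ segs → (cs ++ [ m ]) , segs)
      (∈-filter⁺ (λ segs → ≡-dec _≟_ (map sum segs) d) (subst (λ c → segs ∈ cuts c) e (cuts⁺ segs h)) eq))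

  Wpairs-unique : Unique (Wpairs la m d)
  Wpairs-unique = concatMap-unique cutsOf (initL ∘ proj₁) (DecUniqueₚ.deduplicate-! (≡-dec _≟_) (perms la))
    (λ {cs} _ → Uniqueₚ.map⁺ (cong proj₂) (Uniqueₚ.filter⁺ _ (cuts-unique (cs ++ [ m ]))))
    (λ {cs} _ q → trans (cong initL (proj₁ (cutsOf⁻ cs q))) (initL-∷ʳ cs m))

-- Linear algebra of chains

-- One entry of `merges`, indexed by its position: the boundary becomes a sum over positions that
-- can be interchanged with a sum over terms.
mergeAt : ℕ → Face → Face
mergeAt zero    (C₁ ∷ C₂ ∷ F) = sortℕ (C₁ ++ C₂) ∷ F
mergeAt (suc j) (C ∷ F)       = C ∷ mergeAt j F
mergeAt _       F             = F

merges-mergeAt : ∀ F → merges F ≡ applyUpTo (λ j → mergeAt j F) (pred (length F))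
merges-mergeAt []            = refl
merges-mergeAt (C ∷ [])      = refl
merges-mergeAt (C ∷ C′ ∷ F) = cong (mergeAt 0 (C ∷ C′ ∷ F) ∷_)
  (trans (cong (map (C ∷_)) (merges-mergeAt (C′ ∷ F))) (map-applyUpTo _ (C ∷_) (length F)))

_≟F_ : (F G : Face) → Dec (F ≡ G)
_≟F_ = ≡-dec (≡-dec _≟_)

module ChainAlgebra {c ℓ} (K : Field c ℓ) where

  module R = Field K
  open R using (Carrier; _≈_; 0#; 1#; -_) renaming (_+_ to _⊕_; _*_ to _⊛_)
  open RingProperties R.ring using (-‿involutive; -0#≈0#; -‿distribˡ-*; -‿distribʳ-*)
  open Chains K
  open SetoidReasoning R.setoid

  private variable
    a : Level.Level
    A : Set a

  sumK : (A → Carrier) → List A → Carrier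
  sumK f []       = 0#
  sumK f (x ∷ xs) = f x ⊕ sumK f xs

  sumK-zero : ∀ {f : A → Carrier} {xs} → All (λ x → f x ≈ 0#) xs → sumK f xs ≈ 0#
  sumK-zero []       = R.refl
  sumK-zero (h ∷ hs) = R.trans (R.+-cong h (sumK-zero hs)) (R.+-identityˡ 0#)

  sumK-cong : ∀ {f g : A → Carrier} {xs} → All (λ x → f x ≈ g x) xs → sumK f xs ≈ sumK g xs
  sumK-cong []       = R.refl
  sumK-cong (h ∷ hs) = R.+-cong h (sumK-cong hs)

  sumK-++ : ∀ (f : A → Carrier) xs ys → sumK f (xs ++ ys) ≈ sumK f xs ⊕ sumK f ys
  sumK-++ f []       ys = R.sym (R.+-identityˡ _)
  sumK-++ f (x ∷ xs) ys = R.trans (R.+-congˡ (sumK-++ f xs ys)) (R.sym (R.+-assoc _ _ _))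

  +-exchange : ∀ a b c d → (a ⊕ b) ⊕ (c ⊕ d) ≈ (a ⊕ c) ⊕ (b ⊕ d)
  +-exchange a b c d = begin
    (a ⊕ b) ⊕ (c ⊕ d) ≈⟨ R.+-assoc _ _ _ ⟩
    a ⊕ (b ⊕ (c ⊕ d)) ≈⟨ R.+-congˡ (R.sym (R.+-assoc _ _ _)) ⟩
    a ⊕ ((b ⊕ c) ⊕ d) ≈⟨ R.+-congˡ (R.+-congʳ (R.+-comm _ _)) ⟩
    a ⊕ ((c ⊕ b) ⊕ d) ≈⟨ R.+-congˡ (R.+-assoc _ _ _) ⟩
    a ⊕ (c ⊕ (b ⊕ d)) ≈⟨ R.sym (R.+-assoc _ _ _) ⟩
    (a ⊕ c) ⊕ (b ⊕ d) ∎

  sumK-+ : ∀ (f g : A → Carrier) xs → sumK (λ x → f x ⊕ g x) xs ≈ sumK f xs ⊕ sumK g xs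
  sumK-+ f g []       = R.sym (R.+-identityˡ _)
  sumK-+ f g (x ∷ xs) = R.trans (R.+-congˡ (sumK-+ f g xs)) (+-exchange _ _ _ _)

  sumK-* : ∀ b (f : A → Carrier) xs → sumK (λ x → b ⊛ f x) xs ≈ b ⊛ sumK f xs
  sumK-* b f []       = R.sym (R.zeroʳ b)
  sumK-* b f (x ∷ xs) = R.trans (R.+-congˡ (sumK-* b f xs)) (R.sym (R.distribˡ b _ _))

  sumK-map : ∀ {b} {B : Set b} (f : B → Carrier) (h : A → B) xs → sumK f (map h xs) ≈ sumK (f ∘ h) xs
  sumK-map f h []       = R.refl
  sumK-map f h (x ∷ xs) = R.+-congˡ (sumK-map f h xs)

  -- `n` bounds the length, because the recursion removes `x` together with `τ x` from an arbitrary
  -- place. Vanishing at fixed points is a separate condition: in characteristic two it does not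
  -- follow from the sign rule.
  sumK-involution : ∀ (f : A → Carrier) (τ : A → A) n xs → length xs ≤ n → Unique xs →
    (∀ {x} → x ∈ xs → τ x ∈ xs) → (∀ {x} → x ∈ xs → τ (τ x) ≡ x) → (∀ {x} → x ∈ xs → f (τ x) ≈ - f x) →
    (∀ {x} → x ∈ xs → τ x ≡ x → f x ≈ 0#) → sumK f xs ≈ 0#
  sumK-involution f τ n       []       _         _       _  _   _   _   = R.refl
  sumK-involution f τ (suc n) (x ∷ xs) (s≤s len) (n∉ ∷ u) cl inv sgn fix with cl (here refl)
  ... | here eq = begin
    f x ⊕ sumK f xs ≈⟨ R.+-cong (fix (here refl) eq) (sumK-involution f τ n xs len u cl′ (inv ∘ there) (sgn ∘ there)
        (fix ∘ there)) ⟩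
    0# ⊕ 0#         ≈⟨ R.+-identityˡ 0# ⟩
    0#              ∎
    where
    cl′ : ∀ {y} → y ∈ xs → τ y ∈ xs
    cl′ {y} y∈ with cl (there y∈)
    ... | there p  = p
    ... | here eq′ = contradiction (trans (sym eq) (trans (cong τ (sym eq′)) (inv (there y∈)))) (All.lookup n∉ y∈)
  ... | there τx∈ with ∈-∃++ τx∈
  ...   | as , bs , refl = begin
    f x ⊕ sumK f (as ++ τ x ∷ bs)                ≈⟨ R.+-congˡ (sumK-++ f as _) ⟩
    f x ⊕ (sumK f as ⊕ (f (τ x) ⊕ sumK f bs))    ≈⟨ R.+-congˡ (R.sym (R.+-assoc _ _ _)) ⟩
    f x ⊕ ((sumK f as ⊕ f (τ x)) ⊕ sumK f bs)    ≈⟨ R.+-congˡ (R.+-congʳ (R.+-comm _ _)) ⟩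
    f x ⊕ ((f (τ x) ⊕ sumK f as) ⊕ sumK f bs)    ≈⟨ R.+-congˡ (R.+-assoc _ _ _) ⟩
    f x ⊕ (f (τ x) ⊕ (sumK f as ⊕ sumK f bs))    ≈⟨ R.sym (R.+-assoc _ _ _) ⟩
    (f x ⊕ f (τ x)) ⊕ (sumK f as ⊕ sumK f bs)    ≈⟨ R.+-cong (R.trans (R.+-congˡ (sgn (here refl))) (R.-‿inverseʳ _))
        (R.sym (sumK-++ f as bs)) ⟩
    0# ⊕ sumK f (as ++ bs)                       ≈⟨ R.+-congˡ ih ⟩
    0# ⊕ 0#                                      ≈⟨ R.+-identityˡ 0# ⟩
    0#                                           ∎
    where
    u′ : Unique (τ x ∷ as ++ bs)
    u′ = unique-↭ (shift (τ x) as bs) u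
    up : ∀ {y} → y ∈ as ++ bs → y ∈ as ++ τ x ∷ bs
    up = ∈-resp-↭ (↭-sym (shift (τ x) as bs)) ∘ there
    cl′ : ∀ {y} → y ∈ as ++ bs → τ y ∈ as ++ bs
    cl′ {y} y∈ with cl (there (up y∈))
    ... | here eq = contradiction (trans (cong τ (sym eq)) (inv (there (up y∈)))) (All.lookup (AllPairs.head u′) y∈)
    ... | there p with ∈-resp-↭ (shift (τ x) as bs) p
    ...   | there q = q
    ...   | here eq = contradiction (trans (sym (inv (here refl))) (trans (cong τ (sym eq)) (inv (there (up y∈)))))
                        (All.lookup n∉ (up y∈))
    ih : sumK f (as ++ bs) ≈ 0#
    ih = sumK-involution f τ n (as ++ bs)
      (≤-trans (n≤1+n _) (≤-trans (≤-reflexive (sym (↭-length (shift (τ x) as bs)))) len)) (AllPairs.tail u′) cl′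
      (inv ∘ there ∘ up) (sgn ∘ there ∘ up) (fix ∘ there ∘ up)

  sumTo : ℕ → (ℕ → Carrier) → Carrier
  sumTo zero    h = 0#
  sumTo (suc n) h = h 0 ⊕ sumTo n (h ∘ suc)

  sumTo-zero : ∀ n {h} → (∀ {i} → i < n → h i ≈ 0#) → sumTo n h ≈ 0#
  sumTo-zero zero    _ = R.refl
  sumTo-zero (suc n) z = R.trans (R.+-cong (z z<s) (sumTo-zero n (z ∘ s<s))) (R.+-identityˡ 0#)

  sumTo-single : ∀ {n j h} → j < n → (∀ {i} → i < n → i ≢ j → h i ≈ 0#) → sumTo n h ≈ h j
  sumTo-single {suc n} {zero}  j<n       z = R.trans (R.+-congˡ (sumTo-zero n (λ i<n → z (s<s i<n) λ ()))) (R.+-identityʳ _)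
  sumTo-single {suc n} {suc j} (s≤s j<n) z =
    R.trans (R.+-cong (z z<s λ ()) (sumTo-single j<n (λ i<n i≢j → z (s<s i<n) (i≢j ∘ suc-injective)))) (R.+-identityˡ _)

  sumTo-cong : ∀ n {h h′} → (∀ i → h i ≈ h′ i) → sumTo n h ≈ sumTo n h′
  sumTo-cong zero    e = R.refl
  sumTo-cong (suc n) e = R.+-cong (e 0) (sumTo-cong n (e ∘ suc))

  sumTo-* : ∀ n b h → b ⊛ sumTo n h ≈ sumTo n (λ i → b ⊛ h i)
  sumTo-* zero    b h = R.zeroʳ b
  sumTo-* (suc n) b h = R.trans (R.distribˡ b _ _) (R.+-congˡ (sumTo-* n b (h ∘ suc)))

  sumK-sumTo : ∀ n (h : ℕ → A → Carrier) xs → sumK (λ x → sumTo n (λ j → h j x)) xs ≈ sumTo n (λ j → sumK (h j) xs)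
  sumK-sumTo zero    h xs = sumK-zero {xs = xs} (All.tabulate λ _ → R.refl)
  sumK-sumTo (suc n) h xs = R.trans (sumK-+ (h 0) _ xs) (R.+-congˡ (sumK-sumTo n (h ∘ suc) xs))

  -- A chain as a linear functional on functions of faces. With `δ G` it yields the coefficient at
  -- `G`, with `incidence D` the coefficient of the boundary at `D`.
  pair : Chain → (Face → Carrier) → Carrier
  pair z φ = sumK (λ p → proj₁ p ⊛ φ (proj₂ p)) z

  pair-scale : ∀ b z φ → pair (scale b z) φ ≈ b ⊛ pair z φ
  pair-scale b z φ = R.trans (sumK-map _ _ z)
    (R.trans (sumK-cong {xs = z} (All.tabulate λ _ → R.*-assoc _ _ _)) (sumK-* b _ z))

  pair-combo : ∀ {I : Set} (g : I → Chain) xs φ → pair (combo g xs) φ ≈ sumK (λ p → proj₁ p ⊛ pair (g (proj₂ p)) φ) xs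
  pair-combo g []             φ = R.refl
  pair-combo g ((b , i) ∷ xs) φ =
    R.trans (sumK-++ _ (scale b (g i)) _) (R.+-cong (pair-scale b (g i) φ) (pair-combo g xs φ))

  δ : Face → Face → Carrier
  δ G F = if ⌊ F ≟F G ⌋ then 1# else 0#

  δ-≡ : ∀ {F G} → F ≡ G → δ G F ≈ 1#
  δ-≡ {F} {G} eq with F ≟F G
  ... | yes _ = R.refl
  ... | no ne = contradiction eq ne

  δ-≢ : ∀ {F G} → F ≢ G → δ G F ≈ 0#
  δ-≢ {F} {G} ne with F ≟F G
  ... | yes eq = contradiction eq ne
  ... | no _   = R.refl

  coeff-pair : ∀ z G → coeff z G ≈ pair z (δ G)
  coeff-pair []            G = R.refl
  coeff-pair ((b , F) ∷ z) G = R.+-cong first (coeff-pair z G)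
    where
    first : (if ⌊ F ≟F G ⌋ then b else 0#) ≈ b ⊛ δ G F
    first with F ≟F G
    ... | yes _ = R.sym (R.*-identityʳ b)
    ... | no _  = R.sym (R.zeroʳ b)

  coeff-++ : ∀ z z′ G → coeff (z ++ z′) G ≈ coeff z G ⊕ coeff z′ G
  coeff-++ []      z′ G = R.sym (R.+-identityˡ _)
  coeff-++ (p ∷ z) z′ G = R.trans (R.+-congˡ (coeff-++ z z′ G)) (R.sym (R.+-assoc _ _ _))

  incidence : Face → Face → Carrier
  incidence D F = sumTo (pred (length F)) (λ j → signOf j ⊛ δ D (mergeAt j F))

  coeff-alt : ∀ D s (f : ℕ → Face) n →
    coeff (alt s (applyUpTo f n)) D ≈ s ⊛ sumTo n (λ j → signOf j ⊛ δ D (f j))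
  coeff-alt D s f zero    = R.sym (R.zeroʳ s)
  coeff-alt D s f (suc n) = begin
    (if ⌊ f 0 ≟F D ⌋ then s else 0#) ⊕ coeff (alt (- s) (applyUpTo (f ∘ suc) n)) D
      ≈⟨ R.+-cong first (coeff-alt D (- s) (f ∘ suc) n) ⟩
    s ⊛ (1# ⊛ δ D (f 0)) ⊕ (- s) ⊛ sumTo n (λ j → signOf j ⊛ δ D (f (suc j)))
      ≈⟨ R.+-congˡ (R.trans (sumTo-* n _ _) (R.trans (sumTo-cong n rest) (R.sym (sumTo-* n _ _)))) ⟩
    s ⊛ (1# ⊛ δ D (f 0)) ⊕ s ⊛ sumTo n (λ j → signOf (suc j) ⊛ δ D (f (suc j)))
      ≈⟨ R.sym (R.distribˡ s _ _) ⟩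
    s ⊛ sumTo (suc n) (λ j → signOf j ⊛ δ D (f j)) ∎
    where
    first : (if ⌊ f 0 ≟F D ⌋ then s else 0#) ≈ s ⊛ (1# ⊛ δ D (f 0))
    first with f 0 ≟F D
    ... | yes _ = R.sym (R.trans (R.*-congˡ (R.*-identityˡ _)) (R.*-identityʳ s))
    ... | no _  = R.sym (R.trans (R.*-congˡ (R.*-identityˡ _)) (R.zeroʳ s))
    rest : ∀ j → (- s) ⊛ (signOf j ⊛ δ D (f (suc j))) ≈ s ⊛ (signOf (suc j) ⊛ δ D (f (suc j)))
    rest j = begin
      (- s) ⊛ (signOf j ⊛ δ D (f (suc j))) ≈⟨ R.sym (-‿distribˡ-* _ _) ⟩
      - (s ⊛ (signOf j ⊛ δ D (f (suc j)))) ≈⟨ -‿distribʳ-* _ _ ⟩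
      s ⊛ (- (signOf j ⊛ δ D (f (suc j)))) ≈⟨ R.*-congˡ (-‿distribˡ-* _ _) ⟩
      s ⊛ (signOf (suc j) ⊛ δ D (f (suc j))) ∎

  coeff-∂ : ∀ z D → coeff (∂ z) D ≈ pair z (incidence D)
  coeff-∂ []            D = R.refl
  coeff-∂ ((b , F) ∷ z) D = R.trans (coeff-++ (alt b (merges F)) (∂ z) D) (R.+-cong first (coeff-∂ z D))
    where
    first : coeff (alt b (merges F)) D ≈ b ⊛ incidence D F
    first rewrite merges-mergeAt F = coeff-alt D b (λ j → mergeAt j F) (pred (length F))

  remove : Face → Chain → Chain
  remove F = filter (λ p → ¬? (proj₂ p ≟F F))

  -- All entries at `F` are gathered into one coefficient. A boundary equation can then be solved
  -- for it, and elimination can delete the face from the list.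
  pair-remove : ∀ F z φ → pair z φ ≈ coeff z F ⊛ φ F ⊕ pair (remove F z) φ
  pair-remove F []            φ = R.sym (R.trans (R.+-identityʳ _) (R.zeroˡ _))
  pair-remove F ((b , G) ∷ z) φ with G ≟F F
  ... | yes refl = begin
    b ⊛ φ G ⊕ pair z φ                                        ≈⟨ R.+-congˡ (pair-remove G z φ) ⟩
    b ⊛ φ G ⊕ (coeff z G ⊛ φ G ⊕ pair (remove G z) φ)         ≈⟨ R.sym (R.+-assoc _ _ _) ⟩
    (b ⊛ φ G ⊕ coeff z G ⊛ φ G) ⊕ pair (remove G z) φ         ≈⟨ R.+-congʳ (R.sym (R.distribʳ _ _ _)) ⟩
    (b ⊕ coeff z G) ⊛ φ G ⊕ pair (remove G z) φ               ∎
  ... | no _ = begin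
    b ⊛ φ G ⊕ pair z φ                                        ≈⟨ R.+-congˡ (pair-remove F z φ) ⟩
    b ⊛ φ G ⊕ (coeff z F ⊛ φ F ⊕ pair (remove F z) φ)         ≈⟨ R.sym (R.+-assoc _ _ _) ⟩
    (b ⊛ φ G ⊕ coeff z F ⊛ φ F) ⊕ pair (remove F z) φ         ≈⟨ R.+-congʳ (R.+-comm _ _) ⟩
    (coeff z F ⊛ φ F ⊕ b ⊛ φ G) ⊕ pair (remove F z) φ         ≈⟨ R.+-assoc _ _ _ ⟩
    coeff z F ⊛ φ F ⊕ (b ⊛ φ G ⊕ pair (remove F z) φ)         ≈⟨ R.+-congʳ (R.*-congʳ (R.sym (R.+-identityˡ _))) ⟩
    (0# ⊕ coeff z F) ⊛ φ F ⊕ (b ⊛ φ G ⊕ pair (remove F z) φ)  ∎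

  pair-zero : ∀ z {φ} → All (λ p → φ (proj₂ p) ≈ 0#) z → pair z φ ≈ 0#
  pair-zero z h = sumK-zero (All.map (λ e → R.trans (R.*-congˡ e) (R.zeroʳ _)) h)

  signOf-unit : ∀ k → signOf k ⊛ signOf k ≈ 1#
  signOf-unit zero    = R.*-identityˡ 1#
  signOf-unit (suc k) = begin
    (- signOf k) ⊛ (- signOf k) ≈⟨ R.sym (-‿distribˡ-* _ _) ⟩
    - (signOf k ⊛ (- signOf k)) ≈⟨ R.-‿cong (R.sym (-‿distribʳ-* _ _)) ⟩
    - (- (signOf k ⊛ signOf k)) ≈⟨ -‿involutive _ ⟩
    signOf k ⊛ signOf k         ≈⟨ signOf-unit k ⟩
    1#                          ∎

  signOf-neighbours : ∀ {k k′} → Neighbours k k′ → signOf k ≈ - signOf k′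
  signOf-neighbours (inj₁ refl) = R.refl
  signOf-neighbours (inj₂ refl) = R.sym (-‿involutive _)

-- Top-dimensional faces

length-concat : ∀ {a} {A : Set a} (xss : List (List A)) → length (concat xss) ≡ sum (map length xss)
length-concat []         = refl
length-concat (xs ∷ xss) = trans (length-++ xs) (cong (length xs +_) (length-concat xss))

concat-↭ : ∀ {xss yss : List (List ℕ)} → Pointwise _↭_ xss yss → concat xss ↭ concat yss
concat-↭ []       = ↭-refl
concat-↭ (p ∷ ps) = ↭-++⁺ p (concat-↭ ps)

map-sum-↭ : Pointwise _↭_ xss yss → map sum xss ≡ map sum yss
map-sum-↭ []       = refl
map-sum-↭ (p ∷ ps) = cong₂ _∷_ (sum-↭ p) (map-sum-↭ ps)

nonempty-↭ : Pointwise _↭_ xss yss → All NonEmpty yss → All NonEmpty xss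
nonempty-↭ []       []       = []
nonempty-↭ (p ∷ ps) (h ∷ hs) = subst (0 <_) (sym (↭-length p)) h ∷ nonempty-↭ ps hs

++-injective : ∀ {a} {A : Set a} (xs ys : List A) {xs′ ys′} → length xs ≡ length ys → xs ++ xs′ ≡ ys ++ ys′ →
  xs ≡ ys × xs′ ≡ ys′
++-injective []       []       _  eq = refl , eq
++-injective (x ∷ xs) (y ∷ ys) le eq with ++-injective xs ys (suc-injective le) (∷-injectiveʳ eq)
... | refl , eq′ = cong (_∷ xs) (∷-injectiveˡ eq) , eq′

unique-++-disjoint : ∀ {a} {A : Set a} (xs : List A) {ys x} → Unique (xs ++ ys) → x ∈ xs → x ∈ ys → ∀ {b} {B : Set b} → B
unique-++-disjoint (x ∷ xs) (n ∷ u) (here refl) q = contradiction refl (All.lookup n (∈-++⁺ʳ xs q))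
unique-++-disjoint (x ∷ xs) (n ∷ u) (there p)   q = unique-++-disjoint xs u p q

unique-++⁻ʳ : ∀ {a} {A : Set a} (xs : List A) {ys} → Unique (xs ++ ys) → Unique ys
unique-++⁻ʳ []       u       = u
unique-++⁻ʳ (x ∷ xs) (_ ∷ u) = unique-++⁻ʳ xs u

unique-++⁻ˡ : ∀ {a} {A : Set a} (xs : List A) {ys} → Unique (xs ++ ys) → Unique xs
unique-++⁻ˡ []       u       = []
unique-++⁻ˡ (x ∷ xs) (n ∷ u) = Allₚ.++⁻ˡ xs n ∷ unique-++⁻ˡ xs u

unique-concat⁻ : ∀ {a} {A : Set a} (xss : List (List A)) → Unique (concat xss) → All Unique xss
unique-concat⁻ []         u = []
unique-concat⁻ (xs ∷ xss) u = unique-++⁻ˡ xs u ∷ unique-concat⁻ xss (unique-++⁻ʳ xs u)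

shared⇒≡ : ∀ {F : Face} {C C′ x} → Unique (concat F) → C ∈ F → C′ ∈ F → x ∈ C → x ∈ C′ → C ≡ C′
shared⇒≡ u (here refl) (here refl) p q = refl
shared⇒≡ u (here refl) (there b)   p q = unique-++-disjoint _ u p (∈-concat⁺′ q b)
shared⇒≡ u (there a)   (here refl) p q = unique-++-disjoint _ u q (∈-concat⁺′ p a)
shared⇒≡ u (there a)   (there b)   p q = shared⇒≡ (unique-++⁻ʳ _ u) a b p q

nonEmpty-∈ : ∀ {xs} → NonEmpty xs → ∃ (_∈ xs)
nonEmpty-∈ {x ∷ _} _ = x , here refl

concat-∷ʳ : ∀ (Cs : Face) C → concat (Cs ++ [ C ]) ≡ concat Cs ++ C
concat-∷ʳ Cs C = trans (sym (concat-++ Cs [ C ])) (cong (concat Cs ++_) (++-identityʳ C))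

-- Each `C` claims some `B` inside it. No `B` is claimed twice, since it is nonempty and the `Cs`
-- are disjoint, so a claimed block may be removed before recursing. `Bs₂` collects the unclaimed
-- ones.
match-blocks : ∀ Bs Cs → All NonEmpty Bs → Unique (concat Cs) → All (λ C → Any (λ B → ∀ {x} → x ∈ B → x ∈ C) Bs) Cs →
  ∃₂ λ Bs₁ Bs₂ → Bs ↭ Bs₁ ++ Bs₂ × Pointwise (λ B C → ∀ {x} → x ∈ B → x ∈ C) Bs₁ Cs
match-blocks Bs []       _  _ _       = [] , Bs , ↭-refl , []
match-blocks Bs (C ∷ Cs) ne u (h ∷ hs) with find h
... | B , B∈ , B⊆C with ∈-∃++ B∈
...   | as , bs , refl with match-blocks (as ++ bs) Cs ne′ (unique-++⁻ʳ C u) (All.tabulate other)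
  where
  ne′ : All NonEmpty (as ++ bs)
  ne′ = All.tail (All-resp-↭ (shift B as bs) ne)
  other : ∀ {C′} → C′ ∈ Cs → Any (λ B → ∀ {x} → x ∈ B → x ∈ C′) (as ++ bs)
  other {C′} C′∈ = go (Any-resp-↭ (shift B as bs) (All.lookup hs C′∈))
    where
    go : Any (λ B → ∀ {x} → x ∈ B → x ∈ C′) (B ∷ as ++ bs) → Any (λ B → ∀ {x} → x ∈ B → x ∈ C′) (as ++ bs)
    go (there q) = q
    go (here s) with nonEmpty-∈ (All.lookup ne B∈)
    ... | x , x∈ = unique-++-disjoint C u (B⊆C x∈) (∈-concat⁺′ (s x∈) C′∈)
...     | Bs₁ , Bs₂ , p , pw = B ∷ Bs₁ , Bs₂ , ↭-trans (shift B as bs) (prep B p) , B⊆C ∷ pw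

sums-squeeze : ∀ {xs ys a b} → Pointwise _≤_ xs ys → a ≤ b → sum xs + a ≡ sum ys + b → xs ≡ ys × a ≡ b
sums-squeeze []                       a≤b eq = refl , eq
sums-squeeze {x ∷ xs} {y ∷ ys} {a} {b} (x≤y ∷ h) a≤b eq with m≤n⇒m<n∨m≡n x≤y
... | inj₁ x<y = contradiction (subst₂ _<_ (sym (+-assoc x (sum xs) a)) (sym (+-assoc y (sum ys) b)) (+-mono-<-≤ x<y
    (+-mono-≤ (sums≤ h) a≤b)))
                   (≤⇒≯ (≤-reflexive (sym eq)))
  where
  sums≤ : ∀ {xs ys} → Pointwise _≤_ xs ys → sum xs ≤ sum ys
  sums≤ []      = z≤n
  sums≤ (h ∷ t) = +-mono-≤ h (sums≤ t)
... | inj₂ refl with sums-squeeze h a≤b (+-cancelˡ-≡ x _ _ (trans (sym (+-assoc x (sum xs) a)) (trans eq (+-assoc x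
    (sum ys) b))))
...   | refl , e = refl , e

addAt : ℕ → List ℕ → List ℕ
addAt zero    (p ∷ q ∷ c) = p + q ∷ c
addAt (suc j) (x ∷ c)     = x ∷ addAt j c
addAt _       c           = c

lengths-mergeAt : ∀ j F → map length (mergeAt j F) ≡ addAt j (map length F)
lengths-mergeAt zero    []           = refl
lengths-mergeAt zero    (C ∷ [])     = refl
lengths-mergeAt zero    (C ∷ C′ ∷ F) = cong (_∷ map length F) (trans (↭-length (sortℕ-↭ (C ++ C′))) (length-++ C))
lengths-mergeAt (suc j) []           = refl
lengths-mergeAt (suc j) (C ∷ F)      = cong (length C ∷_) (lengths-mergeAt j F)

at-addAt : ∀ j c → suc j < length c → at (addAt j c) j ≡ at c j + at c (suc j)
at-addAt zero    (p ∷ [])    (s≤s ())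
at-addAt zero    (p ∷ q ∷ c) _       = refl
at-addAt (suc j) (x ∷ c)     (s≤s h) = at-addAt j c h

at-addAt-< : ∀ i j c → i < j → at (addAt j c) i ≡ at c i
at-addAt-< i       (suc j) []      _       = refl
at-addAt-< zero    (suc j) (x ∷ c) _       = refl
at-addAt-< (suc i) (suc j) (x ∷ c) (s≤s h) = at-addAt-< i j c h

at-++ˡ : ∀ i xs ys → i < length xs → at (xs ++ ys) i ≡ at xs i
at-++ˡ zero    (x ∷ xs) ys _       = refl
at-++ˡ (suc i) (x ∷ xs) ys (s≤s h) = at-++ˡ i xs ys h

at-sub : ∀ i cs → i < length cs → ∃ λ ν → at cs i ∷ ν ↭ cs
at-sub zero    (c ∷ cs) _       = cs , ↭-refl
at-sub (suc i) (c ∷ cs) (s≤s h) with at-sub i cs h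
... | ν , p = c ∷ ν , ↭-trans (swap _ c ↭-refl) (prep c p)

at-sub₂ : ∀ i cs → suc i < length cs → ∃ λ ν → at cs i ∷ at cs (suc i) ∷ ν ↭ cs
at-sub₂ zero    (c ∷ [])     (s≤s ())
at-sub₂ zero    (c ∷ c′ ∷ cs) _      = cs , ↭-refl
at-sub₂ (suc i) (c ∷ cs)     (s≤s h) with at-sub₂ i cs h
... | ν , p = c ∷ ν , ↭-trans (shift c (at cs i ∷ at cs (suc i) ∷ []) ν) (prep c p)

∷ʳ-split : ∀ {a} {A : Set a} (as : List A) {b bs cs z} → as ++ b ∷ bs ≡ cs ++ [ z ] →
  (bs ≡ [] × cs ≡ as × b ≡ z) ⊎ ∃ λ bs′ → bs ≡ bs′ ++ [ z ] × cs ≡ as ++ b ∷ bs′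
∷ʳ-split as {b} {bs} {cs} {z} eq with initLast bs
... | []        = inj₁ (refl , sym (∷ʳ-injectiveˡ as cs eq) , ∷ʳ-injectiveʳ as cs eq)
... | bs′ ∷ʳ′ y with ∷ʳ-injective (as ++ b ∷ bs′) cs (trans (++-assoc as (b ∷ bs′) [ y ]) eq)
...   | e , refl = inj₂ (bs′ , refl , sym e)

splitAt₂ : ∀ j (F : Face) → suc j < length F → ∃₂ λ A C → ∃₂ λ C′ B → F ≡ A ++ C ∷ C′ ∷ B × length A ≡ j
splitAt₂ zero    (C ∷ [])     (s≤s ())
splitAt₂ zero    (C ∷ C′ ∷ B) _      = [] , C , C′ , B , refl , refl
splitAt₂ (suc j) (X ∷ F)     (s≤s h) with splitAt₂ j F h
... | A , C , C′ , B , refl , e = X ∷ A , C , C′ , B , refl , cong suc e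

mergeAt-++ : ∀ A C C′ B → mergeAt (length A) (A ++ C ∷ C′ ∷ B) ≡ A ++ sortℕ (C ++ C′) ∷ B
mergeAt-++ []      C C′ B = refl
mergeAt-++ (X ∷ A) C C′ B = cong (X ∷_) (mergeAt-++ A C C′ B)

pair-↭-cases : ∀ {p q p′ q′ : ℕ} → p ∷ q ∷ [] ↭ p′ ∷ q′ ∷ [] → (p ≡ p′ × q ≡ q′) ⊎ (p ≡ q′ × q ≡ p′)
pair-↭-cases h with ∈-resp-↭ h (here refl)
... | here refl with ↭-singleton-inv (drop-∷ h)
...   | refl = inj₁ (refl , refl)
pair-↭-cases {p} h | there (here refl) with ↭-singleton-inv (drop-∷ (↭-trans h (swap _ p ↭-refl)))
...   | refl = inj₂ (refl , refl)

-- `B ≡ []` says that `C′` is the pointed block. No sizes are compared there, because the pointed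
-- size is always `m`.
data NonPivot : Face → Set where
  nonPivot : ∀ A C C′ B → Asc (C ++ C′) → length C ≤ length C′ ⊎ B ≡ [] → NonPivot (A ++ C ∷ C′ ∷ B)

module TopFaces (n : ℕ) (la : List ℕ) (m : ℕ) (knap : IsKnapsack la) where

  -- Filter membership made explicit: a face with k + 1 blocks in the filter must itself have type λ
  -- with pointed part `m`.
  record Top (F : Face) : Set where
    field
      sizes  : List ℕ
      shape  : map length F ≡ sizes ++ [ m ]
      sizes↭ : sizes ↭ la
      asc    : All Asc F
      word↭  : concat F ↭ upTo n

    length-top : length F ≡ suc (length la)
    length-top = trans (sym (length-map length F)) (trans (cong length shape) (trans (length-++ sizes)
      (trans (+-comm (length sizes) 1) (cong suc (↭-length sizes↭)))))

  open Top

  private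
    word-unique : ∀ {xs : List ℕ} → xs ↭ upTo n → Unique xs
    word-unique p = unique-↭ (↭-sym p) (Uniqueₚ.upTo⁺ n)

    -- A point of a nonpointed block `C` lies in some block `B` of the generating partition, and the
    -- block of `F` around `B` shares this point with `C`, hence is `C`. So every nonpointed `C`
    -- contains some `B`, and sizes can be compared.
    matching : ∀ {F} → ΛFace n la m F → ∃₂ λ Cs Cr → ∃₂ λ Bs₁ Bs₂ → F ≡ Cs ++ [ Cr ] ×
      map length (Bs₁ ++ Bs₂) ↭ la × length Bs₁ ≡ length Cs × Pointwise _≤_ (map length Bs₁) (map length Cs) ×
      m ≤ length Cr × sum la + m ≡ n × sum (map length Cs) + length Cr ≡ n
    matching (((Cs , Cr , refl , neC) , asc , w) , (Cs′ , Cr′ , eq , Bs , Z , p , neB , lens , refl , sub , Z⊆))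
      with ∷ʳ-injective Cs Cs′ eq
    ... | refl , refl = Cs , Cr , go (match-blocks Bs Cs neB uC (All.tabulate holds))
      where
      uF : Unique (concat (Cs ++ [ Cr ]))
      uF = word-unique w
      uF′ : Unique (concat Cs ++ Cr)
      uF′ = subst Unique (concat-∷ʳ Cs Cr) uF
      uC = unique-++⁻ˡ (concat Cs) uF′
      uB : Unique (concat Bs ++ Z)
      uB = word-unique p
      holds : ∀ {C} → C ∈ Cs → Any (λ B → ∀ {x} → x ∈ B → x ∈ C) Bs
      holds {C} C∈ with nonEmpty-∈ (All.lookup neC C∈)
      ... | x , x∈ with ∈-++⁻ (concat Bs) (∈-resp-↭ (↭-trans w (↭-sym p)) (∈-concat⁺′ x∈ (∈-++⁺ˡ C∈)))
      -- `Z` lies in the pointed block, which is disjoint from `C`.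
      ...   | inj₂ x∈Z = unique-++-disjoint (concat Cs) uF′ (∈-concat⁺′ x∈ C∈) (Z⊆ x∈Z)
      ...   | inj₁ x∈B with ∈-concat⁻′ Bs x∈B
      ...     | B , x∈′ , B∈ with find (All.lookup sub B∈)
      ...       | C₂ , C₂∈ , s with shared⇒≡ uF (∈-++⁺ˡ C∈) C₂∈ x∈ (s x∈′)
      ...         | refl = Any.map (λ { refl → λ {x} → s {x} }) B∈
      lengths≤ : ∀ {Bs₁ Cs′} → All Unique Bs₁ → Pointwise (λ B C → ∀ {x} → x ∈ B → x ∈ C) Bs₁ Cs′ →
        Pointwise _≤_ (map length Bs₁) (map length Cs′)
      lengths≤ _        []       = []
      lengths≤ (u ∷ us) (s ∷ ss) = unique-⊆-length u s ∷ lengths≤ us ss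
      go : (∃₂ λ Bs₁ Bs₂ → Bs ↭ Bs₁ ++ Bs₂ × Pointwise (λ B C → ∀ {x} → x ∈ B → x ∈ C) Bs₁ Cs) →
        ∃₂ λ Bs₁ Bs₂ → Cs ++ [ Cr ] ≡ Cs ++ [ Cr ] ×
          map length (Bs₁ ++ Bs₂) ↭ la × length Bs₁ ≡ length Cs × Pointwise _≤_ (map length Bs₁) (map length Cs) ×
          length Z ≤ length Cr × sum la + length Z ≡ n × sum (map length Cs) + length Cr ≡ n
      go (Bs₁ , Bs₂ , q , pw) = Bs₁ , Bs₂ , refl , ↭-trans (↭-map⁺ length (↭-sym q)) lens , Pointwise.Pointwise-length pw ,
        lengths≤ (Allₚ.++⁻ˡ Bs₁ (All-resp-↭ q (unique-concat⁻ Bs (unique-++⁻ˡ (concat Bs) uB)))) pw ,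
        unique-⊆-length (unique-++⁻ʳ (concat Bs) uB) Z⊆ ,
        trans (cong (_+ length Z) (trans (sum-↭ (↭-sym lens)) (sym (length-concat Bs))))
          (trans (sym (length-++ (concat Bs))) (trans (↭-length p) (length-upTo n))) ,
        trans (cong (_+ length Cr) (sym (length-concat Cs))) (trans (sym (length-++ (concat Cs)))
          (trans (cong length (sym (concat-∷ʳ Cs Cr))) (trans (↭-length w) (length-upTo n))))

  -- With k + 1 blocks every `B` is claimed, so the sizes are bounded termwise with equal totals and
  -- must agree.
  Λ⇒Top : ∀ {F} → ΛFace n la m F → length F ≡ suc (length la) → Top F
  Λ⇒Top h@((_ , asc , w) , _) len with matching h
  ... | Cs , Cr , Bs₁ , Bs₂ , refl , lens , lenB , le , le′ , e₁ , e₂ = go Bs₂ lens no-rest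
    where
    lenCs : length Cs ≡ length la
    lenCs = suc-injective (trans (+-comm 1 (length Cs)) (trans (sym (length-++ Cs)) len))
    total : length Bs₁ + length Bs₂ ≡ length la
    total = trans (sym (length-++ Bs₁)) (trans (sym (length-map length (Bs₁ ++ Bs₂))) (↭-length lens))
    no-rest : length Bs₂ ≡ 0
    no-rest = +-cancelˡ-≡ (length Bs₁) _ 0 (trans total (trans (sym lenCs) (trans (sym lenB) (sym (+-identityʳ _)))))
    go : ∀ Bs₂ → map length (Bs₁ ++ Bs₂) ↭ la → length Bs₂ ≡ 0 → Top (Cs ++ [ Cr ])
    go [] lens _ with subst (λ Bs → map length Bs ↭ la) (++-identityʳ Bs₁) lens
    ... | lens′ with sums-squeeze le le′ (trans (cong (_+ m) (sum-↭ lens′)) (trans e₁ (sym e₂)))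
    ...   | e , e′ = record
      { sizes  = map length Cs
      ; shape  = trans (map-++ length Cs [ Cr ]) (cong (λ k → map length Cs ++ [ k ]) (sym e′))
      ; sizes↭ = subst (_↭ la) e lens′
      ; asc    = All.map (λ {B} eq → subst Asc eq (sortℕ-asc B)) asc
      ; word↭  = w
      }

  -- The nonpointed blocks claim different blocks of the generating partition, which has only k of
  -- them.
  no-larger-face : ∀ {F} → ΛFace n la m F → length F ≢ suc (suc (length la))
  no-larger-face h len with matching h
  ... | Cs , Cr , Bs₁ , Bs₂ , refl , lens , lenB , _ =
    contradiction (≤-trans (≤-reflexive (trans (sym lenCs) (sym lenB))) (≤-trans (m≤m+n _ (length Bs₂)) (≤-reflexive
        total))) 1+n≰n
    where
    lenCs : length Cs ≡ suc (length la)
    lenCs = suc-injective (trans (+-comm 1 (length Cs)) (trans (sym (length-++ Cs)) len))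
    total : length Bs₁ + length Bs₂ ≡ length la
    total = trans (sym (length-++ Bs₁)) (trans (sym (length-map length (Bs₁ ++ Bs₂))) (↭-length lens))

  Top⇒Λ : ∀ {F} → Top F → ΛFace n la m F
  Top⇒Λ {F} t with initLast F | t
  ... | []       | t = contradiction (length-top t) λ ()
  ... | Cs ∷ʳ′ Z | t with ∷ʳ-injective (map length Cs) (sizes t) (trans (sym (map-++ length Cs [ Z ])) (shape t))
  ...   | eq , refl =
    ((Cs , Z , refl , ne) , All.map sortℕ-fix (asc t) , word↭ t) ,
    (Cs , Z , refl , Cs , Z , subst (_↭ upTo n) (concat-∷ʳ Cs Z) (word↭ t) , ne ,
      subst (_↭ la) (sym eq) (sizes↭ t) , refl , All.tabulate (λ {C} C∈ → Any.map (λ { refl → λ {x} q → q }) (∈-++⁺ˡ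
          C∈)) , λ q → q)
    where
    ne : All NonEmpty Cs
    ne = Allₚ.map⁻ (All-resp-↭ (↭-trans (↭-sym (sizes↭ t)) (↭-reflexive (sym eq))) (proj₁ knap))

  private
    sub-length : ∀ {μ μ′} → SubMultiset μ la → SubMultiset μ′ la → sum μ ≡ sum μ′ → length μ ≡ length μ′
    sub-length {μ} {μ′} p q e = ↭-length (proj₂ knap μ μ′ p q e)

    -- At entry `j` one side has a sum of two parts of λ and the other a single part, while the
    -- knapsack property makes equal sums have equally many parts. Looking at the smaller position
    -- keeps the pointed part out of both sums.
    no-earlier-merge : ∀ {cs cs′ j j′} → cs ↭ la → cs′ ↭ la → j < j′ → j′ < length la →
      addAt j (cs ++ [ m ]) ≢ addAt j′ (cs′ ++ [ m ])
    no-earlier-merge {cs} {cs′} {j} {j′} p p′ j<j′ j′< eq = contradiction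
      (sub-length {at cs j ∷ at cs (suc j) ∷ []} {[ at cs′ j ]}
        (proj₁ two , ↭-trans (proj₂ two) p) (proj₁ one , ↭-trans (proj₂ one) p′)
        (trans (sym (+-assoc (at cs j) _ 0)) (cong (_+ 0) sums))) λ ()
      where
      lt : suc j < length cs
      lt = ≤-<-trans j<j′ (subst (j′ <_) (sym (↭-length p)) j′<)
      lt′ : j < length cs′
      lt′ = <-trans j<j′ (subst (j′ <_) (sym (↭-length p′)) j′<)
      two = at-sub₂ j cs lt
      one = at-sub j cs′ lt′
      sums : at cs j + at cs (suc j) ≡ at cs′ j
      sums = trans (sym (cong₂ _+_ (at-++ˡ j cs [ m ] (<-trans (n<1+n j) lt)) (at-++ˡ (suc j) cs [ m ] lt)))
        (trans (sym (at-addAt j (cs ++ [ m ]) (subst (suc j <_) (sym (length-++ cs)) (≤-trans lt (m≤m+n _ _)))))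
        (trans (cong (λ l → at l j) eq) (trans (at-addAt-< j j′ (cs′ ++ [ m ]) j<j′) (at-++ˡ j cs′ [ m ] lt′))))

  merge-position : ∀ {F F′ j j′} → Top F → Top F′ → j < length la → j′ < length la →
    mergeAt j F ≡ mergeAt j′ F′ → j ≡ j′
  merge-position {F} {F′} {j} {j′} t t′ j< j′< eq with <-cmp j j′
  ... | tri≈ _ e _ = e
  ... | tri< l _ _ = contradiction lens (no-earlier-merge (sizes↭ t) (sizes↭ t′) l j′<)
    where
    lens : addAt j (sizes t ++ [ m ]) ≡ addAt j′ (sizes t′ ++ [ m ])
    lens rewrite sym (shape t) | sym (shape t′) =
      trans (sym (lengths-mergeAt j F)) (trans (cong (map length) eq) (lengths-mergeAt j′ F′))
  ... | tri> _ _ l = contradiction lens (no-earlier-merge (sizes↭ t′) (sizes↭ t) l j<)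
    where
    lens : addAt j′ (sizes t′ ++ [ m ]) ≡ addAt j (sizes t ++ [ m ])
    lens rewrite sym (shape t) | sym (shape t′) =
      trans (sym (lengths-mergeAt j′ F′)) (trans (cong (map length) (sym eq)) (lengths-mergeAt j F))

  -- Lexicographic in the two inversion numbers, since the second one is below the multiplier.
  key : Face → ℕ
  key F = inversions (concat F) * suc (suc (length la) * suc (length la)) + inversions (map length F)

  shape-inversions< : ∀ {F : Face} → length F ≡ suc (length la) → inversions (map length F) < suc (suc (length la) *
      suc (length la))
  shape-inversions< {F} e = s≤s (subst (λ k → inversions (map length F) ≤ k * k) (trans (length-map length F) e)
      (inversions≤ (map length F)))

  key-word< : ∀ {F F′} → length F ≡ suc (length la) → inversions (concat F) < inversions (concat F′) → key F < key F′
  key-word< {F} {F′} e lt = ≤-trans (+-monoʳ-< (inversions (concat F) * N) (shape-inversions< {F} e))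
    (≤-trans (≤-reflexive (+-comm _ N)) (≤-trans (*-monoˡ-≤ N lt) (m≤m+n _ _)))
    where N = suc (suc (length la) * suc (length la))

  key-shape< : ∀ {F F′} → concat F ≡ concat F′ → inversions (map length F) < inversions (map length F′) → key F < key F′
  key-shape< {F} {F′} e lt rewrite e = +-monoʳ-< (inversions (concat F′) * _) lt

  nonPivot-index : ∀ {F} → NonPivot F → ℕ
  nonPivot-index (nonPivot A _ _ _ _ _) = length A

  nonPivot-index< : ∀ {F} (np : NonPivot F) → Top F → nonPivot-index np < length la
  nonPivot-index< (nonPivot A C C′ B _ _) t = s<s⁻¹ (subst (suc (length A) <_) (trans (sym (length-++ A)) (length-top t))
    (subst (suc (length A) <_) (sym (+-suc (length A) (suc (length B)))) (s≤s (subst (length A <_) (sym (+-suc (length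
        A) (length B))) (s≤s (m≤m+n _ _))))))

  -- Both faces cut the same merged block in two. If the words differ, ascent of `C ++ C′` makes the
  -- word of `F` smaller. If they agree, only the place of the cut can differ; the pointed size or
  -- the knapsack property leaves at most an exchange of two sizes, and `length C < length C′` makes
  -- that exchange an increase.
  nonPivot-minimal : ∀ {F F′} (np : NonPivot F) → Top F → Top F′ →
    mergeAt (nonPivot-index np) F ≡ mergeAt (nonPivot-index np) F′ → F ≡ F′ ⊎ key F < key F′
  nonPivot-minimal {F} {F′} np@(nonPivot A C C′ B ascC small) t t′ eq
    with splitAt₂ (length A) F′ (subst (suc (length A) <_) (sym (length-top t′)) (s<s (nonPivot-index< np t)))
  ... | A′ , D , D′ , B′ , refl , lenA = go same
    where
    eq′ : A ++ sortℕ (C ++ C′) ∷ B ≡ A′ ++ sortℕ (D ++ D′) ∷ B′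
    eq′ = trans (sym (mergeAt-++ A C C′ B)) (trans eq (trans (cong (λ k → mergeAt k (A′ ++ D ∷ D′ ∷ B′)) (sym lenA))
        (mergeAt-++ A′ D D′ B′)))
    same = ++-injective A A′ (sym lenA) eq′
    go : A ≡ A′ × sortℕ (C ++ C′) ∷ B ≡ sortℕ (D ++ D′) ∷ B′ →
      A ++ C ∷ C′ ∷ B ≡ A′ ++ D ∷ D′ ∷ B′ ⊎ key (A ++ C ∷ C′ ∷ B) < key (A′ ++ D ∷ D′ ∷ B′)
    go (refl , e) with ∷-injective e
    ... | e₁ , refl = compare-words (⊑-++ {xs = concat A} ⊑-refl (⊑-++ (asc⇒⊑ ascC CD↭) (⊑-refl {concat B})))
      where
      CD↭ : C ++ C′ ↭ D ++ D′
      CD↭ = ↭-trans (↭-sym (sortℕ-↭ (C ++ C′))) (↭-trans (↭-reflexive e₁) (sortℕ-↭ (D ++ D′)))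
      word : ∀ X Y → concat (A ++ X ∷ Y ∷ B) ≡ concat A ++ (X ++ Y) ++ concat B
      word X Y = trans (sym (concat-++ A (X ∷ Y ∷ B))) (cong (concat A ++_) (sym (++-assoc X Y (concat B))))
      lens : length C + length C′ ≡ length D + length D′
      lens = trans (sym (length-++ C)) (trans (↭-length CD↭) (length-++ D))
      same-words : C ++ C′ ≡ D ++ D′ → length C ≡ length D → A ++ C ∷ C′ ∷ B ≡ A ++ D ∷ D′ ∷ B
      same-words w l with ++-injective C D l w
      ... | refl , refl = refl
      shapeC : map length A ++ length C ∷ length C′ ∷ map length B ≡ sizes t ++ [ m ]
      shapeC = trans (sym (map-++ length A (C ∷ C′ ∷ B))) (shape t)
      shapeD : map length A ++ length D ∷ length D′ ∷ map length B ≡ sizes t′ ++ [ m ]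
      shapeD = trans (sym (map-++ length A (D ∷ D′ ∷ B))) (shape t′)
      sub : ∀ {p q Bs cs} → map length A ++ p ∷ q ∷ Bs ≡ cs ++ [ m ] → cs ↭ la → Bs ≢ [] → SubMultiset (p ∷ q ∷ []) la
      sub {p} {q} {Bs} eq r ne with ∷ʳ-split (map length A ++ [ p ]) (trans (++-assoc (map length A) [ p ] _) eq)
      ... | inj₁ (e , _) = contradiction e ne
      ... | inj₂ (Bs′ , _ , refl) = map length A ++ Bs′ ,
        ↭-trans (↭-trans (↭-sym (shifts (map length A) (p ∷ q ∷ []))) (↭-reflexive (sym (++-assoc (map length A) [ p ]
            (q ∷ Bs′))))) r
      same-shape : C ++ C′ ≡ D ++ D′ → A ++ C ∷ C′ ∷ B ≡ A ++ D ∷ D′ ∷ B ⊎ key (A ++ C ∷ C′ ∷ B) < key (A ++ D ∷ D′ ∷ B)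
      same-shape w = last-or-inner B refl
        where
        last-or-inner : ∀ B₀ → B₀ ≡ B → A ++ C ∷ C′ ∷ B ≡ A ++ D ∷ D′ ∷ B ⊎ key (A ++ C ∷ C′ ∷ B) < key (A ++ D ∷ D′ ∷ B)
        -- Both pointed blocks have size `m`, so the cut is the same.
        last-or-inner [] refl = inj₁ (same-words w (+-cancelʳ-≡ (length C′) _ _ (trans lens (cong (length D +_) last≡))))
          where
          last-m : ∀ {p q cs} → map length A ++ p ∷ q ∷ [] ≡ cs ++ [ m ] → q ≡ m
          last-m {p} {q} {cs} e = ∷ʳ-injectiveʳ (map length A ++ [ p ]) cs (trans (++-assoc (map length A) [ p ] [ q ]) e)
          last≡ : length D′ ≡ length C′
          last≡ = trans (last-m {cs = sizes t′} shapeD) (sym (last-m {cs = sizes t} shapeC))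
        -- No pointed block is involved, so both pairs of sizes are submultisets of λ with the same
        -- sum.
        last-or-inner (_ ∷ _) refl with pair-↭-cases (proj₂ knap (length C ∷ length C′ ∷ []) (length D ∷ length D′ ∷ [])
            (sub shapeC (sizes↭ t) λ ()) (sub shapeD (sizes↭ t′) λ ())
            (trans (sym (+-assoc (length C) _ 0)) (trans (cong (_+ 0) lens) (+-assoc (length D) _ 0))))
        ... | inj₁ (e , _) = inj₁ (same-words w e)
        ... | inj₂ (e , e′) = swapped small
          where
          shape< : length C < length C′ → inversions (map length (A ++ C ∷ C′ ∷ B)) < inversions (map length (A ++ D ∷
              D′ ∷ B))
          shape< lt = subst₂ (λ u v → inversions u < inversions v) (sym (map-++ length A (C ∷ C′ ∷ B)))
            (trans (cong₂ (λ p q → map length A ++ p ∷ q ∷ map length B) e′ e) (sym (map-++ length A (D ∷ D′ ∷ B))))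
            (⊑-strict (⊑-++ {xs = map length A} ⊑-refl (swap-⊑ (map length B) lt))
              λ eq → <⇒≢ lt (∷-injectiveˡ (++-cancelˡ (map length A) _ _ eq)))
          swapped : length C ≤ length C′ ⊎ B ≡ [] → A ++ C ∷ C′ ∷ B ≡ A ++ D ∷ D′ ∷ B ⊎ key (A ++ C ∷ C′ ∷ B) < key (A
              ++ D ∷ D′ ∷ B)
          swapped (inj₂ ())
          swapped (inj₁ le) with m≤n⇒m<n∨m≡n le
          ... | inj₂ ee = inj₁ (same-words w (trans ee e′))
          ... | inj₁ lt = inj₂ (key-shape< {A ++ C ∷ C′ ∷ B} {A ++ D ∷ D′ ∷ B}
            (trans (word C C′) (trans (cong (λ z → concat A ++ z ++ concat B) w) (sym (word D D′)))) (shape< lt))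
      compare-words : concat A ++ (C ++ C′) ++ concat B ⊑ concat A ++ (D ++ D′) ++ concat B →
        A ++ C ∷ C′ ∷ B ≡ A ++ D ∷ D′ ∷ B ⊎ key (A ++ C ∷ C′ ∷ B) < key (A ++ D ∷ D′ ∷ B)
      compare-words (_ , inj₁ lt) = inj₂ (key-word< {A ++ C ∷ C′ ∷ B} {A ++ D ∷ D′ ∷ B} (length-top t) (subst₂ (λ u v →
          inversions u < inversions v) (sym (word C C′)) (sym (word D D′)) lt))
      compare-words (_ , inj₂ e)  = same-shape (++-cancelʳ (concat B) _ _ (++-cancelˡ (concat A) _ _ e))

-- Descents, rows and columns

Descent : List ℕ → List ℕ → Set
Descent u v = ∃₂ λ u′ x → ∃₂ λ y v′ → u ≡ u′ ++ [ x ] × v ≡ y ∷ v′ × y < x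

-- The maximal ascending runs of a word. Nonemptiness is asked of the last run only; the others end
-- in a descent.
data Runs : List (List ℕ) → Set where
  last : ∀ {u} → Asc u → NonEmpty u → Runs [ u ]
  step : ∀ {u v vs} → Asc u → Descent u v → Runs (v ∷ vs) → Runs (u ∷ v ∷ vs)

Descent-++ : ∀ w {u v} → Descent u v → Descent (w ++ u) v
Descent-++ w (u′ , x , y , v′ , refl , e , lt) = w ++ u′ , x , y , v′ , sym (++-assoc w u′ [ x ]) , e , lt

Runs-extend : ∀ w {u vs} → Asc (w ++ u) → Runs (u ∷ vs) → Runs ((w ++ u) ∷ vs)
Runs-extend w {u} asc (last _ ne)  = last asc (≤-trans ne (≤-trans (m≤n+m _ (length w)) (≤-reflexive (sym (length-++ w)))))
Runs-extend w     asc (step _ d r) = step asc (Descent-++ w d) r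

Runs-asc : ∀ {rows} → Runs rows → All Asc rows
Runs-asc (last a _)   = a ∷ []
Runs-asc (step a _ r) = a ∷ Runs-asc r

∃-runs : ∀ x xs → ∃₂ λ v vs → Runs ((x ∷ v) ∷ vs) × concat ((x ∷ v) ∷ vs) ≡ x ∷ xs
∃-runs x []       = [] , [] , last ([] ∷ []) z<s , refl
∃-runs x (y ∷ xs) with ∃-runs y xs
... | v , vs , r , eq with x ≤? y
...   | no x≰y  = [] , (y ∷ v) ∷ vs , step ([] ∷ []) ([] , x , y , v , refl , refl , ≰⇒> x≰y) r , cong (x ∷_) eq
...   | yes x≤y = y ∷ v , vs , Runs-extend [ x ] (extended (Runs-asc r)) r , cong (x ∷_) eq
  where
  extended : ∀ {vs} → All Asc ((y ∷ v) ∷ vs) → Asc (x ∷ y ∷ v)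
  extended ((h ∷ a) ∷ _) = (x≤y ∷ All.map (≤-trans x≤y) h) ∷ h ∷ a

DescentAt : List ℕ → ℕ → Set
DescentAt α s = at α s < at α (s ∸ 1)

descentAt? : ∀ α s → Dec (DescentAt α s)
descentAt? α s = at α s <? at α (s ∸ 1)

-- Positivity matters because `s ∸ 1` is truncated: only for `s > 0` does passing to the tail shift
-- both compared positions.
filter-map-suc : ∀ x α {ss} → All (0 <_) ss →
  filter (descentAt? (x ∷ α)) (map suc ss) ≡ map suc (filter (descentAt? α) ss)
filter-map-suc x α []                       = refl
filter-map-suc x α {suc s ∷ ss} (_ ∷ h) = go (descentAt? α (suc s))
  where
  go : Dec (DescentAt α (suc s)) →
    filter (descentAt? (x ∷ α)) (map suc (suc s ∷ ss)) ≡ map suc (filter (descentAt? α) (suc s ∷ ss))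
  go (yes p) = trans (filter-accept (descentAt? (x ∷ α)) {suc (suc s)} {map suc ss} p)
    (trans (cong (suc (suc s) ∷_) (filter-map-suc x α h)) (cong (map suc) (sym (filter-accept (descentAt? α) {suc s}
        {ss} p))))
  go (no ¬p) = trans (filter-reject (descentAt? (x ∷ α)) {suc (suc s)} {map suc ss} ¬p)
    (trans (filter-map-suc x α h) (cong (map suc) (sym (filter-reject (descentAt? α) {suc s} {ss} ¬p))))

descents : List ℕ → List ℕ
descents α = descentSet (length α) α

descents-tail : ∀ x y α → filter (descentAt? (x ∷ y ∷ α)) (applyUpTo (suc ∘ suc) (length α)) ≡ map suc (descents (y ∷ α))
descents-tail x y α = trans (cong (filter (descentAt? (x ∷ y ∷ α))) (sym (trans (cong (map suc) (map-upTo suc (length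
    α))) (map-applyUpTo suc suc (length α)))))
  (filter-map-suc x (y ∷ α) (Allₚ.map⁺ {xs = upTo (length α)} (All.tabulate λ _ → z<s)))

descents-∷ : ∀ x y α → x ≤ y → descents (x ∷ y ∷ α) ≡ map suc (descents (y ∷ α))
descents-∷ x y α x≤y = trans (cong (filter (descentAt? (x ∷ y ∷ α))) (map-upTo suc (suc (length α))))
  (trans (filter-reject (descentAt? (x ∷ y ∷ α)) {1} {applyUpTo (suc ∘ suc) (length α)} (≤⇒≯ x≤y)) (descents-tail x y α))

descents-∷> : ∀ x y α → y < x → descents (x ∷ y ∷ α) ≡ 1 ∷ map suc (descents (y ∷ α))
descents-∷> x y α y<x = trans (cong (filter (descentAt? (x ∷ y ∷ α))) (map-upTo suc (suc (length α))))
  (trans (filter-accept (descentAt? (x ∷ y ∷ α)) {1} {applyUpTo (suc ∘ suc) (length α)} y<x) (cong (1 ∷_)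
      (descents-tail x y α)))

descents-asc : ∀ {u} → Asc u → descents u ≡ []
descents-asc []             = refl
descents-asc {x ∷ []} _     = refl
descents-asc {x ∷ y ∷ u} ((x≤y ∷ _) ∷ a) = trans (descents-∷ x y u x≤y) (cong (map suc) (descents-asc a))

descents-++ : ∀ u {w} → Asc u → Descent u w → descents (u ++ w) ≡ length u ∷ map (length u +_) (descents w)
descents-++ []          _ ([] , _ , _ , _ , () , _)
descents-++ []          _ (_ ∷ _ , _ , _ , _ , () , _)
descents-++ (x ∷ [])    _ ([] , .x , y , v , refl , refl , y<x) = descents-∷> x y v y<x
descents-++ (x ∷ [])    _ (_ ∷ [] , _ , _ , _ , () , _)
descents-++ (x ∷ [])    _ (_ ∷ _ ∷ _ , _ , _ , _ , () , _)
descents-++ (x ∷ z ∷ u) _ ([] , _ , _ , _ , () , _)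
descents-++ (x ∷ z ∷ u) {w} ((x≤z ∷ _) ∷ a) (_ ∷ u′ , r , y , v , e , e′ , lt) =
  trans (descents-∷ x z (u ++ w) x≤z) (trans (cong (map suc) (descents-++ (z ∷ u) a (u′ , r , y , v , ∷-injectiveʳ e ,
      e′ , lt)))
    (cong (suc (suc (length u)) ∷_) (sym (map-∘ (descents w)))))

boundaries : List (List ℕ) → List ℕ
boundaries []            = []
boundaries (u ∷ [])      = []
boundaries (u ∷ v ∷ vs) = length u ∷ map (length u +_) (boundaries (v ∷ vs))

Descent-++ʳ : ∀ w {u v} → Descent u v → Descent u (v ++ w)
Descent-++ʳ w (u′ , x , y , v′ , e , refl , lt) = u′ , x , y , v′ ++ w , e , refl , lt

descents-runs : ∀ {rows} → Runs rows → descents (concat rows) ≡ boundaries rows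
descents-runs (last {u} a _) rewrite ++-identityʳ u = descents-asc a
descents-runs (step {u} {v} {vs} a d r) =
  trans (descents-++ u a (Descent-++ʳ (concat vs) d)) (cong (λ z → length u ∷ map (length u +_) z) (descents-runs r))

-- The offset `p` is the length already passed; at `p = 0` differences undo the partial sums of the
-- row lengths.
diffs-boundaries : ∀ p u rows → diffs p (map (p +_) (boundaries (u ∷ rows)) ++ [ p + length (concat (u ∷ rows)) ]) ≡
    map length (u ∷ rows)
diffs-boundaries p u []       rewrite ++-identityʳ u = cong [_] (m+n∸m≡n p (length u))
diffs-boundaries p u (v ∷ vs) = cong₂ _∷_ (m+n∸m≡n p (length u))
  (trans (cong₂ (λ a b → diffs (p + length u) (a ++ [ b ]))
      (trans (sym (map-∘ (boundaries (v ∷ vs)))) (map-cong (λ z → sym (+-assoc p (length u) z)) (boundaries (v ∷ vs))))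
      (trans (cong (p +_) (length-++ u)) (sym (+-assoc p (length u) _))))
    (diffs-boundaries (p + length u) v vs))

partialSums-boundaries : ∀ p u rows → partialSums p (initL (map length (u ∷ rows))) ≡ map (p +_) (boundaries (u ∷ rows))
partialSums-boundaries p u []       = refl
partialSums-boundaries p u (v ∷ vs) = cong ((p + length u) ∷_) (trans (partialSums-boundaries (p + length u) v vs)
  (trans (map-cong (λ z → +-assoc p (length u) z) (boundaries (v ∷ vs))) (map-∘ (boundaries (v ∷ vs)))))

Runs-nonempty : ∀ {rows} → Runs rows → rows ≢ []
Runs-nonempty (last _ _)   ()
Runs-nonempty (step _ _ _) ()

descComp-runs : ∀ {rows} → Runs rows → descComp (length (concat rows)) (concat rows) ≡ map length rows
descComp-runs {[]}       r = contradiction refl (Runs-nonempty r)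
descComp-runs {u ∷ rows} r = trans (cong (λ z → diffs 0 (z ++ [ length (concat (u ∷ rows)) ])) (trans (descents-runs r)
    (sym (map-id _))))
  (diffs-boundaries 0 u rows)

partialSums-runs : ∀ {rows} → Runs rows → partialSums 0 (initL (map length rows)) ≡ descents (concat rows)
partialSums-runs {[]}       r = contradiction refl (Runs-nonempty r)
partialSums-runs {u ∷ rows} r = trans (partialSums-boundaries 0 u rows) (trans (map-id _) (sym (descents-runs r)))

-- Chunks

length-take-≤ : ∀ k (α : List ℕ) → k ≤ length α → length (take k α) ≡ k
length-take-≤ k α h = trans (length-take k α) (m≤n⇒m⊓n≡m h)

chunks-concat : ∀ α c → sum c ≡ length α → concat (chunks α c) ≡ α
chunks-concat []      []      _ = refl
chunks-concat α       (k ∷ c) e = trans (cong (take k α ++_) (chunks-concat (drop k α) c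
  (sym (trans (length-drop k α) (trans (cong (_∸ k) (sym e)) (m+n∸m≡n k (sum c))))))) (take++drop≡id k α)

chunks-lengths : ∀ α c → sum c ≡ length α → map length (chunks α c) ≡ c
chunks-lengths α []      _ = refl
chunks-lengths α (k ∷ c) e = cong₂ _∷_ (length-take-≤ k α (≤-trans (m≤m+n k (sum c)) (≤-reflexive e)))
  (chunks-lengths (drop k α) c (sym (trans (length-drop k α) (trans (cong (_∸ k) (sym e)) (m+n∸m≡n k (sum c))))))

chunks-map-length : ∀ F → chunks (concat F) (map length F) ≡ F
chunks-map-length []      = refl
chunks-map-length (C ∷ F) = cong₂ _∷_ (take-length-++ C (concat F))
  (trans (cong (λ β → chunks β (map length F)) (drop-length-++ C (concat F))) (chunks-map-length F))

chunks-++ : ∀ α β c c′ → sum c ≡ length α → chunks (α ++ β) (c ++ c′) ≡ chunks α c ++ chunks β c′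
chunks-++ []      β []      c′ _ = refl
chunks-++ α       β (k ∷ c) c′ e = cong₂ _∷_ (take-++-≤ k α k≤)
  (trans (cong (λ γ → chunks γ (c ++ c′)) (drop-++-≤ k α k≤)) (chunks-++ (drop k α) β c c′
    (sym (trans (length-drop k α) (trans (cong (_∸ k) (sym e)) (m+n∸m≡n k (sum c)))))))
  where
  k≤ : k ≤ length α
  k≤ = ≤-trans (m≤m+n k (sum c)) (≤-reflexive e)
  take-++-≤ : ∀ k (α : List ℕ) → k ≤ length α → take k (α ++ β) ≡ take k α
  take-++-≤ zero    α       _       = refl
  take-++-≤ (suc k) (x ∷ α) (s≤s h) = cong (x ∷_) (take-++-≤ k α h)
  drop-++-≤ : ∀ k (α : List ℕ) → k ≤ length α → drop k (α ++ β) ≡ drop k α ++ β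
  drop-++-≤ zero    α       _       = refl
  drop-++-≤ (suc k) (x ∷ α) (s≤s h) = drop-++-≤ k α h

chunks-asc : ∀ {α} → Asc α → ∀ c → All Asc (chunks α c)
chunks-asc a []      = []
chunks-asc a (k ∷ c) = AllPairsₚ.take⁺ k a ∷ chunks-asc (AllPairsₚ.drop⁺ k a) c

-- The cut into parts refines the cut into rows, so each chunk lies inside one ascending row. This
-- is why `sigma` has nothing to sort when applied to α itself.
rows-chunks-asc : ∀ rows segs → All Asc rows → map length rows ≡ map sum segs → All Asc (chunks (concat rows) (concat segs))
rows-chunks-asc []         []           _        _  = []
rows-chunks-asc (u ∷ rows) (seg ∷ segs) (a ∷ as) eq rewrite chunks-++ u (concat rows) seg (concat segs) (sym
    (∷-injectiveˡ eq)) =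
  Allₚ.++⁺ (chunks-asc a seg) (rows-chunks-asc rows segs as (∷-injectiveʳ eq))

sum-concat : ∀ segs → sum (concat segs) ≡ sum (map sum segs)
sum-concat []           = refl
sum-concat (seg ∷ segs) = trans (sum-++ seg (concat segs)) (cong (sum seg +_) (sum-concat segs))

map-sortℕ-fix : ∀ {F} → All Asc F → map sortℕ F ≡ F
map-sortℕ-fix []       = refl
map-sortℕ-fix (a ∷ as) = cong₂ _∷_ (sortℕ-fix a) (map-sortℕ-fix as)

-- Transpositions inside a block

-- Positions `j` and `j + 1` of the concatenation fall into the same inner list. For segments,
-- merging position `j` is then interior to a part of `d`; for columns, the two neighbouring entries
-- may be exchanged.
data Internal {a} {A : Set a} : ℕ → List (List A) → Set a where
  here  : ∀ {j xs xss} → suc j < length xs → Internal j (xs ∷ xss)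
  there : ∀ {j j′ xs xss} → j ≡ length xs + j′ → Internal j′ xss → Internal j (xs ∷ xss)

module _ {a} {A : Set a} where

  internal? : ∀ j (xss : List (List A)) → Dec (Internal j xss)
  internal? j []         = no λ ()
  internal? j (xs ∷ xss) with suc j <? length xs
  ... | yes h = yes (here h)
  ... | no ¬h with length xs ≤? j
  ...   | no ¬le = no λ { (here h) → ¬h h ; (there refl _) → ¬le (m≤m+n _ _) }
  ...   | yes le with internal? (j ∸ length xs) xss
  ...     | yes p = yes (there (sym (m+[n∸m]≡n le)) p)
  ...     | no ¬p = no λ { (here h) → ¬h h
                         ; (there {j′ = j′} refl p) → ¬p (subst (λ k → Internal k xss) (sym (m+n∸m≡n (length xs) j′)) p) }

  -- Meant for internal positions. Elsewhere truncated subtraction may send the exchange into the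
  -- next list, but it remains an involution that rearranges each inner list separately, so these
  -- two facts need no hypothesis.
  swapIn : ℕ → List (List A) → List (List A)
  swapIn j []         = []
  swapIn j (xs ∷ xss) with suc j <? length xs
  ... | yes _ = swapAt j xs ∷ xss
  ... | no _  = xs ∷ swapIn (j ∸ length xs) xss

  swapIn-↭ : ∀ j (xss : List (List A)) → Pointwise _↭_ (swapIn j xss) xss
  swapIn-↭ j []         = []
  swapIn-↭ j (xs ∷ xss) with suc j <? length xs
  ... | yes _ = swapAt-↭ j xs ∷ Pointwise.refl ↭-refl
  ... | no _  = ↭-refl ∷ swapIn-↭ (j ∸ length xs) xss

  swapIn-involutive : ∀ j (xss : List (List A)) → swapIn j (swapIn j xss) ≡ xss
  swapIn-involutive j []         = refl
  swapIn-involutive j (xs ∷ xss) with suc j <? length xs in eq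
  ... | no _ rewrite eq = cong (xs ∷_) (swapIn-involutive (j ∸ length xs) xss)
  ... | yes h with suc j <? length (swapAt j xs)
  ...   | yes _ = cong (_∷ xss) (swapAt-involutive j xs)
  ...   | no ¬h = contradiction (subst (suc j <_) (sym (↭-length (swapAt-↭ j xs))) h) ¬h

  Internal-resp : ∀ {j} {xss yss : List (List A)} → Pointwise _↭_ xss yss → Internal j xss → Internal j yss
  Internal-resp (p ∷ ps) (here h)    = here (subst (_ <_) (↭-length p) h)
  Internal-resp (p ∷ ps) (there e i) = there (trans e (cong (_+ _) (↭-length p))) (Internal-resp ps i)

  concat-swapIn : ∀ {j} {xss : List (List A)} → Internal j xss → concat (swapIn j xss) ≡ swapAt j (concat xss)
  concat-swapIn {j} {xs ∷ xss} (here h) with suc j <? length xs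
  ... | yes _ = sym (swapAt-++ˡ j xs (concat xss) h)
  ... | no ¬h = contradiction h ¬h
  concat-swapIn {j} {xs ∷ xss} (there {j′ = j′} refl i) with suc (length xs + j′) <? length xs
  ... | yes h = contradiction h (≤⇒≯ (m≤n⇒m≤1+n (m≤m+n (length xs) j′)))
  ... | no _  rewrite m+n∸m≡n (length xs) j′ = trans (cong (xs ++_) (concat-swapIn i)) (sym (swapAt-++ʳ j′ xs (concat xss)))

-- A position that is not internal ends a segment, so the parts up to it fill whole segments. `acc`
-- carries the segments already passed.
boundary-sum : ∀ acc j segs → suc j < length (concat segs) → ¬ Internal j segs →
  acc + sum (take (suc j) (concat segs)) ∈ partialSums acc (initL (map sum segs))
boundary-sum acc j (seg ∷ []) lt ¬i = contradiction (here (subst (λ l → suc j < length l) (++-identityʳ seg) lt)) ¬i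
boundary-sum acc j (seg ∷ seg′ ∷ segs) lt ¬i
  with suc j <? length seg | length seg ≤? j | boundary-sum (acc + sum seg) (j ∸ length seg) (seg′ ∷ segs)
... | yes h | _      | _  = contradiction (here h) ¬i
... | no ¬h | no ¬le | _  =
  here (cong (acc +_) (cong sum (trans (cong (λ k → take k (seg ++ concat (seg′ ∷ segs))) (≤-antisym (≰⇒> ¬le) (≮⇒≥
      ¬h))) (take-length-++ seg _))))
... | no ¬h | yes le | ih = there (subst (_∈ partialSums (acc + sum seg) (initL (map sum (seg′ ∷ segs)))) eq
    (ih lt′ (λ i → ¬i (there (sym e) i))))
  where
  j′ = j ∸ length seg
  e = m+[n∸m]≡n le
  rest = concat (seg′ ∷ segs)
  lt′ : suc j′ < length rest
  lt′ = +-cancelˡ-< (length seg) _ _ (≤-trans (≤-reflexive (cong suc (trans (+-suc (length seg) j′) (cong suc e))))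
      (≤-trans lt (≤-reflexive (length-++ seg))))
  take-+ : ∀ (xs : List ℕ) k → take (length xs + k) (xs ++ rest) ≡ xs ++ take k rest
  take-+ []       k = refl
  take-+ (x ∷ xs) k = cong (x ∷_) (take-+ xs k)
  eq : acc + sum seg + sum (take (suc j′) rest) ≡ acc + sum (take (suc j) (seg ++ rest))
  eq = trans (+-assoc acc (sum seg) _) (cong (acc +_) (trans (sym (sum-++ seg _)) (cong sum
    (trans (sym (take-+ seg (suc j′))) (cong (λ k → take k (seg ++ rest)) (trans (+-suc (length seg) j′) (cong suc e)))))))

-- Column intervals

range : ℕ → ℕ → List ℕ
range i zero    = []
range i (suc l) = i ∷ range (suc i) l

applyUpTo-range : ∀ (f : ℕ → ℕ) i l → (∀ t → f t ≡ i + t) → applyUpTo f l ≡ range i l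
applyUpTo-range f i zero    _ = refl
applyUpTo-range f i (suc l) h = cong₂ _∷_ (trans (h 0) (+-identityʳ i)) (applyUpTo-range (f ∘ suc) (suc i) l (λ t →
    trans (h (suc t)) (+-suc i t)))

concat-groupBy : ∀ p cur is → concat (groupBy p cur is) ≡ cur ++ is
concat-groupBy p cur []       = refl
concat-groupBy p cur (i ∷ is) with p i
... | true  = trans (concat-groupBy p (cur ++ [ i ]) is) (++-assoc cur [ i ] is)
... | false = cong (cur ++_) (concat-groupBy p [ i ] is)

-- The invariant keeps `f (i ∸ 1)` as a lower bound of the open group, whose last index is `i ∸ 1`.
-- A descent at `i` then puts `f i` below the entire group.
groupBy-desc : ∀ (f : ℕ → ℕ) p → (∀ i → p i ≡ true → f i < f (i ∸ 1)) → ∀ cur i l →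
  Desc (map f cur) → All (λ c → f (i ∸ 1) ≤ f c) cur → All (Desc ∘ map f) (groupBy p cur (range i l))
groupBy-desc f p h cur i zero    d _  = d ∷ []
groupBy-desc f p h cur i (suc l) d lo with p i in eq
... | false = d ∷ groupBy-desc f p h [ i ] (suc i) l ([] ∷ []) (≤-refl ∷ [])
... | true  = groupBy-desc f p h (cur ++ [ i ]) (suc i) l
  (subst Desc (sym (map-++ f cur [ i ])) (AllPairsₚ.++⁺ d ([] ∷ []) (Allₚ.map⁺ (All.map (λ le → <-≤-trans (h i eq) le ∷
      []) lo))))
  (Allₚ.++⁺ (All.map (≤-trans (<⇒≤ (h i eq))) lo) (≤-refl ∷ []))

groupBy-head : ∀ p cur is {j} → suc j < length cur → Internal j (groupBy p cur is)
groupBy-head p cur []       h = here h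
groupBy-head p cur (i ∷ is) h with p i
... | true  = groupBy-head p (cur ++ [ i ]) is (≤-trans h (≤-trans (m≤m+n _ _) (≤-reflexive (sym (length-++ cur)))))
... | false = here h

-- Positions are counted from the start of `cur`: its last entry sits at `b`, so `i + t` sits at
-- `b + t + 1` and is joined to its predecessor at `b + t`.
groupBy-internal : ∀ p cur i l b t → length cur ≡ suc b → t < l → p (i + t) ≡ true → Internal (b + t) (groupBy p cur
    (range i l))
groupBy-internal p cur i (suc l) b zero    e _ pt rewrite +-identityʳ i | +-identityʳ b | pt =
  groupBy-head p (cur ++ [ i ]) (range (suc i) l) (≤-reflexive (sym (trans (length-++ cur) (trans (+-comm _ 1) (cong
      suc e)))))
groupBy-internal p cur i (suc l) b (suc t) e (s≤s lt) pt with p i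
... | true  = subst (λ k → Internal k (groupBy p (cur ++ [ i ]) (range (suc i) l))) (sym (+-suc b t))
  (groupBy-internal p (cur ++ [ i ]) (suc i) l (suc b) t (trans (length-++ cur) (trans (+-comm _ 1) (cong suc e))) lt
      (trans (cong p (sym (+-suc i t))) pt))
... | false = there (trans (+-suc b t) (cong (_+ t) (sym e))) (groupBy-internal p [ i ] (suc i) l 0 t refl lt (trans
    (cong p (sym (+-suc i t))) pt))

any-≟⁻ : ∀ i xs → any (λ s → ⌊ s ≟ i ⌋) xs ≡ true → i ∈ xs
any-≟⁻ i (x ∷ xs) h with x ≟ i
... | yes refl = here refl
... | no _     = there (any-≟⁻ i xs h)

any-≟⁺ : ∀ {i xs} → i ∈ xs → any (λ s → ⌊ s ≟ i ⌋) xs ≡ true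
any-≟⁺ {i} (here {x = x} refl) with x ≟ x
... | yes _ = refl
... | no ne = contradiction refl ne
any-≟⁺ {i} (there {x = x} p) with x ≟ i
... | yes _ = refl
... | no _  = any-≟⁺ p

map-suc-upTo : ∀ l → map suc (upTo l) ≡ range 1 l
map-suc-upTo l = trans (map-upTo suc l) (applyUpTo-range suc 1 l λ _ → refl)

columns-concat : ∀ n d → concat (columnIntervals n d) ≡ upTo n
columns-concat zero    d = refl
columns-concat (suc n) d = trans (concat-groupBy _ [ 0 ] (map suc (upTo n))) (cong (0 ∷_) (map-upTo suc n))

-- Indices are joined exactly at the descents of the word, so the word decreases along each column.
columns-desc : ∀ {rows} n → Runs rows → length (concat rows) ≡ n → All (Desc ∘ map (at (concat rows))) (columnIntervals
    n (map length rows))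
columns-desc zero    r e = []
columns-desc {rows} (suc n) r e rewrite map-suc-upTo n = groupBy-desc (at (concat rows)) _ desc [ 0 ] 1 n ([] ∷ [])
    (≤-refl ∷ [])
  where
  desc : ∀ i → any (λ s → ⌊ s ≟ i ⌋) (partialSums 0 (initL (map length rows))) ≡ true → at (concat rows) i < at (concat
      rows) (i ∸ 1)
  desc i h = proj₂ (∈-filter⁻ (descentAt? (concat rows)) {xs = map suc (upTo (pred (length (concat rows))))}
    (subst (i ∈_) (partialSums-runs r) (any-≟⁻ i _ h)))

columns-internal : ∀ n d s → suc s < n → suc s ∈ partialSums 0 (initL d) → Internal s (columnIntervals n d)
columns-internal (suc n) d s (s≤s lt) h rewrite map-suc-upTo n = groupBy-internal _ [ 0 ] 1 n 0 s refl lt (any-≟⁺ h)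

colPerms-↭ : ∀ n d {γ} → γ ∈ colPerms n d → γ ↭ upTo n
colPerms-↭ n d γ∈ with choices-perms⁻ (columnIntervals n d) γ∈
... | γs , ps , refl = ↭-trans (concat-↭ ps) (↭-reflexive (columns-concat n d))

colPerms-unique : ∀ n d → Unique (colPerms n d)
colPerms-unique n d = choices-perms-unique (columnIntervals n d)
  (unique-concat⁻ _ (subst Unique (sym (columns-concat n d)) (Uniqueₚ.upTo⁺ n)))

id∈colPerms : ∀ n d → upTo n ∈ colPerms n d
id∈colPerms n d = subst (_∈ colPerms n d) (columns-concat n d) (choices-perms⁺ {Ks = columnIntervals n d}
    (Pointwise.refl ↭-refl))

colPerms-swap : ∀ n d s {γ} → γ ∈ colPerms n d → suc s < n → suc s ∈ partialSums 0 (initL d) → swapAt s γ ∈ colPerms n d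
colPerms-swap n d s γ∈ lt h with choices-perms⁻ (columnIntervals n d) γ∈
... | γs , ps , refl = subst (_∈ colPerms n d)
    (concat-swapIn (Internal-resp (Pointwise.symmetric ↭-sym ps) (columns-internal n d s lt h)))
    (choices-perms⁺ (Pointwise.transitive ↭-trans (swapIn-↭ s γs) ps))

map-at-upTo : ∀ α → map (at α) (upTo (length α)) ≡ α
map-at-upTo α = trans (map-upTo (at α) (length α)) (go α)
  where
  go : ∀ α → applyUpTo (at α) (length α) ≡ α
  go []      = refl
  go (x ∷ α) = cong (x ∷_) (go α)

at-∈ : ∀ {i} α → i < length α → at α i ∈ α
at-∈ {zero}  (x ∷ α) _       = here refl
at-∈ {suc i} (x ∷ α) (s≤s h) = there (at-∈ α h)

at-injective : ∀ {α i j} → Unique α → i < length α → j < length α → at α i ≡ at α j → i ≡ j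
at-injective {x ∷ α} {zero}  {zero}  _       _       _       _ = refl
at-injective {x ∷ α} {zero}  {suc j} (n ∷ _) _       (s≤s h) e = contradiction e (All.lookup n (at-∈ α h))
at-injective {x ∷ α} {suc i} {zero}  (n ∷ _) (s≤s h) _       e = contradiction (sym e) (All.lookup n (at-∈ α h))
at-injective {x ∷ α} {suc i} {suc j} (_ ∷ u) (s≤s h) (s≤s k) e = cong suc (at-injective u h k e)

map-injective-on : ∀ {f : ℕ → ℕ} {P : ℕ → Set} → (∀ {i j} → P i → P j → f i ≡ f j → i ≡ j) →
  ∀ {xs ys} → All P xs → All P ys → map f xs ≡ map f ys → xs ≡ ys
map-injective-on inj []       []       _ = refl
map-injective-on inj (p ∷ ps) (q ∷ qs) e = cong₂ _∷_ (inj p q (∷-injectiveˡ e)) (map-injective-on inj ps qs (∷-injectiveʳ e))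

compose-injective : ∀ {n α γ γ′} → α ↭ upTo n → γ ↭ upTo n → γ′ ↭ upTo n → compose α γ ≡ compose α γ′ → γ ≡ γ′
compose-injective {n} {α} p q q′ = map-injective-on (at-injective (unique-↭ (↭-sym p) (Uniqueₚ.upTo⁺ n))) (bound q)
    (bound q′)
  where
  bound : ∀ {γ} → γ ↭ upTo n → All (_< length α) γ
  bound q = All-resp-↭ (↭-sym q) (All.map (λ lt → ≤-trans lt (≤-reflexive (sym (trans (↭-length p) (length-upTo n)))))
      (Allₚ.all-upTo n))

compose-id : ∀ {n α} → α ↭ upTo n → compose α (upTo n) ≡ α
compose-id {n} {α} p rewrite sym (trans (↭-length p) (length-upTo n)) = map-at-upTo α

compose-↭ : ∀ {n α γ} → α ↭ upTo n → γ ↭ upTo n → compose α γ ↭ upTo n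
compose-↭ {α = α} p q = ↭-trans (↭-map⁺ (at α) q) (↭-trans (↭-reflexive (compose-id p)) p)

-- γ permutes within columns, and along a column the word already has the order with most
-- inversions. Columns are consecutive, so the comparisons concatenate.
compose-⊑ : ∀ {n rows γ} → Runs rows → concat rows ↭ upTo n → γ ∈ colPerms n (map length rows) → compose (concat rows)
    γ ⊑ concat rows
compose-⊑ {n} {rows} r p γ∈ with choices-perms⁻ (columnIntervals n (map length rows)) γ∈
... | γs , ps , refl = ⊑-trans (⊑-reflexive (sym (concat-map γs))) (⊑-trans (⊑-concat (go ps (columns-desc n r (trans
    (↭-length p) (length-upTo n)))))
    (⊑-reflexive (trans (concat-map (columnIntervals n (map length rows))) (trans (cong (map (at (concat rows)))
        (columns-concat n (map length rows))) (compose-id p)))))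
  where
  go : ∀ {γs Ks} → Pointwise _↭_ γs Ks → All (Desc ∘ map (at (concat rows))) Ks →
    Pointwise _⊑_ (map (map (at (concat rows))) γs) (map (map (at (concat rows))) Ks)
  go []       []       = []
  go (p ∷ ps) (d ∷ ds) = desc⇒⊑ d (↭-map⁺ _ p) ∷ go ps ds

-- Pivots and leading terms

asc-glue : ∀ u {v w} → Asc (u ++ v) → Asc (v ++ w) → NonEmpty v → Asc (u ++ v ++ w)
asc-glue []      _       b _ = b
asc-glue (x ∷ u) {y ∷ v} (h ∷ a) b@(k ∷ _) ne = Allₚ.++⁺ (Allₚ.++⁻ˡ u h) (Allₚ.++⁺ hv (All.map (≤-trans (All.head hv))
    (Allₚ.++⁻ʳ v k))) ∷ asc-glue u a b ne
  where hv = Allₚ.++⁻ʳ u h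

¬asc⇒Descent : ∀ {u v} → Asc u → Asc v → NonEmpty u → NonEmpty v → ¬ Asc (u ++ v) → Descent u v
¬asc⇒Descent {u} {y ∷ v} au av@(h ∷ _) ne _ ¬a with initLast u
... | u′ ∷ʳ′ x with y <? x
...   | yes y<x = u′ , x , y , v , refl , refl , y<x
...   | no y≮x  = contradiction (subst Asc (sym (++-assoc u′ [ x ] (y ∷ v)))
    (asc-glue u′ au ((≮⇒≥ y≮x ∷ All.map (≤-trans (≮⇒≥ y≮x)) h) ∷ av) z<s)) ¬a

-- The shape of a leading face: the nonpointed blocks are grouped into rows, each an ascending run
-- of the word with strictly decreasing block sizes, and the pointed block is a run by itself.
record PivotRows (F : Face) : Set where
  constructor pivotRows
  field
    rows     : List Face
    final    : List ℕ
    face     : concat rows ++ [ final ] ≡ F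
    runs     : Runs (map concat rows ++ [ final ])
    desc     : All (Desc ∘ map length) rows
    nonempty : All (λ R → 0 < length R) rows

nonPivot-∷ : ∀ {C F} → NonPivot F → NonPivot (C ∷ F)
nonPivot-∷ {C} (nonPivot A X Y B asc small) = nonPivot (C ∷ A) X Y B asc small

-- The face is read from the right. A descent after `C` starts a new row; without a descent, a
-- strictly larger nonpointed neighbour joins the row that follows, and every other case exhibits a
-- non-pivot.
pivot? : ∀ C F → All NonEmpty (C ∷ F) → All Asc (C ∷ F) → NonPivot (C ∷ F) ⊎ PivotRows (C ∷ F)
pivot? C []       (ne ∷ _) (a ∷ _) = inj₂ (pivotRows [] C refl (last a ne) [] [])
pivot? C (C′ ∷ F) (ne ∷ nes) (a ∷ as) with pivot? C′ F nes as | AllPairs.allPairs? _≤?_ (C ++ C′)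
... | inj₁ np | _ = inj₁ (nonPivot-∷ np)
-- No rows yet: `C′` is the pointed block, and ascent into it suffices whatever the sizes.
... | inj₂ (pivotRows [] .C′ refl r d k) | yes asc = inj₁ (nonPivot [] C C′ [] asc (inj₂ refl))
... | inj₂ (pivotRows [] .C′ refl r d k) | no ¬asc = inj₂ (pivotRows ([ C ] ∷ []) C′ refl
    (subst (λ u → Runs (u ∷ C′ ∷ [])) (sym (++-identityʳ C)) (step a (¬asc⇒Descent a (All.head as) ne (All.head nes)
        ¬asc) r))
    (([] ∷ []) ∷ []) (z<s ∷ []))
... | inj₂ (pivotRows ([] ∷ _) _ _ _ _ (() ∷ _)) | _
... | inj₂ (pivotRows ((.C′ ∷ R) ∷ Rs) Z refl r d k) | no ¬asc = inj₂ (pivotRows ([ C ] ∷ (C′ ∷ R) ∷ Rs) Z refl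
    (subst (λ u → Runs (u ∷ (C′ ++ concat R) ∷ map concat Rs ++ [ Z ])) (sym (++-identityʳ C))
      (step a (Descent-++ʳ (concat R) (¬asc⇒Descent a (All.head as) ne (All.head nes) ¬asc)) r))
    (([] ∷ []) ∷ d) (z<s ∷ k))
... | inj₂ (pivotRows ((.C′ ∷ R) ∷ Rs) Z refl r (d ∷ ds) (_ ∷ k)) | yes asc with length C ≤? length C′
...   | yes le = inj₁ (nonPivot [] C C′ _ asc (inj₁ le))
...   | no ¬le = inj₂ (pivotRows ((C ∷ C′ ∷ R) ∷ Rs) Z refl
    (Runs-extend C (asc-glue C asc (All.head (Runs-asc r)) (All.head nes)) r)
    (((≰⇒> ¬le ∷ All.map (λ lt → <-trans lt (≰⇒> ¬le)) (AllPairs.head d)) ∷ d) ∷ ds) (z<s ∷ k))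

∃-desc : ∀ xs → Unique xs → ∃ λ ys → ys ↭ xs × Desc ys
∃-desc xs u = sortDesc xs , ↭-trans (↭-reverse (sortℕ xs)) (sortℕ-↭ xs) ,
  reverse-desc (strict (sortℕ-asc xs) (unique-↭ (↭-sym (sortℕ-↭ xs)) u))
  where
  strict : ∀ {ys} → Asc ys → Unique ys → AllPairs _<_ ys
  strict []       []       = []
  strict (h ∷ a) (k ∷ u) = All.zipWith (λ { (le , ne) → ≤∧≢⇒< le ne }) (h , k) ∷ strict a u
  reverse-desc : ∀ {ys} → AllPairs _<_ ys → Desc (reverse ys)
  reverse-desc []                    = []
  reverse-desc {y ∷ ys} (h ∷ a) = subst Desc (sym (unfold-reverse y ys))
    (AllPairsₚ.++⁺ (reverse-desc a) ([] ∷ []) (All-resp-↭ (↭-sym (↭-reverse ys)) (All.map (_∷ []) h)))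

-- Corresponding lists have equal lengths, so the concatenation determines the cuts.
Pointwise-concat-≡ : ∀ {xss yss : List (List ℕ)} → Pointwise _⊑_ xss yss → concat xss ≡ concat yss → xss ≡ yss
Pointwise-concat-≡ []                        _  = refl
Pointwise-concat-≡ {xs ∷ _} {ys ∷ _} (p ∷ ps) eq with ++-injective xs ys (↭-length (proj₁ p)) eq
... | refl , eq′ = cong (xs ∷_) (Pointwise-concat-≡ ps eq′)

concat-map-sortℕ-⊑ : ∀ F → concat (map sortℕ F) ⊑ concat F
concat-map-sortℕ-⊑ F = ⊑-concat (go F)
  where
  go : ∀ F → Pointwise _⊑_ (map sortℕ F) F
  go []      = []
  go (C ∷ F) = sortℕ-⊑ C ∷ go F

module Pivots (n : ℕ) (la : List ℕ) (m : ℕ) (knap : IsKnapsack la) (total : sum la + m ≡ n) (m>0 : 0 < m) where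

  open TopFaces n la m knap
  open Top

  Pair : Set
  Pair = List ℕ × List (List ℕ)

  private
    positive : ∀ {cs} → cs ↭ la → All (0 <_) cs
    positive p = All-resp-↭ (↭-sym p) (proj₁ knap)

    sum-zero : ∀ {s} → All (0 <_) s → sum s ≡ 0 → s ≡ []
    sum-zero []            _ = refl
    sum-zero (s≤s _ ∷ _) ()

  -- The last segment ends in the part `m` and sums to `m`; as the parts of λ are positive, it
  -- consists of `m` alone.
  W-structure : ∀ {ds w} → w ∈ Wpairs la m (ds ++ [ m ]) → ∃₂ λ cs segs →
    w ≡ (cs ++ [ m ] , segs ++ [ [ m ] ]) × cs ↭ la × concat segs ≡ cs × map sum segs ≡ ds × All NonEmpty segs
  W-structure {ds} {c , segs} w∈ with Wpairs⁻ la m (ds ++ [ m ]) w∈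
  ... | cs , refl , p , e , ne , e′ with initLast segs
  ...   | []         = contradiction (++-conicalʳ ds [ m ] (sym e′)) λ ()
  ...   | segs₀ ∷ʳ′ s with ∷ʳ-injective (map sum segs₀) ds (trans (sym (map-++ sum segs₀ [ s ])) e′) | initLast s
  ...     | _ , _ | [] = contradiction (All.head (Allₚ.++⁻ʳ segs₀ ne)) λ ()
  ...     | e₁ , e₂ | s′ ∷ʳ′ z with ∷ʳ-injective (concat segs₀ ++ s′) cs
              (trans (++-assoc (concat segs₀) s′ [ z ]) (trans (sym (concat-∷ʳ segs₀ (s′ ++ [ z ]))) e))
  ...       | refl , refl with sum-zero (Allₚ.++⁻ʳ (concat segs₀) (positive p)) (m+n≡m⇒n≡0 (trans (+-comm (z + 0) _)
      (trans (sym (sum-++ s′ [ z ])) (trans e₂ (sym (+-identityʳ z))))))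
    where
    m+n≡m⇒n≡0 : ∀ {a b} → a + b ≡ a → b ≡ 0
    m+n≡m⇒n≡0 {a} {b} h = +-cancelˡ-≡ a b 0 (trans h (sym (+-identityʳ a)))
  ...         | refl = concat segs₀ ++ [] , segs₀ , refl , p , sym (++-identityʳ _) , e₁ , Allₚ.++⁻ˡ segs₀ ne

  segments-sub : ∀ {segs} → concat segs ↭ la → All (λ s → SubMultiset s la) segs
  segments-sub {segs} p = go [] segs p
    where
    go : ∀ pre segs → pre ++ concat segs ↭ la → All (λ s → SubMultiset s la) segs
    go pre []           _ = []
    go pre (s ∷ segs) p = (pre ++ concat segs , ↭-trans (↭-sym (shifts pre s)) p) ∷
      go (pre ++ s) segs (↭-trans (↭-reflexive (++-assoc pre s (concat segs))) p)

  same-sums-↭ : ∀ {segs segs′} → All (λ s → SubMultiset s la) segs → All (λ s → SubMultiset s la) segs′ →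
    map sum segs ≡ map sum segs′ → Pointwise _↭_ segs segs′
  same-sums-↭ []       []         _  = []
  same-sums-↭ (p ∷ ps) (q ∷ qs) eq = proj₂ knap _ _ p q (∷-injectiveˡ eq) ∷ same-sums-↭ ps qs (∷-injectiveʳ eq)

  -- By the knapsack property equal sums mean equal multisets, so two elements of W(d) have the same
  -- segments up to rearrangement, and decreasing segments have the most inversions.
  desc-dominates : ∀ {ds w w′} → w ∈ Wpairs la m (ds ++ [ m ]) → w′ ∈ Wpairs la m (ds ++ [ m ]) →
    All Desc (proj₂ w′) → Pointwise _⊑_ (proj₂ w) (proj₂ w′)
  desc-dominates {ds} {w} {w′} w∈ w′∈ d with W-structure {ds} w∈ | W-structure {ds} w′∈
  ... | cs , segs , refl , p , refl , e , _ | cs′ , segs′ , refl , p′ , refl , e′ , _ =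
    Pointwise.++⁺ (go (same-sums-↭ (segments-sub p) (segments-sub p′) (trans e (sym e′))) (Allₚ.++⁻ˡ segs′ d)) (⊑-refl ∷ [])
    where
    go : ∀ {xss yss} → Pointwise _↭_ xss yss → All Desc yss → Pointwise _⊑_ xss yss
    go []       []       = []
    go (p ∷ ps) (d ∷ ds) = desc⇒⊑ d p ∷ go ps ds

  -- ε(d) is characterised by domination within W(d), which determines it, instead of by an explicit
  -- sorting.
  record Epsilon (d : List ℕ) : Set where
    field
      ε         : Pair
      ε∈W       : ε ∈ Wpairs la m d
      dominates : ∀ {w} → w ∈ Wpairs la m d → Pointwise _⊑_ (proj₂ w) (proj₂ ε)
      segs-unique : ∀ {w} → w ∈ Wpairs la m d → All Unique (proj₂ w)

  -- The filter condition supplies one cut of an arrangement of λ. Distinctness is given only for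
  -- some multiset with the same sum; the knapsack property transfers it to the actual segment,
  -- which can then be sorted strictly.
  V⇒Epsilon : ∀ {d} → InV n la m d → Epsilon d
  V⇒Epsilon ((_ , c , _ , (cs , .m , refl , p , refl) , segs , e , ne , sums) , ds , refl , parts)
    with W-structure {ds} (Wpairs⁺ la m (ds ++ [ m ]) cs segs p e ne sums)
  ... | cs₀ , segs₀ , eq , p₀ , refl , e₀ , ne₀ = record
    { ε           = concat (proj₁ sorted) ++ [ m ] , proj₁ sorted ++ [ [ m ] ]
    ; ε∈W         = ε∈
    ; dominates   = λ w∈ → desc-dominates {ds} w∈ ε∈ (Allₚ.++⁺ (proj₂ (proj₂ sorted)) (([] ∷ []) ∷ []))
    ; segs-unique = all-unique
    }
    where
    unique-segs : ∀ {ss xs} → All (λ s → SubMultiset s la) ss → map sum ss ≡ xs →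
      All (λ x → ∃ λ μ → SubMultiset μ la × Unique μ × sum μ ≡ x) xs → All Unique ss
    unique-segs []       refl []                         = []
    unique-segs (q ∷ qs) refl ((μ , r , u , s) ∷ h) =
      unique-↭ (proj₂ knap μ _ r q s) u ∷ unique-segs qs refl h
    sort-all : ∀ {ss} → All Unique ss → ∃ λ ts → Pointwise _↭_ ts ss × All Desc ts
    sort-all []               = [] , [] , []
    sort-all {s ∷ _} (u ∷ us) with ∃-desc s u | sort-all us
    ... | t , q , d | ts , qs , ds = t ∷ ts , q ∷ qs , d ∷ ds
    sorted = sort-all (unique-segs (segments-sub p₀) e₀ parts)
    ε∈ : (concat (proj₁ sorted) ++ [ m ] , proj₁ sorted ++ [ [ m ] ]) ∈ Wpairs la m (ds ++ [ m ])
    ε∈ = Wpairs⁺ la m (ds ++ [ m ]) (concat (proj₁ sorted)) (proj₁ sorted ++ [ [ m ] ])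
      (↭-trans (concat-↭ (proj₁ (proj₂ sorted))) p₀)
      (concat-∷ʳ (proj₁ sorted) [ m ])
      (Allₚ.++⁺ (nonempty-↭ (proj₁ (proj₂ sorted)) ne₀) (z<s ∷ []))
      (trans (map-++ sum (proj₁ sorted) [ [ m ] ]) (cong₂ (λ a b → a ++ [ b ]) (trans (map-sum-↭ (proj₁ (proj₂
          sorted))) e₀) (+-identityʳ m)))
    all-unique : ∀ {w} → w ∈ Wpairs la m (ds ++ [ m ]) → All Unique (proj₂ w)
    all-unique w∈ with W-structure {ds} w∈
    ... | _ , segs₁ , refl , p₁ , refl , e₁ , _ = Allₚ.++⁺ (unique-segs (segments-sub p₁) e₁ parts) (([] ∷ []) ∷ [])

  W-sum : ∀ {d w} → w ∈ Wpairs la m d → sum (proj₁ w) ≡ n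
  W-sum {d} w∈ with Wpairs⁻ la m d w∈
  ... | cs , refl , p , _ = trans (sum-++ cs [ m ]) (trans (cong₂ _+_ (sum-↭ p) (+-identityʳ m)) total)

  length-perm : ∀ {α : List ℕ} → α ↭ upTo n → length α ≡ n
  length-perm p = trans (↭-length p) (length-upTo n)

  sigma-Top : ∀ {d w β} → w ∈ Wpairs la m d → β ↭ upTo n → Top (sigma β (proj₁ w))
  sigma-Top {d} {w} {β} w∈ q with Wpairs⁻ la m d w∈ | W-sum {d} w∈
  ... | cs , refl , p , _ | s = record
    { sizes  = cs
    ; shape  = trans (sym (map-∘ (chunks β (cs ++ [ m ])))) (trans (map-cong (λ B → ↭-length (sortℕ-↭ B)) (chunks β (cs
        ++ [ m ]))) (chunks-lengths β (cs ++ [ m ]) len))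
    ; sizes↭ = p
    ; asc    = Allₚ.map⁺ (All.tabulate λ {B} _ → sortℕ-asc B)
    ; word↭  = ↭-trans (proj₁ (concat-map-sortℕ-⊑ (chunks β (cs ++ [ m ])))) (↭-trans (↭-reflexive (chunks-concat β (cs
        ++ [ m ]) len)) q)
    }
    where
    len : sum (cs ++ [ m ]) ≡ length β
    len = trans s (sym (length-perm q))

  n>0 : 0 < n
  n>0 = ≤-trans m>0 (≤-trans (m≤n+m m (sum la)) (≤-reflexive total))

  record Leading (d α : List ℕ) : Set where
    field
      epsilon : Epsilon d
      rows    : List (List ℕ)
      runs    : Runs rows
      word    : concat rows ≡ α
      comp    : map length rows ≡ d
      α↭      : α ↭ upTo n
    open Epsilon epsilon public

    face : Face
    face = sigma α (proj₁ ε)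

    sigma-chunks : ∀ {w} → w ∈ Wpairs la m d → sigma α (proj₁ w) ≡ chunks α (proj₁ w)
    sigma-chunks {w} w∈ with Wpairs⁻ la m d w∈
    ... | cs , refl , _ , e , _ , sums = map-sortℕ-fix (subst₂ (λ β c → All Asc (chunks β c)) word e
      (rows-chunks-asc rows (proj₂ w) (Runs-asc runs) (trans comp (sym sums))))

    len : ∀ {w} → w ∈ Wpairs la m d → sum (proj₁ w) ≡ length α
    len w∈ = trans (W-sum {d} w∈) (sym (length-perm α↭))

    sigma-word : ∀ {w} → w ∈ Wpairs la m d → concat (sigma α (proj₁ w)) ≡ α
    sigma-word {w} w∈ = trans (cong concat (sigma-chunks w∈)) (chunks-concat α (proj₁ w) (len w∈))

    sigma-shape : ∀ {w} → w ∈ Wpairs la m d → map length (sigma α (proj₁ w)) ≡ proj₁ w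
    sigma-shape {w} w∈ = trans (cong (map length) (sigma-chunks w∈)) (chunks-lengths α (proj₁ w) (len w∈))

    -- Inversions can be lost twice: by sorting the blocks, and by permuting inside the columns.
    term-⊑ : ∀ {γ w} → γ ∈ colPerms n d → w ∈ Wpairs la m d →
      concat (sigma (compose α γ) (proj₁ w)) ⊑ compose α γ × compose α γ ⊑ α
    term-⊑ {γ} {w} γ∈ w∈ =
      ⊑-trans (concat-map-sortℕ-⊑ (chunks (compose α γ) (proj₁ w))) (⊑-reflexive (chunks-concat (compose α γ) (proj₁ w)
        (trans (W-sum {d} w∈) (sym (length-perm (compose-↭ α↭ (colPerms-↭ n d γ∈))))))) ,
      subst₂ (λ a b → compose a γ ⊑ b) word word (compose-⊑ runs (subst (_↭ upTo n) (sym word) α↭) (subst (λ e → γ ∈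
          colPerms n e) (sym comp) γ∈))

    concat≡ : ∀ {w} → w ∈ Wpairs la m d → concat (proj₂ w) ≡ proj₁ w
    concat≡ w∈ with Wpairs⁻ la m d w∈
    ... | _ , refl , _ , e , _ = e

    -- A loss at the level of words settles the comparison. Otherwise γ is trivial, every remaining
    -- term has the word α, and the size lists decide, with `ε` on top.
    term-key : ∀ {γ w} → γ ∈ colPerms n d → w ∈ Wpairs la m d →
      (γ ≡ upTo n × w ≡ ε) ⊎ key (sigma (compose α γ) (proj₁ w)) < key face
    term-key {γ} {w} γ∈ w∈ with term-⊑ γ∈ w∈
    ... | s₁ , s₂ with ⊑-trans s₁ s₂
    ...   | _ , inj₁ lt = inj₂ (key-word< {sigma (compose α γ) (proj₁ w)} {face} (length-top (sigma-Top {d} w∈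
        (compose-↭ α↭ (colPerms-↭ n d γ∈))))
        (subst (λ u → inversions (concat (sigma (compose α γ) (proj₁ w))) < inversions u) (sym (sigma-word ε∈W)) lt))
    -- Equality of the two ends squeezes `compose α γ` to α.
    ...   | _ , inj₂ eq with compose-injective α↭ (colPerms-↭ n d γ∈) ↭-refl (trans (⊑-antisym s₂ (subst (λ u →
        inversions u ≤ inversions (compose α γ)) eq (⊑⇒≤ s₁))) (sym (compose-id α↭)))
    ...     | refl with ⊑-concat (dominates w∈)
    ...       | q , inj₂ eq′ = inj₁ (refl , same-ε)
      where
      same-ε : w ≡ ε
      same-ε = cong₂ _,_ (trans (sym (concat≡ w∈)) (trans eq′ (concat≡ ε∈W))) (Pointwise-concat-≡ (dominates w∈) eq′)
    ...       | q , inj₁ lt rewrite compose-id α↭ = inj₂ (key-shape< {sigma α (proj₁ w)} {face} (trans (sigma-word w∈)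
        (sym (sigma-word ε∈W)))
        (subst₂ (λ a b → inversions a < inversions b) (trans (concat≡ w∈) (sym (sigma-shape w∈))) (trans (concat≡ ε∈W)
            (sym (sigma-shape ε∈W))) lt))

  GIndex⇒Leading : ∀ {d α} → GIndex n la m (d , α) → Leading d α
  GIndex⇒Leading {d} {[]}    (v , p , dc) = contradiction (subst (0 <_) (sym (length-perm p)) n>0) λ ()
  GIndex⇒Leading {d} {x ∷ α} (v , p , dc) with ∃-runs x α
  ... | u , us , r , eq = record
    { epsilon = V⇒Epsilon v
    ; rows    = (x ∷ u) ∷ us
    ; runs    = r
    ; word    = eq
    ; comp    = trans (sym (descComp-runs r)) (trans (cong₂ descComp (trans (cong length eq) (length-perm p)) eq) dc)
    ; α↭      = p
    }

  -- `d` is read off as the row sums together with `m`. The rows being runs makes it the descent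
  -- composition, and the decreasing sizes identify the cut given by the rows with `ε`.
  pivot-index : ∀ {F} → Top F → PivotRows F → ∃₂ λ d α → Σ (GIndex n la m (d , α)) λ g → Leading.face (GIndex⇒Leading g) ≡ F
  pivot-index {F} t (pivotRows rows Z refl r ds ne) = d , concat F , g , face≡
    where
    segs₀ = map (map length) rows
    segs = segs₀ ++ [ [ m ] ]
    rowWords = map concat rows ++ [ Z ]
    d₀ = map sum segs₀
    d = d₀ ++ [ m ]
    α = concat F
    shape≡ : map length (concat rows) ≡ sizes t × length Z ≡ m
    shape≡ = ∷ʳ-injective _ (sizes t) (trans (sym (map-++ length (concat rows) [ Z ])) (shape t))
    concat-segs₀ : concat segs₀ ≡ sizes t
    concat-segs₀ = trans (concat-map rows) (proj₁ shape≡)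
    concat-segs : concat segs ≡ sizes t ++ [ m ]
    concat-segs = trans (concat-∷ʳ segs₀ [ m ]) (cong (_++ [ m ]) concat-segs₀)
    segs₀↭ : concat segs₀ ↭ la
    segs₀↭ = subst (_↭ la) (sym concat-segs₀) (sizes↭ t)
    sums : map sum segs ≡ d
    sums = trans (map-++ sum segs₀ [ [ m ] ]) (cong (λ k → d₀ ++ [ k ]) (+-identityʳ m))
    lengths-words : ∀ rows → map length (map concat rows) ≡ map sum (map (map length) rows)
    lengths-words []         = refl
    lengths-words (R ∷ rows) = cong₂ _∷_ (length-concat R) (lengths-words rows)
    comp : map length rowWords ≡ d
    comp = trans (map-++ length (map concat rows) [ Z ]) (cong₂ (λ a b → a ++ [ b ]) (lengths-words rows) (proj₂ shape≡))
    concat-words : ∀ rows → concat (map concat rows) ≡ concat (concat rows)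
    concat-words []         = refl
    concat-words (R ∷ rows) = trans (cong (concat R ++_) (concat-words rows)) (concat-++ R (concat rows))
    word : concat rowWords ≡ α
    word = trans (concat-∷ʳ (map concat rows) Z) (trans (cong (_++ Z) (concat-words rows)) (sym (concat-∷ʳ (concat rows) Z)))
    segs-nonempty : All NonEmpty segs
    segs-nonempty = Allₚ.++⁺ (Allₚ.map⁺ (All.map (λ {R} h → subst (0 <_) (sym (length-map length R)) h) ne)) (z<s ∷ [])
    comp-positive : ∀ {ss} → All NonEmpty ss → All (0 <_) (concat ss) → All (0 <_) (map sum ss)
    comp-positive []                        _ = []
    comp-positive {(x ∷ s) ∷ ss} (h ∷ hs) (x>0 ∷ p) = ≤-trans x>0 (m≤m+n x (sum s)) ∷ comp-positive hs (Allₚ.++⁻ʳ s p)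
    sum-shape : sum (sizes t ++ [ m ]) ≡ n
    sum-shape = trans (sum-++ (sizes t) [ m ]) (trans (cong₂ _+_ (sum-↭ (sizes↭ t)) (+-identityʳ m)) total)
    desc⇒unique : ∀ {s} → Desc s → Unique s
    desc⇒unique = AllPairs.map (λ lt → <⇒≢ lt ∘ sym)
    v : InV n la m d
    v = ((d₀ , m , refl , comp-positive (Allₚ.++⁻ˡ segs₀ segs-nonempty) (positive segs₀↭) ,
            trans (cong sum (sym sums)) (trans (sym (sum-concat segs)) (trans (cong sum concat-segs) sum-shape))) ,
          sizes t ++ [ m ] , (sizes t , m , refl , positive (sizes↭ t) , sum-shape) , (sizes t , m , refl , sizes↭ t ,
              refl) ,
          segs , concat-segs , segs-nonempty , sums) ,
        d₀ , refl , parts (segments-sub {segs₀} segs₀↭) (Allₚ.map⁺ ds)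
      where
      parts : ∀ {ss} → All (λ s → SubMultiset s la) ss → All Desc ss → All (λ x → ∃ λ μ → SubMultiset μ la × Unique μ ×
          sum μ ≡ x) (map sum ss)
      parts []       []       = []
      parts (q ∷ qs) (d ∷ ds) = (_ , q , desc⇒unique d , refl) ∷ parts qs ds
    dc : descComp n α ≡ d
    dc = trans (cong₂ descComp (sym (trans (cong length word) (length-perm (word↭ t)))) (sym word)) (trans
        (descComp-runs r) comp)
    g : GIndex n la m (d , α)
    g = v , word↭ t , dc
    L = GIndex⇒Leading g
    w∈ : (sizes t ++ [ m ] , segs) ∈ Wpairs la m d
    w∈ = Wpairs⁺ la m d (sizes t) segs (sizes↭ t) concat-segs segs-nonempty sums
    -- Each of the two cuts dominates the other.
    ε≡ : Leading.ε L ≡ (sizes t ++ [ m ] , segs)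
    ε≡ with Wpairs⁻ la m d (Leading.ε∈W L) | ⊑-concat (Leading.dominates L w∈) |
         ⊑-concat (desc-dominates {d₀} (Leading.ε∈W L) w∈ (Allₚ.++⁺ (Allₚ.map⁺ ds) (([] ∷ []) ∷ [])))
    ... | cs , e , _ , e′ , _ | le | ge = cong₂ _,_
          (trans e (trans (sym e′) (trans (sym same) concat-segs)))
          (sym (Pointwise-concat-≡ (Leading.dominates L w∈) same))
      where
      same : concat segs ≡ concat (proj₂ (Leading.ε L))
      same = ⊑-antisym le (⊑⇒≤ ge)
    face≡ : Leading.face L ≡ F
    face≡ = trans (Leading.sigma-chunks L (Leading.ε∈W L)) (trans (cong (λ w → chunks α (proj₁ w)) ε≡)
      (trans (cong (chunks α) (sym (shape t))) (chunks-map-length F)))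

-- The cycles

indexOf-injective : ∀ {x y ys} → x ∈ ys → y ∈ ys → indexOf x ys ≡ indexOf y ys → x ≡ y
indexOf-injective {x} {y} {z ∷ ys} x∈ y∈ e with x ≟ z | y ≟ z
... | yes refl | yes refl = refl
indexOf-injective (here refl) y∈          e | no ne | _     = contradiction refl ne
indexOf-injective (there x∈)  (here refl) e | no _  | no ne = contradiction refl ne
indexOf-injective (there x∈)  (there y∈)  e | no _  | no _  = indexOf-injective x∈ y∈ (suc-injective e)

unique-map-on : ∀ (f : ℕ → ℕ) {xs} → (∀ {x y} → x ∈ xs → y ∈ xs → f x ≡ f y → x ≡ y) → Unique xs → Unique (map f xs)
unique-map-on f inj []      = []
unique-map-on f inj (h ∷ u) = Allₚ.map⁺ (All.tabulate λ y∈ e → All.lookup h y∈ (inj (here refl) (there y∈) e)) ∷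
  unique-map-on f (λ p q → inj (there p) (there q)) u

sortDesc-↭ : ∀ xs → sortDesc xs ↭ xs
sortDesc-↭ xs = ↭-trans (↭-reverse (sortℕ xs)) (sortℕ-↭ xs)

rhoSeg-unique : ∀ {seg} → Unique seg → Unique (rhoSeg seg)
rhoSeg-unique {seg} = unique-map-on _ λ p q → indexOf-injective (up p) (up q)
  where
  up : ∀ {x} → x ∈ seg → x ∈ sortDesc seg
  up = ∈-resp-↭ (↭-sym (sortDesc-↭ seg))

-- The reference order `sortDesc seg` depends only on the contents, so an exchange affects only the
-- listing of the entries.
rhoSeg-swapAt : ∀ j seg → rhoSeg (swapAt j seg) ≡ swapAt j (rhoSeg seg)
rhoSeg-swapAt j seg = trans (cong (λ o → map (λ x → indexOf x (reverse o)) (swapAt j seg)) (sortℕ-cong (swapAt-↭ j seg)))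
  (map-swapAt _ j seg)

-- The exponent inside `signW`.
segsInversions : List (List ℕ) → ℕ
segsInversions segs = sum (map (λ s → inversions (rhoSeg s)) segs)

Neighbours-+ˡ : ∀ k {a b} → Neighbours a b → Neighbours (k + a) (k + b)
Neighbours-+ˡ k {b = b} (inj₁ refl) = inj₁ (+-suc k b)
Neighbours-+ˡ k {a = a} (inj₂ refl) = inj₂ (+-suc k a)

Neighbours-+ʳ : ∀ k {a b} → Neighbours a b → Neighbours (a + k) (b + k)
Neighbours-+ʳ k (inj₁ refl) = inj₁ refl
Neighbours-+ʳ k (inj₂ refl) = inj₂ refl

Neighbours-≢ : ∀ {a b} → Neighbours a b → a ≢ b
Neighbours-≢ (inj₁ e) refl = contradiction (sym e) 1+n≢n
Neighbours-≢ (inj₂ e) refl = contradiction (sym e) 1+n≢n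

segsInversions-swapIn : ∀ {j segs} → Internal j segs → All Unique segs →
  Neighbours (segsInversions (swapIn j segs)) (segsInversions segs)
segsInversions-swapIn {j} {seg ∷ segs} (here h) (u ∷ _) with suc j <? length seg
... | no ¬h = contradiction h ¬h
... | yes _ rewrite rhoSeg-swapAt j seg = Neighbours-+ʳ (segsInversions segs)
  (inversions-swapAt j (rhoSeg-unique u) (≤-trans h (≤-reflexive (sym (length-map _ seg)))))
segsInversions-swapIn {j} {seg ∷ segs} (there {j′ = j′} refl i) (_ ∷ us) with suc (length seg + j′) <? length seg
... | yes h = contradiction h (≤⇒≯ (m≤n⇒m≤1+n (m≤m+n (length seg) j′)))
... | no _ rewrite m+n∸m≡n (length seg) j′ = Neighbours-+ˡ _ (segsInversions-swapIn i us)

-- Merged faces under the two kinds of exchange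

module _ {a} {A : Set a} where

  take-take-drop : ∀ p q (xs : List A) → take p xs ++ take q (drop p xs) ≡ take (p + q) xs
  take-take-drop zero    q xs       = refl
  take-take-drop (suc p) zero    [] = refl
  take-take-drop (suc p) (suc q) [] = refl
  take-take-drop (suc p) q (x ∷ xs) = cong (x ∷_) (take-take-drop p q xs)

  drop-drop-+ : ∀ p q (xs : List A) → drop q (drop p xs) ≡ drop (p + q) xs
  drop-drop-+ zero    q       xs       = refl
  drop-drop-+ (suc p) zero    []       = refl
  drop-drop-+ (suc p) (suc q) []       = refl
  drop-drop-+ (suc p) q       (x ∷ xs) = drop-drop-+ p q xs

  swapAt-[] : ∀ i → swapAt i [] ≡ ([] {A = A})
  swapAt-[] zero    = refl
  swapAt-[] (suc i) = refl

  take-swapAt-↭ : ∀ i r (xs : List A) → suc i < r → take r (swapAt i xs) ↭ take r xs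
  take-swapAt-↭ zero    (suc (suc r)) []           _       = ↭-refl
  take-swapAt-↭ zero    (suc (suc r)) (x ∷ [])     _       = ↭-refl
  take-swapAt-↭ zero    (suc (suc r)) (x ∷ y ∷ xs) _       = swap y x ↭-refl
  take-swapAt-↭ zero    (suc zero)    xs           (s≤s ())
  take-swapAt-↭ (suc i) (suc r)       []           _       = ↭-refl
  take-swapAt-↭ (suc i) (suc r)       (x ∷ xs)     (s≤s h) = prep x (take-swapAt-↭ i r xs h)

  drop-swapAt-< : ∀ i r (xs : List A) → suc i < r → drop r (swapAt i xs) ≡ drop r xs
  drop-swapAt-< zero    (suc (suc r)) []           _       = refl
  drop-swapAt-< zero    (suc (suc r)) (x ∷ [])     _       = refl
  drop-swapAt-< zero    (suc (suc r)) (x ∷ y ∷ xs) _       = refl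
  drop-swapAt-< zero    (suc zero)    xs           (s≤s ())
  drop-swapAt-< (suc i) (suc r)       []           _       = refl
  drop-swapAt-< (suc i) (suc r)       (x ∷ xs)     (s≤s h) = drop-swapAt-< i r xs h

  take-swapAt-+ : ∀ p i (xs : List A) → take p (swapAt (p + i) xs) ≡ take p xs
  take-swapAt-+ zero    i xs       = refl
  take-swapAt-+ (suc p) i []       = refl
  take-swapAt-+ (suc p) i (x ∷ xs) = cong (x ∷_) (take-swapAt-+ p i xs)

  drop-swapAt-+ : ∀ p i (xs : List A) → drop p (swapAt (p + i) xs) ≡ swapAt i (drop p xs)
  drop-swapAt-+ zero    i xs       = refl
  drop-swapAt-+ (suc p) i []       = sym (swapAt-[] i)
  drop-swapAt-+ (suc p) i (x ∷ xs) = drop-swapAt-+ p i xs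

-- Only `p + q` enters the right-hand side; this is behind the invariance under both exchanges.
sigma-merge-head : ∀ β p q c → mergeAt 0 (sigma β (p ∷ q ∷ c)) ≡ sortℕ (take (p + q) β) ∷ sigma (drop (p + q) β) c
sigma-merge-head β p q c = cong₂ _∷_
  (sortℕ-cong (↭-trans (↭-++⁺ (sortℕ-↭ (take p β)) (sortℕ-↭ (take q (drop p β)))) (↭-reflexive (take-take-drop p q β))))
  (cong (λ γ → sigma γ c) (drop-drop-+ p q β))

merge-swap-parts : ∀ j β c → suc j < length c → mergeAt j (sigma β (swapAt j c)) ≡ mergeAt j (sigma β c)
merge-swap-parts zero    β (p ∷ [])    (s≤s ())
merge-swap-parts zero    β (p ∷ q ∷ c) _ = trans (sigma-merge-head β q p c)
  (trans (cong (λ r → sortℕ (take r β) ∷ sigma (drop r β) c) (+-comm q p)) (sym (sigma-merge-head β p q c)))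
merge-swap-parts (suc j) β (p ∷ c) (s≤s h) = cong (sortℕ (take p β) ∷_) (merge-swap-parts j (drop p β) c h)

-- Counting from 0, positions `i` and `i + 1` hold the last value of block `j` and the first value
-- of the next one. Positivity of the next part puts both inside the merged block.
merge-swap-word : ∀ j i β c → suc j < length c → All (0 <_) c → suc i ≡ sum (take (suc j) c) →
  mergeAt j (sigma (swapAt i β) c) ≡ mergeAt j (sigma β c)
merge-swap-word zero    i β (p ∷ [])    (s≤s ())
merge-swap-word zero    i β (p ∷ q ∷ c) _ (_ ∷ q>0 ∷ _) e = trans (sigma-merge-head (swapAt i β) p q c)
  (trans (cong₂ (λ B γ → B ∷ sigma γ c) (sortℕ-cong (take-swapAt-↭ i (p + q) β lt)) (drop-swapAt-< i (p + q) β lt))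
      (sym (sigma-merge-head β p q c)))
  where
  lt : suc i < p + q
  lt = subst (_< p + q) (sym e) (+-monoʳ-< p q>0)
-- The parts after `p` up to the boundary have a positive sum, so the exchange lies entirely beyond
-- the first block and its position drops by `p`.
merge-swap-word (suc j) i β (p ∷ x ∷ c) (s≤s h) (_ ∷ x>0 ∷ c>0) e with sum (take (suc j) (x ∷ c)) in eq
... | zero  = contradiction (≤-trans x>0 (m≤m+n x (sum (take j c)))) (≤⇒≯ (≤-reflexive eq))
... | suc r with suc-injective (trans e (+-suc p r))
...   | refl = cong₂ _∷_ (cong sortℕ (take-swapAt-+ p r β))
  (trans (cong (λ γ → mergeAt j (sigma γ (x ∷ c))) (drop-swapAt-+ p r β)) (merge-swap-word j r (drop p β) (x ∷ c) h
      (x>0 ∷ c>0) (sym eq)))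

-- Applied to segments, whose last one is the single part `m`: an internal exchange never involves
-- the pointed part.
Internal-∷ʳ : ∀ {a} {A : Set a} {j} (xss : List (List A)) {z} → Internal j (xss ++ [ [ z ] ]) → suc j < length (concat xss)
Internal-∷ʳ []         (here (s≤s ()))
Internal-∷ʳ []         (there _ ())
Internal-∷ʳ (xs ∷ xss) (here h)                  = ≤-trans h (≤-trans (m≤m+n _ _) (≤-reflexive (sym (length-++ xs))))
Internal-∷ʳ (xs ∷ xss) (there {j′ = j′} refl i) = ≤-trans (≤-reflexive (trans (cong suc (sym (+-suc (length xs) j′)))
    (sym (+-suc (length xs) (suc j′)))))
    (≤-trans (+-monoʳ-≤ (length xs) (Internal-∷ʳ xss i)) (≤-reflexive (sym (length-++ xs))))

module Cycles {c ℓ} (K : Field c ℓ) (n : ℕ) (la : List ℕ) (m : ℕ)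
  (knap : IsKnapsack la) (total : sum la + m ≡ n) (m>0 : 0 < m) where

  open TopFaces n la m knap
  open Pivots n la m knap total m>0
  open ChainAlgebra K
  open Chains K
  open R using (Carrier; _≈_; 0#; 1#; -_) renaming (_+_ to _⊕_; _*_ to _⊛_)
  open RingProperties R.ring using (-‿distribˡ-*; -‿distribʳ-*)
  open SetoidReasoning R.setoid

  Term : Set
  Term = List ℕ × Pair

  module _ (d α : List ℕ) where

    terms : List Term
    terms = cartesianProduct (colPerms n d) (Wpairs la m d)

    termSign : Term → Carrier
    termSign (γ , w) = signOf (inversions γ) ⊛ signW (proj₂ w)

    termFace : Term → Face
    termFace (γ , w) = sigma (compose α γ) (proj₁ w)

    gCycle-terms : gCycle n la m d α ≡ map (λ t → termSign t , termFace t) terms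
    gCycle-terms = go (colPerms n d)
      where
      go : ∀ γs → concatMap (λ γ → map (λ w → termSign (γ , w) , termFace (γ , w)) (Wpairs la m d)) γs ≡
        map (λ t → termSign t , termFace t) (cartesianProduct γs (Wpairs la m d))
      go []       = refl
      go (γ ∷ γs) = trans (cong₂ _++_ (map-∘ (Wpairs la m d)) (go γs)) (sym (map-++ _ (map (γ ,_) (Wpairs la m d)) _))

    pair-gCycle : ∀ φ → pair (gCycle n la m d α) φ ≈ sumK (λ t → termSign t ⊛ φ (termFace t)) terms
    pair-gCycle φ rewrite gCycle-terms = sumK-map _ _ terms

    terms-unique : Unique terms
    terms-unique = Uniqueₚ.cartesianProduct⁺ (colPerms-unique n d) (Wpairs-unique la m d)

    terms⁻ : ∀ {t} → t ∈ terms → proj₁ t ∈ colPerms n d × proj₂ t ∈ Wpairs la m d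
    terms⁻ = ∈-cartesianProduct⁻ (colPerms n d) (Wpairs la m d)

    -- The sum of `take (suc j) c` is the 1-based boundary between the two merged blocks; `pred`
    -- turns it into a 0-based position in γ.
    toggle : ℕ → Term → Term
    toggle j (γ , c , segs) with internal? j segs
    ... | yes _ = γ , swapAt j c , swapIn j segs
    ... | no _  = swapAt (pred (sum (take (suc j) c))) γ , c , segs

    toggle-internal : ∀ {j γ c segs} → Internal j segs → toggle j (γ , c , segs) ≡ (γ , swapAt j c , swapIn j segs)
    toggle-internal {j} {segs = segs} i with internal? j segs
    ... | yes _ = refl
    ... | no ¬i = contradiction i ¬i

    toggle-boundary : ∀ {j γ c segs} → ¬ Internal j segs → toggle j (γ , c , segs) ≡ (swapAt (pred (sum (take (suc j)
        c))) γ , c , segs)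
    toggle-boundary {j} {segs = segs} ¬i with internal? j segs
    ... | yes i = contradiction i ¬i
    ... | no _  = refl

    -- An internal exchange preserves segment lengths, and a boundary exchange leaves `c` and `segs`
    -- alone, so the second application takes the same branch at the same position.
    toggle-involutive : ∀ j t → toggle j (toggle j t) ≡ t
    toggle-involutive j (γ , c , segs) with internal? j segs
    ... | yes i = trans (toggle-internal {γ = γ} {c = swapAt j c} (Internal-resp (Pointwise.symmetric ↭-sym (swapIn-↭ j
        segs)) i))
      (cong₂ (λ c segs → γ , c , segs) (swapAt-involutive j c) (swapIn-involutive j segs))
    ... | no ¬i = trans (toggle-boundary {γ = swapAt (pred (sum (take (suc j) c))) γ} {c = c} ¬i)
      (cong (λ γ → γ , c , segs) (swapAt-involutive (pred (sum (take (suc j) c))) γ))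

  module _ {ds α : List ℕ} (v : InV n la m (ds ++ [ m ])) (α↭ : α ↭ upTo n) where

    private
      d = ds ++ [ m ]
      segs-unique = Epsilon.segs-unique (V⇒Epsilon v)

      -- `moved` excludes fixed points, which the sign rule alone would not do in characteristic
      -- two.
      record Toggled (j : ℕ) (t t′ : Term) : Set ℓ where
        field
          member : t′ ∈ terms d α
          sign   : termSign d α t′ ≈ - termSign d α t
          merge  : mergeAt j (termFace d α t′) ≡ mergeAt j (termFace d α t)
          moved  : t′ ≢ t

      toggled-internal : ∀ {j γ c segs} → (γ , c , segs) ∈ terms d α → Internal j segs → Toggled j (γ , c , segs) (γ ,
          swapAt j c , swapIn j segs)
      toggled-internal {j} {γ} t∈ i with terms⁻ d α t∈
      ... | γ∈ , w∈ with W-structure {ds} w∈ | segs-unique w∈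
      ...   | cs , segs₀ , refl , p , refl , e , ne | u = record
        { member = ∈-cartesianProduct⁺ γ∈ w′∈
        ; sign   = R.trans (R.*-congˡ (signOf-neighbours nb)) (R.sym (-‿distribʳ-* _ _))
        ; merge  = merge-swap-parts j (compose α γ) (cs ++ [ m ]) (≤-trans lt (≤-trans (m≤m+n _ _) (≤-reflexive (sym
            (length-++ cs)))))
        ; moved  = λ eq → Neighbours-≢ nb (cong (segsInversions ∘ proj₂ ∘ proj₂) eq)
        }
        where
        lt : suc j < length cs
        lt = Internal-∷ʳ segs₀ i
        nb = segsInversions-swapIn i u
        segs = segs₀ ++ [ [ m ] ]
        swapped : swapAt j (cs ++ [ m ]) ≡ swapAt j cs ++ [ m ]
        swapped = swapAt-++ˡ j cs [ m ] lt
        w′∈ : (swapAt j (cs ++ [ m ]) , swapIn j segs) ∈ Wpairs la m d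
        w′∈ rewrite swapped = Wpairs⁺ la m d (swapAt j cs) (swapIn j segs) (↭-trans (swapAt-↭ j cs) p)
          (trans (concat-swapIn i) (trans (cong (swapAt j) (concat-∷ʳ segs₀ [ m ])) swapped))
          (nonempty-↭ (swapIn-↭ j segs) (Allₚ.++⁺ ne (z<s ∷ [])))
          (trans (map-sum-↭ (swapIn-↭ j segs)) (trans (map-++ sum segs₀ [ [ m ] ]) (cong₂ (λ a b → a ++ [ b ]) e
              (+-identityʳ m))))

      toggled-boundary : ∀ {j γ c segs} → j < length la → (γ , c , segs) ∈ terms d α → ¬ Internal j segs →
        Toggled j (γ , c , segs) (swapAt (pred (sum (take (suc j) c))) γ , c , segs)
      toggled-boundary {j} {γ} {c} {segs} j< t∈ ¬i with terms⁻ d α t∈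
      ... | γ∈ , w∈ with Wpairs⁻ la m d w∈
      ...   | cs , refl , p , e , ne , e′ = record
        { member = ∈-cartesianProduct⁺ (colPerms-swap n d pos γ∈ pos<n boundary) w∈
        ; sign   = R.trans (R.*-congʳ (signOf-neighbours nb)) (R.sym (-‿distribˡ-* _ _))
        ; merge  = trans (cong (λ β → mergeAt j (sigma β (cs ++ [ m ]))) (map-swapAt (at α) pos γ))
            (merge-swap-word j pos (compose α γ) (cs ++ [ m ]) lt c>0 (sym s≡))
        ; moved  = λ eq → Neighbours-≢ nb (cong (inversions ∘ proj₁) eq)
        }
        where
        s = sum (take (suc j) (cs ++ [ m ]))
        pos = pred s
        lt : suc j < length (cs ++ [ m ])
        lt = ≤-trans (s≤s j<) (≤-reflexive (sym (trans (length-++ cs) (trans (+-comm _ 1) (cong suc (↭-length p))))))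
        c>0 : All (0 <_) (cs ++ [ m ])
        c>0 = Allₚ.++⁺ (All-resp-↭ (↭-sym p) (proj₁ knap)) (m>0 ∷ [])
        sum-take>0 : ∀ {cs} j → suc j < length cs → All (0 <_) cs → 0 < sum (take (suc j) cs)
        sum-take>0 {x ∷ cs} j _ (h ∷ _) = ≤-trans h (m≤m+n x _)
        sum-take< : ∀ {cs} j → j < length cs → All (0 <_) cs → sum (take j cs) < sum cs
        sum-take< {x ∷ cs} zero    _       (h ∷ _)  = ≤-trans h (m≤m+n x _)
        sum-take< {x ∷ cs} (suc j) (s≤s h) (_ ∷ hs) = +-monoʳ-< x (sum-take< j h hs)
        s≡ : s ≡ suc pos
        s≡ with s in eq
        ... | zero  = contradiction (sum-take>0 j lt c>0) (≤⇒≯ (≤-reflexive eq))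
        ... | suc _ = refl
        -- At the last merging position only `m` lies beyond the boundary, and it is positive.
        pos<n : suc pos < n
        pos<n = subst₂ _<_ s≡ (W-sum {d} w∈) (sum-take< (suc j) lt c>0)
        boundary : suc pos ∈ partialSums 0 (initL d)
        boundary = subst₂ (λ x y → x ∈ partialSums 0 (initL y)) (trans (cong (sum ∘ take (suc j)) e) s≡) e′
          (boundary-sum 0 j segs (subst (λ l → suc j < length l) (sym e) lt) ¬i)
        γ↭ = colPerms-↭ n d γ∈
        nb : Neighbours (inversions (swapAt pos γ)) (inversions γ)
        nb = inversions-swapAt pos (unique-↭ (↭-sym γ↭) (Uniqueₚ.upTo⁺ n)) (≤-trans pos<n (≤-reflexive (sym
            (length-perm γ↭))))

      toggled : ∀ {j t} → j < length la → t ∈ terms d α → Toggled j t (toggle d α j t)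
      toggled {j} {γ , c , segs} j< t∈ with internal? j segs
      ... | yes i = toggled-internal t∈ i
      ... | no ¬i = toggled-boundary j< t∈ ¬i

    -- Once the sums are interchanged, each merging position cancels separately by its own
    -- involution.
    gCycle-closed : ∀ D → pair (gCycle n la m d α) (incidence D) ≈ 0#
    gCycle-closed D = begin
      pair (gCycle n la m d α) (incidence D)
        ≈⟨ pair-gCycle d α (incidence D) ⟩
      sumK (λ t → termSign d α t ⊛ incidence D (termFace d α t)) (terms d α)
        ≈⟨ sumK-cong (All.tabulate expand) ⟩
      sumK (λ t → sumTo (length la) (λ j → summand j t)) (terms d α)
        ≈⟨ sumK-sumTo (length la) summand (terms d α) ⟩
      sumTo (length la) (λ j → sumK (summand j) (terms d α))
        ≈⟨ sumTo-zero (length la) vanish ⟩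
      0# ∎
      where
      summand : ℕ → Term → Carrier
      summand j t = termSign d α t ⊛ (signOf j ⊛ δ D (mergeAt j (termFace d α t)))
      expand : ∀ {t} → t ∈ terms d α → termSign d α t ⊛ incidence D (termFace d α t) ≈ sumTo (length la) (λ j → summand j t)
      expand {t} t∈ with terms⁻ d α t∈
      ... | γ∈ , w∈ rewrite Top.length-top (sigma-Top {d} w∈ (compose-↭ α↭ (colPerms-↭ n d γ∈))) = sumTo-* (length la) _ _
      vanish : ∀ {j} → j < length la → sumK (summand j) (terms d α) ≈ 0#
      vanish {j} j< = sumK-involution (summand j) (toggle d α j) (length (terms d α)) (terms d α) ≤-refl (terms-unique d α)
        (λ t∈ → Toggled.member (toggled j< t∈)) (λ {t} _ → toggle-involutive d α j t) flip
        (λ t∈ eq → contradiction eq (Toggled.moved (toggled j< t∈)))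
        where
        flip : ∀ {t} → t ∈ terms d α → summand j (toggle d α j t) ≈ - summand j t
        flip {t} t∈ = R.trans (R.*-cong (Toggled.sign T) (R.*-congˡ (R.reflexive (cong (δ D) (Toggled.merge T)))))
            (R.sym (-‿distribˡ-* _ _))
          where T = toggled j< t∈

-- The basis

∈⇒≤sum : ∀ {x xs} → x ∈ xs → x ≤ sum xs
∈⇒≤sum {xs = x ∷ xs} (here refl) = m≤m+n x (sum xs)
∈⇒≤sum {xs = x ∷ xs} (there p)   = ≤-trans (∈⇒≤sum p) (m≤n+m (sum xs) x)

unique-map-injective : ∀ {a b} {A : Set a} {B : Set b} (f : A → B) {xs p q} → Unique (map f xs) → p ∈ xs → q ∈ xs → f p
    ≡ f q → p ≡ q
unique-map-injective f _       (here refl) (here refl) _ = refl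
unique-map-injective f (n ∷ _) (here refl) (there q)   e = contradiction e (All.lookup n (∈-map⁺ f q))
unique-map-injective f (n ∷ _) (there p)   (here refl) e = contradiction (sym e) (All.lookup n (∈-map⁺ f p))
unique-map-injective f (_ ∷ u) (there p)   (there q)   e = unique-map-injective f u p q e

module Basis {c ℓ} (K : Field c ℓ) (n : ℕ) (la : List ℕ) (m : ℕ)
  (knap : IsKnapsack la) (total : sum la + m ≡ n) (m>0 : 0 < m) where

  open TopFaces n la m knap
  open Pivots n la m knap total m>0
  open ChainAlgebra K
  open Chains K
  open Cycles K n la m knap total m>0
  open R using (Carrier; _≈_; 0#; 1#; -_) renaming (_+_ to _⊕_; _*_ to _⊛_)
  open RingProperties R.ring using (-‿distribˡ-*; -‿distribʳ-*)
  open SetoidReasoning R.setoid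

  Index : Set
  Index = List ℕ × List ℕ

  g : Index → Chain
  g i = gCycle n la m (proj₁ i) (proj₂ i)

  sumK-single : ∀ {a} {A : Set a} {f : A → Carrier} {x xs} → Unique xs → x ∈ xs → (∀ {y} → y ∈ xs → y ≢ x → f y ≈ 0#) →
      sumK f xs ≈ f x
  sumK-single (n ∷ _) (here refl) z = R.trans (R.+-congˡ (sumK-zero (All.tabulate λ y∈ → z (there y∈) λ { refl →
      All.lookup n y∈ refl }))) (R.+-identityʳ _)
  sumK-single (n ∷ u) (there x∈)  z = R.trans (R.+-cong (z (here refl) λ { refl → All.lookup n x∈ refl }) (sumK-single
      u x∈ (z ∘ there))) (R.+-identityˡ _)

  unit-cancel : ∀ {a u} → u ⊛ u ≈ 1# → a ⊛ u ≈ 0# → a ≈ 0#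
  unit-cancel {a} {u} uu au = begin
    a           ≈⟨ R.sym (R.*-identityʳ a) ⟩
    a ⊛ 1#      ≈⟨ R.*-congˡ (R.sym uu) ⟩
    a ⊛ (u ⊛ u) ≈⟨ R.sym (R.*-assoc a u u) ⟩
    (a ⊛ u) ⊛ u ≈⟨ R.*-congʳ au ⟩
    0# ⊛ u      ≈⟨ R.zeroˡ u ⟩
    0#          ∎

  termSign-unit : ∀ d α t → termSign d α t ⊛ termSign d α t ≈ 1#
  termSign-unit d α (γ , w) = begin
    (a ⊛ b) ⊛ (a ⊛ b) ≈⟨ R.*-assoc a b _ ⟩
    a ⊛ (b ⊛ (a ⊛ b)) ≈⟨ R.*-congˡ (R.trans (R.sym (R.*-assoc b a b)) (R.trans (R.*-congʳ (R.*-comm b a)) (R.*-assoc a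
        b b))) ⟩
    a ⊛ (a ⊛ (b ⊛ b)) ≈⟨ R.*-congˡ (R.trans (R.*-congˡ (signOf-unit (segsInversions (proj₂ w)))) (R.*-identityʳ a)) ⟩
    a ⊛ a             ≈⟨ signOf-unit (inversions γ) ⟩
    1#                ∎
    where
    a = signOf (inversions γ)
    b = signW (proj₂ w)

  module Leads {d α : List ℕ} (L : Leading d α) where

    open Leading L

    leadTerm : Term
    leadTerm = upTo n , ε

    leadSign : Carrier
    leadSign = termSign d α leadTerm

    leadTerm-face : termFace d α leadTerm ≡ face
    leadTerm-face = cong (λ β → sigma β (proj₁ ε)) (compose-id α↭)

    coeff-terms : ∀ G → coeff (g (d , α)) G ≈ sumK (λ t → termSign d α t ⊛ δ G (termFace d α t)) (terms d α)
    coeff-terms G = R.trans (coeff-pair (gCycle n la m d α) G) (pair-gCycle d α (δ G))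

    coeff-lead : coeff (g (d , α)) face ≈ leadSign
    coeff-lead = begin
      coeff (g (d , α)) face
        ≈⟨ coeff-terms face ⟩
      sumK (λ t → termSign d α t ⊛ δ face (termFace d α t)) (terms d α)
        ≈⟨ sumK-single (terms-unique d α) (∈-cartesianProduct⁺ (id∈colPerms n d) ε∈W) others ⟩
      leadSign ⊛ δ face (termFace d α leadTerm)
        ≈⟨ R.*-congˡ (δ-≡ leadTerm-face) ⟩
      leadSign ⊛ 1#
        ≈⟨ R.*-identityʳ _ ⟩
      leadSign ∎
      where
      others : ∀ {t} → t ∈ terms d α → t ≢ leadTerm → termSign d α t ⊛ δ face (termFace d α t) ≈ 0#
      others t∈ ne with terms⁻ d α t∈
      ... | γ∈ , w∈ with term-key γ∈ w∈
      ...   | inj₁ (refl , refl) = contradiction refl ne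
      ...   | inj₂ lt            = R.trans (R.*-congˡ (δ-≢ λ eq → <⇒≢ lt (cong key eq))) (R.zeroʳ _)

    -- Stated for words only: independence compares index permutations, and size lists do not enter.
    coeff-zero : ∀ {G} → ¬ (concat G ⊑ α) → coeff (g (d , α)) G ≈ 0#
    coeff-zero {G} ¬⊑ = R.trans (coeff-terms G) (sumK-zero {xs = terms d α} (All.tabulate vanish))
      where
      vanish : ∀ {t} → t ∈ terms d α → termSign d α t ⊛ δ G (termFace d α t) ≈ 0#
      vanish t∈ with terms⁻ d α t∈
      ... | γ∈ , w∈ with term-⊑ γ∈ w∈
      ...   | s₁ , s₂ = R.trans (R.*-congˡ (δ-≢ λ { refl → ¬⊑ (⊑-trans s₁ s₂) })) (R.zeroʳ _)

    g-Top : All (λ p → Top (proj₂ p)) (g (d , α))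
    g-Top rewrite gCycle-terms d α = Allₚ.map⁺ (All.tabulate λ t∈ →
      sigma-Top {d} (proj₂ (terms⁻ d α t∈)) (compose-↭ α↭ (colPerms-↭ n d (proj₁ (terms⁻ d α t∈)))))

    g-key : All (λ p → proj₂ p ≡ face ⊎ key (proj₂ p) < key face) (g (d , α))
    g-key rewrite gCycle-terms d α = Allₚ.map⁺ (All.tabulate λ t∈ → bound (terms⁻ d α t∈))
      where
      bound : ∀ {t} → proj₁ t ∈ colPerms n d × proj₂ t ∈ Wpairs la m d → termFace d α t ≡ face ⊎ key (termFace d α t) <
          key face
      bound (γ∈ , w∈) with term-key γ∈ w∈
      ... | inj₁ (refl , refl) = inj₁ leadTerm-face
      ... | inj₂ lt            = inj₂ lt

  g-closed : ∀ {i} → GIndex n la m i → ∀ D → pair (g i) (incidence D) ≈ 0#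
  g-closed (v@(_ , ds , refl , _) , α↭ , _) = gCycle-closed {ds} v α↭

  cycles : ∀ i → GIndex n la m i → ChainIn (ΛFace n la m) (suc (length la)) (g i) × IsZeroChain (∂ (g i))
  cycles i idx = All.map (λ t → Top⇒Λ t , Top.length-top t) (Leads.g-Top (GIndex⇒Leading idx)) ,
    λ D → R.trans (coeff-∂ (g i) D) (g-closed idx D)

  no-boundaries : ∀ {b} → ChainIn (ΛFace n la m) (suc (suc (length la))) b → b ≡ []
  no-boundaries []            = refl
  no-boundaries ((f , e) ∷ _) = contradiction e (no-larger-face f)

  -- Descending induction on the inversions of α. At the leading face of (d, α), indices with more
  -- inversions contribute nothing by induction; for any other α′ different from α, the word α is
  -- not below α′.
  independent : ∀ (xs : List (Carrier × Index)) → All (λ p → GIndex n la m (proj₂ p)) xs → Unique (map proj₂ xs) →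
    (∀ G → coeff (combo g xs) G ≈ 0#) → All (λ p → proj₁ p ≈ 0#) xs
  independent xs idx uniq zero-combo = All.tabulate λ p∈ → vanish bound p∈ (m≤n+m bound _)
    where
    wordInversions : Carrier × Index → ℕ
    wordInversions p = inversions (proj₂ (proj₂ p))
    bound : ℕ
    bound = suc (sum (map wordInversions xs))
    sum-zero : ∀ G → sumK (λ p → proj₁ p ⊛ coeff (g (proj₂ p)) G) xs ≈ 0#
    sum-zero G = begin
      sumK (λ p → proj₁ p ⊛ coeff (g (proj₂ p)) G) xs
        ≈⟨ sumK-cong {xs = xs} (All.tabulate λ {p} _ → R.*-congˡ (coeff-pair (g (proj₂ p)) G)) ⟩
      sumK (λ p → proj₁ p ⊛ pair (g (proj₂ p)) (δ G)) xs
        ≈⟨ R.sym (pair-combo g xs (δ G)) ⟩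
      pair (combo g xs) (δ G)
        ≈⟨ R.sym (coeff-pair (combo g xs) G) ⟩
      coeff (combo g xs) G
        ≈⟨ zero-combo G ⟩
      0# ∎
    -- `t` measures the distance to `bound`, which exceeds every inversion number that occurs.
    vanish : ∀ t {p} → p ∈ xs → bound ≤ wordInversions p + t → proj₁ p ≈ 0#
    vanish zero    {p} p∈ le = contradiction (∈⇒≤sum (∈-map⁺ wordInversions p∈)) (<⇒≱ (≤-trans le (≤-reflexive
        (+-identityʳ _))))
    vanish (suc t) {a , d , α} p∈ le = unit-cancel (termSign-unit d α (Leads.leadTerm L)) (begin
      a ⊛ Leads.leadSign L                                     ≈⟨ R.*-congˡ (R.sym (Leads.coeff-lead L)) ⟩
      a ⊛ coeff (g (d , α)) G                                  ≈⟨ R.sym (sumK-single (Uniqueₚ.map⁻ uniq) p∈ others) ⟩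
      sumK (λ p → proj₁ p ⊛ coeff (g (proj₂ p)) G) xs          ≈⟨ sum-zero G ⟩
      0#                                                       ∎)
      where
      L = GIndex⇒Leading (All.lookup idx p∈)
      G = Leading.face L
      others : ∀ {q} → q ∈ xs → q ≢ (a , d , α) → proj₁ q ⊛ coeff (g (proj₂ q)) G ≈ 0#
      others {a′ , d′ , α′} q∈ ne with inversions α <? inversions α′
      ... | yes lt = R.trans (R.*-congʳ (vanish t q∈ (≤-trans le (≤-trans (≤-reflexive (+-suc _ t)) (+-monoˡ-≤ t
          lt))))) (R.zeroˡ _)
      ... | no ≮   = R.trans (R.*-congˡ (Leads.coeff-zero (GIndex⇒Leading (All.lookup idx q∈)) ¬⊑)) (R.zeroʳ _)
        where
        ¬⊑ : ¬ (concat G ⊑ α′)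
        ¬⊑ h with subst (_⊑ α′) (Leading.sigma-word L (Leading.ε∈W L)) h
        ... | _ , inj₁ lt   = ≮ lt
        -- With α′ = α the descent composition makes the indices equal, and indices do not repeat in
        -- `xs`.
        ... | _ , inj₂ refl = ne (unique-map-injective proj₂ uniq q∈ p∈ (cong (_, α)
          (trans (sym (proj₂ (proj₂ (All.lookup idx q∈)))) (proj₂ (proj₂ (All.lookup idx p∈))))))

  -- By the knapsack property this facet can arise from a top face at one position only, so a single
  -- term of the incidence sum survives.
  incidence-at : ∀ {F F′} (np : NonPivot F) → Top F → Top F′ → let j = nonPivot-index np in
    incidence (mergeAt j F) F′ ≈ signOf j ⊛ δ (mergeAt j F) (mergeAt j F′)
  incidence-at {F} {F′} np t t′ rewrite Top.length-top t′ = sumTo-single (nonPivot-index< np t) λ i< i≢j →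
    R.trans (R.*-congˡ (δ-≢ λ eq → i≢j (merge-position t′ t i< (nonPivot-index< np t) eq))) (R.zeroʳ _)

  -- Apart from `F`, only faces of larger key contribute to the boundary coefficient at `D`, and `z`
  -- contains none of those.
  nonPivot-coeff : ∀ {F z} → NonPivot F → Top F → All (λ p → Top (proj₂ p) × key (proj₂ p) ≤ key F) z →
    (∀ D → pair z (incidence D) ≈ 0#) → coeff z F ≈ 0#
  nonPivot-coeff {F} {z} np t tops closed = unit-cancel (signOf-unit j) (begin
    coeff z F ⊛ signOf j                                              ≈⟨ R.*-congˡ (R.sym inc) ⟩
    coeff z F ⊛ incidence D F                                         ≈⟨ R.sym (R.+-identityʳ _) ⟩
    coeff z F ⊛ incidence D F ⊕ 0#                                    ≈⟨ R.+-congˡ (R.sym (pair-zero (remove F z) others)) ⟩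
    coeff z F ⊛ incidence D F ⊕ pair (remove F z) (incidence D)       ≈⟨ R.sym (pair-remove F z (incidence D)) ⟩
    pair z (incidence D)                                              ≈⟨ closed D ⟩
    0#                                                                ∎)
    where
    j = nonPivot-index np
    D = mergeAt j F
    inc : incidence D F ≈ signOf j
    inc = R.trans (incidence-at np t t) (R.trans (R.*-congˡ (δ-≡ refl)) (R.*-identityʳ _))
    others : All (λ p → incidence D (proj₂ p) ≈ 0#) (remove F z)
    others = All.tabulate λ {p} p∈ → let p∈z , ne = ∈-filter⁻ (λ p → ¬? (proj₂ p ≟F F)) {xs = z} p∈ in vanish p∈z ne
      where
      vanish : ∀ {p} → p ∈ z → proj₂ p ≢ F → incidence D (proj₂ p) ≈ 0#
      vanish {p} p∈ ne with All.lookup tops p∈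
      ... | t′ , le = R.trans (incidence-at np t t′) (R.trans (R.*-congˡ (δ-≢ differs)) (R.zeroʳ _))
        where
        differs : mergeAt j (proj₂ p) ≢ D
        differs eq with nonPivot-minimal np t t′ (sym eq)
        ... | inj₁ e  = ne (sym e)
        ... | inj₂ lt = contradiction lt (≤⇒≯ le)

  -- Agreement is required under all pairings, the form in which elimination steps compose; `δ G`
  -- gives back coefficients.
  Spanned : Chain → Set (c Level.⊔ ℓ)
  Spanned z = ∃ λ (xs : List (Carrier × Index)) → All (λ p → GIndex n la m (proj₂ p)) xs × (∀ φ → pair z φ ≈ pair
      (combo g xs) φ)

  -- Positivity of `m` covers the pointed block.
  top-nonempty : ∀ {F} → Top F → All NonEmpty F
  top-nonempty {F} t = Allₚ.map⁻ (subst (All (0 <_)) (sym (Top.shape t)) (Allₚ.++⁺ (All-resp-↭ (↭-sym (Top.sizes↭ t))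
      (proj₁ knap)) (m>0 ∷ [])))

  pivot-or-not : ∀ {F} → Top F → NonPivot F ⊎ PivotRows F
  pivot-or-not {[]}    t = contradiction (Top.length-top t) λ ()
  pivot-or-not {C ∷ F} t = pivot? C F (top-nonempty t) (Top.asc t)

  remove-All : ∀ {p} {P : Face → Set p} F z → All (λ q → P (proj₂ q) ⊎ proj₂ q ≡ F) z → All (P ∘ proj₂) (remove F z)
  remove-All {P = P} F z h = All.tabulate λ q∈ → let q∈z , ne = ∈-filter⁻ (λ p → ¬? (proj₂ p ≟F F)) {xs = z} q∈ in go (All.lookup h q∈z) ne
    where
    go : ∀ {G} → P G ⊎ G ≡ F → G ≢ F → P G
    go (inj₁ p) _  = p
    go (inj₂ e) ne = contradiction e ne

  -- Fs lists the faces of key v that are not yet eliminated from z.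
  span-level : ∀ v Fs z → All (λ F → Top F × key F ≡ v) Fs →
    All (λ p → Top (proj₂ p) × (key (proj₂ p) < v ⊎ proj₂ p ∈ Fs)) z → (∀ D → pair z (incidence D) ≈ 0#) →
    (∀ z′ → All (λ p → Top (proj₂ p) × key (proj₂ p) < v) z′ → (∀ D → pair z′ (incidence D) ≈ 0#) → Spanned z′) → Spanned z
  span-level v []       z _                    hz closed lower = lower z (All.map (λ { (t , inj₁ lt) → t , lt ; (t ,
      inj₂ ()) }) hz) closed
  span-level v (F ∷ Fs) z ((t , refl) ∷ hF) hz closed lower = go (pivot-or-not t)
    where
    rest-z : All (λ p → Top (proj₂ p) × (key (proj₂ p) < v ⊎ proj₂ p ∈ Fs)) (remove F z)
    rest-z = remove-All {P = λ G → Top G × (key G < v ⊎ G ∈ Fs)} F z (All.map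
      (λ { (t , inj₁ lt) → inj₁ (t , inj₁ lt) ; (t , inj₂ (here e)) → inj₂ e ; (t , inj₂ (there p)) → inj₁ (t , inj₂ p)
          }) hz)
    bounded : All (λ p → Top (proj₂ p) × key (proj₂ p) ≤ key F) z
    bounded = All.map (λ { (t , inj₁ lt) → t , <⇒≤ lt ; (t , inj₂ (here refl)) → t , ≤-refl
                         ; (t , inj₂ (there p)) → t , ≤-reflexive (proj₂ (All.lookup hF p)) }) hz
    go : NonPivot F ⊎ PivotRows F → Spanned z
    -- A non-pivot has coefficient zero at this stage, so its entries can simply be dropped.
    go (inj₁ np) = proj₁ ih , proj₁ (proj₂ ih) , λ φ → R.trans (same φ) (proj₂ (proj₂ ih) φ)
      where
      same : ∀ φ → pair z φ ≈ pair (remove F z) φ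
      same φ = R.trans (pair-remove F z φ) (R.trans (R.+-congʳ (R.trans (R.*-congʳ (nonPivot-coeff np t bounded
          closed)) (R.zeroˡ _))) (R.+-identityˡ _))
      ih = span-level v Fs (remove F z) hF rest-z (λ D → R.trans (R.sym (same (incidence D))) (closed D)) lower
    go (inj₂ pr) with pivot-index t pr
    ... | d , α , idx , refl = (a , d , α) ∷ proj₁ ih , idx ∷ proj₁ (proj₂ ih) , λ φ → begin
        pair z φ                                                   ≈⟨ split φ ⟩
        a ⊛ pair (g (d , α)) φ ⊕ pair z′ φ                         ≈⟨ R.+-cong (R.sym (pair-scale a (g (d , α)) φ))
            (proj₂ (proj₂ ih) φ) ⟩
        pair (scale a (g (d , α))) φ ⊕ pair (combo g (proj₁ ih)) φ ≈⟨ R.sym (sumK-++ _ (scale a (g (d , α))) _) ⟩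
        pair (combo g ((a , d , α) ∷ proj₁ ih)) φ                  ∎
      where
      L = GIndex⇒Leading idx
      u = Leads.leadSign L
      c₀ = coeff z F
      -- The leading sign is its own inverse, so this is division by it.
      a = c₀ ⊛ u
      gF = remove F (g (d , α))
      -- `F` is deleted from both chains before subtracting. Its coefficients would cancel anyway,
      -- and now it no longer occurs in the list.
      z′ = remove F z ++ scale (- a) gF
      expand-g : ∀ φ → a ⊛ pair (g (d , α)) φ ≈ c₀ ⊛ φ F ⊕ a ⊛ pair gF φ
      expand-g φ = begin
        a ⊛ pair (g (d , α)) φ                         ≈⟨ R.*-congˡ (R.trans (pair-remove F (g (d , α)) φ) (R.+-congʳ
            (R.*-congʳ (Leads.coeff-lead L)))) ⟩
        a ⊛ (u ⊛ φ F ⊕ pair gF φ)                      ≈⟨ R.distribˡ a _ _ ⟩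
        a ⊛ (u ⊛ φ F) ⊕ a ⊛ pair gF φ                  ≈⟨ R.+-congʳ (R.trans (R.sym (R.*-assoc a u (φ F))) (R.*-congʳ
            (R.*-assoc c₀ u u))) ⟩
        (c₀ ⊛ (u ⊛ u)) ⊛ φ F ⊕ a ⊛ pair gF φ           ≈⟨ R.+-congʳ (R.*-congʳ (R.trans (R.*-congˡ (termSign-unit d α
            (Leads.leadTerm L))) (R.*-identityʳ c₀))) ⟩
        c₀ ⊛ φ F ⊕ a ⊛ pair gF φ                       ∎
      split : ∀ φ → pair z φ ≈ a ⊛ pair (g (d , α)) φ ⊕ pair z′ φ
      split φ = R.sym (begin
        a ⊛ pair (g (d , α)) φ ⊕ pair z′ φ
          ≈⟨ R.+-cong (expand-g φ) (R.trans (sumK-++ _ (remove F z) _) (R.+-congˡ (R.trans (pair-scale (- a) gF φ)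
              (R.sym (-‿distribˡ-* a _))))) ⟩
        (c₀ ⊛ φ F ⊕ a ⊛ pair gF φ) ⊕ (pair (remove F z) φ ⊕ (- (a ⊛ pair gF φ)))
          ≈⟨ +-exchange _ _ _ _ ⟩
        (c₀ ⊛ φ F ⊕ pair (remove F z) φ) ⊕ (a ⊛ pair gF φ ⊕ (- (a ⊛ pair gF φ)))
          ≈⟨ R.+-cong (R.sym (pair-remove F z φ)) (R.-‿inverseʳ _) ⟩
        pair z φ ⊕ 0#
          ≈⟨ R.+-identityʳ _ ⟩
        pair z φ ∎)
      closed′ : ∀ D → pair z′ (incidence D) ≈ 0#
      closed′ D = begin
        pair z′ (incidence D)                                                ≈⟨ R.sym (R.+-identityˡ _) ⟩
        0# ⊕ pair z′ (incidence D)                                           ≈⟨ R.+-congʳ (R.sym (R.trans (R.*-congˡ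
            (g-closed idx D)) (R.zeroʳ a))) ⟩
        a ⊛ pair (g (d , α)) (incidence D) ⊕ pair z′ (incidence D)           ≈⟨ R.sym (split (incidence D)) ⟩
        pair z (incidence D)                                                 ≈⟨ closed D ⟩
        0#                                                                   ∎
      rest-g : All (λ p → Top (proj₂ p) × (key (proj₂ p) < v ⊎ proj₂ p ∈ Fs)) gF
      rest-g = remove-All {P = λ G → Top G × (key G < v ⊎ G ∈ Fs)} F (g (d , α))
        (All.zipWith (λ { (t , inj₁ e) → inj₂ e ; (t , inj₂ lt) → inj₁ (t , inj₁ lt) }) (Leads.g-Top L , Leads.g-key L))
      ih = span-level v Fs z′ hF (Allₚ.++⁺ rest-z (Allₚ.map⁺ rest-g)) closed′ lower

  -- Induction on a strict bound for the keys; each stage clears the faces with the largest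
  -- admissible key.
  spanned : ∀ v z → All (λ p → Top (proj₂ p) × key (proj₂ p) < v) z → (∀ D → pair z (incidence D) ≈ 0#) → Spanned z
  spanned zero    []             _              _ = [] , [] , λ φ → R.refl
  spanned zero    (_ ∷ _)        ((_ , ()) ∷ _) _
  spanned (suc v) z              h         closed = span-level v level z
    (All.tabulate λ F∈ → level-Top F∈) (All.tabulate λ p∈ → cases p∈ (All.lookup h p∈)) closed (spanned v)
    where
    -- A face may recur here; at its later turns its coefficient is already zero.
    level = filter (λ F → key F ≟ v) (map proj₂ z)
    level-Top : ∀ {F} → F ∈ level → Top F × key F ≡ v
    level-Top F∈ with ∈-filter⁻ (λ F → key F ≟ v) {xs = map proj₂ z} F∈
    ... | F∈z , e with ∈-map⁻ proj₂ F∈z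
    ...   | p , p∈ , refl = proj₁ (All.lookup h p∈) , e
    cases : ∀ {p} → p ∈ z → Top (proj₂ p) × key (proj₂ p) < suc v → Top (proj₂ p) × (key (proj₂ p) < v ⊎ proj₂ p ∈ level)
    cases p∈ (t , s≤s le) with m≤n⇒m<n∨m≡n le
    ... | inj₁ lt = t , inj₁ lt
    ... | inj₂ e  = t , inj₂ (∈-filter⁺ (λ F → key F ≟ v) (∈-map⁺ proj₂ p∈) e)

  homologyBasis : HomologyBasis (ΛFace n la m) (suc (length la)) (GIndex n la m) g
  homologyBasis = cycles , relations , generators
    where
    relations : ∀ (xs : List (Carrier × Index)) (b : Chain) → All (λ p → GIndex n la m (proj₂ p)) xs → Unique (map
        proj₂ xs) →
      ChainIn (ΛFace n la m) (suc (suc (length la))) b → combo g xs ≈ᶜ ∂ b → All (λ p → proj₁ p ≈ 0#) xs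
    relations xs b idx uniq hb eq with no-boundaries hb
    ... | refl = independent xs idx uniq eq
    generators : ∀ (z : Chain) → ChainIn (ΛFace n la m) (suc (length la)) z → IsZeroChain (∂ z) →
      ∃₂ λ (xs : List (Carrier × Index)) (b : Chain) → All (λ p → GIndex n la m (proj₂ p)) xs ×
        ChainIn (ΛFace n la m) (suc (suc (length la))) b × z ≈ᶜ (combo g xs ++ ∂ b)
    generators z hz closed with spanned (suc (sum (map (key ∘ proj₂) z))) z
      (All.tabulate λ p∈ → Λ⇒Top (proj₁ (All.lookup hz p∈)) (proj₂ (All.lookup hz p∈)) , s≤s (∈⇒≤sum (∈-map⁺ (key ∘
          proj₂) p∈)))
      (λ D → R.trans (R.sym (coeff-∂ z D)) (closed D))
    -- In top dimension the boundary witness is empty: the cycle itself is a combination.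
    ... | xs , idx , eq = xs , [] , idx , [] , λ G → begin
      coeff z G                 ≈⟨ coeff-pair z G ⟩
      pair z (δ G)              ≈⟨ eq (δ G) ⟩
      pair (combo g xs) (δ G)   ≈⟨ R.sym (coeff-pair (combo g xs) G) ⟩
      coeff (combo g xs) G      ≡⟨ cong (λ y → coeff y G) (sym (++-identityʳ (combo g xs))) ⟩
      coeff (combo g xs ++ []) G ∎

theorem9p4 : ∀ {c ℓ} (K : Field c ℓ) (n : ℕ) (la : List ℕ) (m : ℕ) →
    IsKnapsack la → sum la + m ≡ n → 0 < m →
    Chains.HomologyBasis K (ΛFace n la m) (suc (length la)) (GIndex n la m)
    (λ { (d , α) → Chains.gCycle K n la m d α })
theorem9p4 K n la m knap total m>0 = Basis.homologyBasis K n la m knap total m>0
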